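{- Let $(x_n)_{n\in\mathbb{Z}}$ be the sequence of rational functions in two indeterminates $x_1,x_2$ determined by $x_nx_{n-2}=x_{n-1}+1$ for all odd $n\in\mathbb{Z}$ and $x_nx_{n-2}=x_{n-1}^4+1$ for all even $n\in\mathbb{Z}$ (the case $(b,c)=(1,4)$). Then for every integer $n\ne 1,2$, $$x_n(x_1,x_2)=\frac{p_n(x_1,x_2)}{m_n(x_1,x_2)},\qquad m_n(x_1,x_2)=x_1^{sq(n)}x_2^{oct(n)},$$ where $p_n(x_1,x_2)$ is the sum of the weights of all perfect matchings of the weighted graph $G_n$ defined in the context, and $$sq(n)=\begin{cases}|n-1|-1 & n\text{ odd}\\ |2n-2|-2 & n\text{ even}\end{cases}\qquad oct(n)=\begin{cases}\left|\tfrac n2-1\right|-\tfrac12 & n\text{ odd}\\ |n-2|-1 & n\text{ even.}\end{cases}$$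
   Context: A perfect matching of a graph is a set $S$ of edges such that each vertex belongs to exactly one edge of $S$; its weight is the product of the weights of its edges. Building blocks. An octagon is an 8-cycle with vertices, in clockwise order, $nl,nr,et,eb,sr,sl,wb,wt$. Its north edge $nl\,nr$, east edge $et\,eb$, south edge $sr\,sl$ and west edge $wb\,wt$ have weight $1$; the four remaining edges (diagonals) $nr\,et$, $eb\,sr$, $sl\,wb$, $wt\,nl$ have weight $x_1$. Attaching a north square to an octagon means adding two new vertices $u,v$ and the edges $nl\,u$, $u\,v$, $v\,nr$; attaching a south square means adding new vertices $u,v$ and the edges $sl\,u$, $u\,v$, $v\,sr$. The two edges joining new to old vertices are the vertical edges of the square; exactly one of them has weight $x_2$ (chosen to be one not incident with any of the arcs below; either one if neither is incident with an arc), and the other added edges have weight $1$. Attaching an end square on the east (resp. west) means adding new vertices $u,v$ and the edges $et\,u$, $u\,v$, $v\,eb$ (resp. $wt\,u$, $u\,v$, $v\,wb$); one (either one) of the two edges joining new to old vertices has weight $x_2$ and the other two added edges have weight $1$. Connecting an octagon $O$ (left) to an octagon $O'$ (right) by a connecting square means adding the top edge $et(O)\,wt(O')$ and the bottom edge $eb(O)\,wb(O')$; one of these has weight $x_2$, as specified below, and the other has weight $1$. An arc is an additional edge of weight $1$. The graphs $G_n$. (a) $G_3$ is a single square (4-cycle) with one edge of weight $x_2$ and three edges of weight $1$. For $k\ge1$, $G_{2k+3}$ has octagons $O_1,\dots,O_k$ arranged from right to left; $O_i$ has a south square if $i$ is odd and a north square if $i$ is even; $O_1$ has an east end square and $O_k$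 a west end square; for $1\le i<k$, $O_i$ and $O_{i+1}$ are connected by a connecting square whose $x_2$-edge is the top edge if $i$ is odd and the bottom edge if $i$ is even; and for $1\le i<k$ there is an arc joining $v_i$ and $v_{i+1}$, where $v_i=sr(O_i)$ for $i$ odd and $v_i=nr(O_i)$ for $i$ even. (d) For $k\ge1$, $G_{ -2k+1}$ has octagons $O_1,\dots,O_k$ arranged from right to left; $O_i$ has a north square if $i$ is odd and a south square if $i$ is even; there are no end squares; for $1\le i<k$, $O_i$ and $O_{i+1}$ are connected by a connecting square whose $x_2$-edge is the top edge if $i$ is odd and the bottom edge if $i$ is even; and for $1\le i<k$ there is an arc joining $v_i$ and $v_{i+1}$, where $v_i=nl(O_i)$ for $i$ odd and $v_i=sl(O_i)$ for $i$ even. (b) For $k\ge1$, $G_{2k+2}$ has octagons $O_{ -(k-1)},\dots,O_{k-1}$ arranged from left to right, consecutive ones connected by connecting squares. $O_0$ has both a north and a south square; for $1\le i\le k-1$, $O_i$ has a north square if $i$ is odd and a south square if $i$ is even, and $O_{ -i}$ has a south square if $i$ is odd and a north square if $i$ is even; $O_{k-1}$ has an east end square and $O_{ -(k-1)}$ a west end square. For $1\le i\le k-1$: the connecting square between $O_{i-1}$ and $O_i$ has its top edge of weight $x_2$ if $i$ is odd and its bottom edge if $i$ is even; the connecting square between $O_{ -i}$ and $O_{ -i+1}$ has its bottom edge of weight $x_2$ if $i$ is odd and its top edge if $i$ is even; there is an arc $v_{i-1}v_i$ and an arc $u_{i-1}u_i$, where $v_0=sl(O_0)$, $u_0=nr(O_0)$,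 and for $j\ge1$: $v_j=nl(O_j)$, $u_j=sr(O_{ -j})$ if $j$ is odd, and $v_j=sl(O_j)$, $u_j=nr(O_{ -j})$ if $j$ is even. (c) For $k\ge1$, $G_{ -2k+2}$ has octagons $O_{ -(k-1)},\dots,O_{k-1}$ arranged from left to right, consecutive ones connected by connecting squares. $O_0$ has no north or south square; for $1\le i\le k-1$, $O_i$ has a north square if $i$ is odd and a south square if $i$ is even, and $O_{ -i}$ has a south square if $i$ is odd and a north square if $i$ is even; there are no end squares. For $1\le i\le k-1$: the connecting square between $O_{i-1}$ and $O_i$ has its bottom edge of weight $x_2$ if $i$ is odd and its top edge if $i$ is even; the connecting square between $O_{ -i}$ and $O_{ -i+1}$ has its top edge of weight $x_2$ if $i$ is odd and its bottom edge if $i$ is even; there is an arc $v_{i-1}v_i$ and an arc $u_{i-1}u_i$, where $v_0=sr(O_0)$, $u_0=nl(O_0)$, and for $j\ge1$: $v_j=nr(O_j)$, $u_j=sl(O_{ -j})$ if $j$ is odd, and $v_j=sr(O_j)$, $u_j=nl(O_{ -j})$ if $j$ is even. -}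

module Defs where

open import Algebra.Bundles using (CommutativeRing; RawSemiring; Semiring)
import Algebra.Definitions.RawSemiring as RawSemiringDefs
import Algebra.Properties.Ring as RingProperties
open import Data.Fin.Base using (Fin)
import Data.Fin.Properties as Fin
open import Data.Fin.Patterns using (0F; 1F; 2F; 3F)
open import Data.Integer.Base as ℤ using (ℤ; +_; ∣_∣)
import Data.Integer.Properties as ℤ
open import Data.List.Base using (List; []; _∷_; _++_; map; concatMap; filter; foldr; length; upTo; allFin)
open import Data.List.Relation.Unary.All using (All; all?)
open import Data.Nat.Base as ℕ using (ℕ; zero; suc; _∸_; ⌊_/2⌋; parity)
import Data.Nat.Properties as ℕ
open import Data.Parity.Base using (0ℙ; 1ℙ)
open import Data.Product.Base using (_×_; _,_)
open import Data.Sum.Base using (_⊎_; inj₁; inj₂; [_,_]′; map₁; map₂)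
open import Level using (0ℓ)
open import Relation.Binary.Bundles using (Setoid)
open import Relation.Binary.Core using (Rel)
open import Relation.Binary.Definitions using (DecidableEquality)
open import Relation.Binary.PropositionalEquality using (_≡_; refl; sym; trans; cong; cong₂)
import Relation.Binary.Reasoning.Setoid as SetoidReasoning
open import Relation.Nullary using (¬_; Dec; yes; no)
open import Relation.Nullary.Decidable using (map′; _×-dec_; _⊎-dec_)

record IntegralDomain : Set₁ where
  field
    commutativeRing : CommutativeRing 0ℓ 0ℓ
  open CommutativeRing commutativeRing public
  field
    1≉0            : ¬ (1# ≈ 0#)
    noZeroDivisors : ∀ x y → x * y ≈ 0# → x ≈ 0# ⊎ y ≈ 0#

  *-nonzero : ∀ {x y} → ¬ (x ≈ 0#) → ¬ (y ≈ 0#) → ¬ (x * y ≈ 0#)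
  *-nonzero x≉0 y≉0 xy≈0 = [ x≉0 , y≉0 ]′ (noZeroDivisors _ _ xy≈0)

  open RawSemiringDefs (Semiring.rawSemiring semiring) public using (_^_)

  ^-nonzero : ∀ {x} n → ¬ (x ≈ 0#) → ¬ (x ^ n ≈ 0#)
  ^-nonzero zero    x≉0 = 1≉0
  ^-nonzero (suc n) x≉0 = *-nonzero x≉0 (^-nonzero n x≉0)

-- Univariate polynomials as coefficient lists, constant term first;
-- trailing zeros are allowed, so equality is coefficientwise.

module Polynomials (D : IntegralDomain) where
  private module R = IntegralDomain D
  open RingProperties R.ring using (-0#≈0#)

  Poly : Set
  Poly = List R.Carrier

  coeff : Poly → ℕ → R.Carrier
  coeff []      i       = R.0#
  coeff (a ∷ p) zero    = a
  coeff (a ∷ p) (suc i) = coeff p i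

  infix  4 _≈_
  infixl 6 _+_
  infixl 7 _*_
  infixr 8 -_

  record _≈_ (p q : Poly) : Set where
    constructor coeffwise
    field at : ∀ i → coeff p i R.≈ coeff q i
  open _≈_ public

  0# : Poly
  0# = []

  1# : Poly
  1# = R.1# ∷ []

  X : Poly
  X = R.0# ∷ R.1# ∷ []

  _+_ : Poly → Poly → Poly
  []      + q       = q
  (a ∷ p) + []      = a ∷ p
  (a ∷ p) + (b ∷ q) = (a R.+ b) ∷ (p + q)

  -_ : Poly → Poly
  - p = map R.-_ p

  scale : R.Carrier → Poly → Poly
  scale a = map (a R.*_)

  shift : Poly → Poly
  shift p = R.0# ∷ p

  _*_ : Poly → Poly → Poly
  []      * q = []
  (a ∷ p) * q = scale a q + shift (p * q)

  coeff-+ : ∀ p q i → coeff (p + q) i R.≈ coeff p i R.+ coeff q i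
  coeff-+ []      q       i       = R.sym (R.+-identityˡ _)
  coeff-+ (a ∷ p) []      i       = R.sym (R.+-identityʳ _)
  coeff-+ (a ∷ p) (b ∷ q) zero    = R.refl
  coeff-+ (a ∷ p) (b ∷ q) (suc i) = coeff-+ p q i

  coeff-neg : ∀ p i → coeff (- p) i R.≈ R.- coeff p i
  coeff-neg []      i       = R.sym -0#≈0#
  coeff-neg (a ∷ p) zero    = R.refl
  coeff-neg (a ∷ p) (suc i) = coeff-neg p i

  coeff-scale : ∀ a p i → coeff (scale a p) i R.≈ a R.* coeff p i
  coeff-scale a []      i       = R.sym (R.zeroʳ a)
  coeff-scale a (b ∷ p) zero    = R.refl
  coeff-scale a (b ∷ p) (suc i) = coeff-scale a p i

  ≈-refl : ∀ {p} → p ≈ p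
  ≈-refl = coeffwise λ i → R.refl

  ≈-sym : ∀ {p q} → p ≈ q → q ≈ p
  ≈-sym e = coeffwise λ i → R.sym (at e i)

  ≈-trans : ∀ {p q r} → p ≈ q → q ≈ r → p ≈ r
  ≈-trans e f = coeffwise λ i → R.trans (at e i) (at f i)

  ∷-cong : ∀ {a b p q} → a R.≈ b → p ≈ q → (a ∷ p) ≈ (b ∷ q)
  ∷-cong e f = coeffwise λ { zero → e ; (suc i) → at f i }

  ∷-zero : ∀ {a p} → a R.≈ R.0# → p ≈ [] → (a ∷ p) ≈ []
  ∷-zero e f = coeffwise λ { zero → e ; (suc i) → at f i }

  tail-≈ : ∀ {a b p q} → (a ∷ p) ≈ (b ∷ q) → p ≈ q
  tail-≈ e = coeffwise λ i → at e (suc i)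

  tail-zero : ∀ {a p} → (a ∷ p) ≈ [] → p ≈ []
  tail-zero e = coeffwise λ i → at e (suc i)

  private
    setoid : Setoid 0ℓ 0ℓ
    setoid = record
      { Carrier = Poly ; _≈_ = _≈_
      ; isEquivalence = record { refl = ≈-refl ; sym = ≈-sym ; trans = ≈-trans } }
    open SetoidReasoning setoid

  +-cong : ∀ {p p′ q q′} → p ≈ p′ → q ≈ q′ → p + q ≈ p′ + q′
  +-cong {p} {p′} {q} {q′} e f = coeffwise λ i →
    R.trans (coeff-+ p q i) (R.trans (R.+-cong (at e i) (at f i)) (R.sym (coeff-+ p′ q′ i)))

  +-assoc : ∀ p q r → (p + q) + r ≈ p + (q + r)
  +-assoc p q r = coeffwise λ i →
    R.trans (coeff-+ (p + q) r i) (R.trans (R.+-congʳ (coeff-+ p q i)) (R.trans (R.+-assoc _ _ _)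
      (R.sym (R.trans (coeff-+ p (q + r) i) (R.+-congˡ (coeff-+ q r i))))))

  +-comm : ∀ p q → p + q ≈ q + p
  +-comm p q = coeffwise λ i →
    R.trans (coeff-+ p q i) (R.trans (R.+-comm _ _) (R.sym (coeff-+ q p i)))

  +-identityˡ : ∀ p → [] + p ≈ p
  +-identityˡ p = ≈-refl

  +-identityʳ : ∀ p → p + [] ≈ p
  +-identityʳ p = +-comm p []

  neg-cong : ∀ {p q} → p ≈ q → - p ≈ - q
  neg-cong {p} {q} e = coeffwise λ i →
    R.trans (coeff-neg p i) (R.trans (R.-‿cong (at e i)) (R.sym (coeff-neg q i)))

  neg-inverseʳ : ∀ p → p + - p ≈ []
  neg-inverseʳ p = coeffwise λ i →
    R.trans (coeff-+ p (- p) i) (R.trans (R.+-congˡ (coeff-neg p i)) (R.-‿inverseʳ _))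

  neg-inverseˡ : ∀ p → - p + p ≈ []
  neg-inverseˡ p = ≈-trans (+-comm (- p) p) (neg-inverseʳ p)

  interchange : ∀ p q r s → (p + q) + (r + s) ≈ (p + r) + (q + s)
  interchange p q r s = begin
    (p + q) + (r + s)   ≈⟨ +-assoc p q (r + s) ⟩
    p + (q + (r + s))   ≈⟨ +-cong (≈-refl {p}) (≈-sym (+-assoc q r s)) ⟩
    p + ((q + r) + s)   ≈⟨ +-cong (≈-refl {p}) (+-cong (+-comm q r) (≈-refl {s})) ⟩
    p + ((r + q) + s)   ≈⟨ +-cong (≈-refl {p}) (+-assoc r q s) ⟩
    p + (r + (q + s))   ≈⟨ ≈-sym (+-assoc p r (q + s)) ⟩
    (p + r) + (q + s)   ∎

  swap-middle : ∀ p q r → p + (q + r) ≈ q + (p + r)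
  swap-middle p q r = begin
    p + (q + r)  ≈⟨ ≈-sym (+-assoc p q r) ⟩
    (p + q) + r  ≈⟨ +-cong (+-comm p q) (≈-refl {r}) ⟩
    (q + p) + r  ≈⟨ +-assoc q p r ⟩
    q + (p + r)  ∎

  shift-cong : ∀ {p q} → p ≈ q → shift p ≈ shift q
  shift-cong = ∷-cong R.refl

  shift-+ : ∀ p q → shift (p + q) ≈ shift p + shift q
  shift-+ p q = ∷-cong (R.sym (R.+-identityˡ _)) ≈-refl

  scale-cong : ∀ {a b p q} → a R.≈ b → p ≈ q → scale a p ≈ scale b q
  scale-cong {a} {b} {p} {q} e f = coeffwise λ i →
    R.trans (coeff-scale a p i) (R.trans (R.*-cong e (at f i)) (R.sym (coeff-scale b q i)))

  scale-distribˡ : ∀ a p q → scale a (p + q) ≈ scale a p + scale a q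
  scale-distribˡ a p q = coeffwise λ i →
    R.trans (coeff-scale a (p + q) i) (R.trans (R.*-congˡ (coeff-+ p q i)) (R.trans (R.distribˡ _ _ _)
      (R.sym (R.trans (coeff-+ (scale a p) (scale a q) i) (R.+-cong (coeff-scale a p i) (coeff-scale a q i))))))

  scale-distribʳ : ∀ a b p → scale (a R.+ b) p ≈ scale a p + scale b p
  scale-distribʳ a b p = coeffwise λ i →
    R.trans (coeff-scale (a R.+ b) p i) (R.trans (R.distribʳ _ _ _)
      (R.sym (R.trans (coeff-+ (scale a p) (scale b p) i) (R.+-cong (coeff-scale a p i) (coeff-scale b p i)))))

  scale-scale : ∀ a b p → scale (a R.* b) p ≈ scale a (scale b p)
  scale-scale a b p = coeffwise λ i →
    R.trans (coeff-scale (a R.* b) p i) (R.trans (R.*-assoc _ _ _)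
      (R.sym (R.trans (coeff-scale a (scale b p) i) (R.*-congˡ (coeff-scale b p i)))))

  scale-0 : ∀ p → scale R.0# p ≈ []
  scale-0 p = coeffwise λ i → R.trans (coeff-scale R.0# p i) (R.zeroˡ _)

  scale-1 : ∀ p → scale R.1# p ≈ p
  scale-1 p = coeffwise λ i → R.trans (coeff-scale R.1# p i) (R.*-identityˡ _)

  scale-shift : ∀ a p → scale a (shift p) ≈ shift (scale a p)
  scale-shift a p = ∷-cong (R.zeroʳ a) ≈-refl

  shift-[] : shift [] ≈ []
  shift-[] = ∷-zero R.refl ≈-refl

  *-congˡ : ∀ p {q q′} → q ≈ q′ → p * q ≈ p * q′
  *-congˡ []      e = ≈-refl
  *-congˡ (a ∷ p) e = +-cong (scale-cong R.refl e) (shift-cong (*-congˡ p e))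

  *-zeroʳ : ∀ p → p * [] ≈ []
  *-zeroʳ []      = ≈-refl
  *-zeroʳ (a ∷ p) = ∷-zero R.refl (*-zeroʳ p)

  *-∷ : ∀ p b q → p * (b ∷ q) ≈ scale b p + shift (p * q)
  *-∷ []      b q = ≈-sym shift-[]
  *-∷ (a ∷ p) b q = ∷-cong (R.+-congʳ (R.*-comm a b)) (begin
    scale a q + p * (b ∷ q)                   ≈⟨ +-cong (≈-refl {scale a q}) (*-∷ p b q) ⟩
    scale a q + (scale b p + shift (p * q))   ≈⟨ swap-middle (scale a q) (scale b p) _ ⟩
    scale b p + (scale a q + shift (p * q))   ∎)

  *-comm : ∀ p q → p * q ≈ q * p
  *-comm []      q = ≈-sym (*-zeroʳ q)
  *-comm (a ∷ p) q = begin
    scale a q + shift (p * q)  ≈⟨ +-cong (≈-refl {scale a q}) (shift-cong (*-comm p q)) ⟩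
    scale a q + shift (q * p)  ≈⟨ ≈-sym (*-∷ q a p) ⟩
    q * (a ∷ p)                ∎

  *-cong : ∀ {p p′ q q′} → p ≈ p′ → q ≈ q′ → p * q ≈ p′ * q′
  *-cong {p} {p′} {q} {q′} e f = begin
    p * q    ≈⟨ *-congˡ p f ⟩
    p * q′   ≈⟨ *-comm p q′ ⟩
    q′ * p   ≈⟨ *-congˡ q′ e ⟩
    q′ * p′  ≈⟨ *-comm q′ p′ ⟩
    p′ * q′  ∎

  distribˡ : ∀ r p q → r * (p + q) ≈ r * p + r * q
  distribˡ []      p q = ≈-refl
  distribˡ (a ∷ r) p q = begin
    scale a (p + q) + shift (r * (p + q))
      ≈⟨ +-cong (scale-distribˡ a p q) (≈-trans (shift-cong (distribˡ r p q)) (shift-+ (r * p) (r * q))) ⟩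
    (scale a p + scale a q) + (shift (r * p) + shift (r * q))
      ≈⟨ interchange (scale a p) (scale a q) _ _ ⟩
    (scale a p + shift (r * p)) + (scale a q + shift (r * q))  ∎

  distribʳ : ∀ r p q → (p + q) * r ≈ p * r + q * r
  distribʳ r p q = begin
    (p + q) * r    ≈⟨ *-comm (p + q) r ⟩
    r * (p + q)    ≈⟨ distribˡ r p q ⟩
    r * p + r * q  ≈⟨ +-cong (*-comm r p) (*-comm r q) ⟩
    p * r + q * r  ∎

  scale-* : ∀ a p q → scale a p * q ≈ scale a (p * q)
  scale-* a []      q = ≈-refl
  scale-* a (b ∷ p) q = begin
    scale (a R.* b) q + shift (scale a p * q)
      ≈⟨ +-cong (scale-scale a b q) (≈-trans (shift-cong (scale-* a p q)) (≈-sym (scale-shift a (p * q)))) ⟩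
    scale a (scale b q) + scale a (shift (p * q))
      ≈⟨ ≈-sym (scale-distribˡ a (scale b q) (shift (p * q))) ⟩
    scale a (scale b q + shift (p * q))  ∎

  shift-* : ∀ p q → shift p * q ≈ shift (p * q)
  shift-* p q = +-cong (scale-0 q) (≈-refl {shift (p * q)})

  *-assoc : ∀ p q r → (p * q) * r ≈ p * (q * r)
  *-assoc []      q r = ≈-refl
  *-assoc (a ∷ p) q r = begin
    (scale a q + shift (p * q)) * r       ≈⟨ distribʳ r (scale a q) (shift (p * q)) ⟩
    scale a q * r + shift (p * q) * r     ≈⟨ +-cong (scale-* a q r) (shift-* (p * q) r) ⟩
    scale a (q * r) + shift (p * q * r)   ≈⟨ +-cong (≈-refl {scale a (q * r)}) (shift-cong (*-assoc p q r)) ⟩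
    scale a (q * r) + shift (p * (q * r)) ∎

  *-identityˡ : ∀ p → 1# * p ≈ p
  *-identityˡ p = begin
    scale R.1# p + shift []  ≈⟨ +-cong (scale-1 p) shift-[] ⟩
    p + []                   ≈⟨ +-identityʳ p ⟩
    p                        ∎

  *-identityʳ : ∀ p → p * 1# ≈ p
  *-identityʳ p = ≈-trans (*-comm p 1#) (*-identityˡ p)

  commutativeRing : CommutativeRing 0ℓ 0ℓ
  commutativeRing = record
    { Carrier = Poly ; _≈_ = _≈_ ; _+_ = _+_ ; _*_ = _*_ ; -_ = -_ ; 0# = 0# ; 1# = 1#
    ; isCommutativeRing = record
      { isRing = record
        { +-isAbelianGroup = record
          { isGroup = record
            { isMonoid = record
              { isSemigroup = record
                { isMagma = record
                  { isEquivalence = record { refl = ≈-refl ; sym = ≈-sym ; trans = ≈-trans }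
                  ; ∙-cong = +-cong }
                ; assoc = +-assoc }
              ; identity = +-identityˡ , +-identityʳ }
            ; inverse = neg-inverseˡ , neg-inverseʳ
            ; ⁻¹-cong = neg-cong }
          ; comm = +-comm }
        ; *-cong = *-cong
        ; *-assoc = *-assoc
        ; *-identity = *-identityˡ , *-identityʳ
        ; distrib = distribˡ , distribʳ }
      ; *-comm = *-comm } }

  1≉0 : ¬ (1# ≈ 0#)
  1≉0 e = R.1≉0 (at e 0)

  X≉0 : ¬ (X ≈ 0#)
  X≉0 e = R.1≉0 (at e 1)

  noZeroDivisors : ∀ p q → p * q ≈ 0# → p ≈ 0# ⊎ q ≈ 0#
  noZeroDivisors []      q       e = inj₁ ≈-refl
  noZeroDivisors (a ∷ p) []      e = inj₂ ≈-refl
  noZeroDivisors (a ∷ p) (b ∷ q) e =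
    [ (λ a≈0 → map₁ (∷-zero a≈0) (noZeroDivisors p (b ∷ q) (dropˡ a≈0)))
    , (λ b≈0 → map₂ (∷-zero b≈0) (noZeroDivisors (a ∷ p) q (dropʳ b≈0)))
    ]′ (R.noZeroDivisors a b (R.trans (R.sym (R.+-identityʳ _)) (at e 0)))
    where
    dropˡ : a R.≈ R.0# → p * (b ∷ q) ≈ []
    dropˡ a≈0 = tail-zero (begin
      shift (p * (b ∷ q))  ≈⟨ ≈-sym (shift-* p (b ∷ q)) ⟩
      shift p * (b ∷ q)    ≈⟨ *-cong {shift p} {a ∷ p} {b ∷ q} {b ∷ q} (∷-cong (R.sym a≈0) ≈-refl) ≈-refl ⟩
      (a ∷ p) * (b ∷ q)    ≈⟨ e ⟩
      []                   ∎)

    dropʳ : b R.≈ R.0# → (a ∷ p) * q ≈ []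
    dropʳ b≈0 = tail-zero (begin
      shift r                      ≈⟨ +-cong (≈-sym (scale-0 (a ∷ p))) (≈-refl {shift r}) ⟩
      scale R.0# (a ∷ p) + shift r ≈⟨ +-cong (scale-cong {p = a ∷ p} (R.sym b≈0) ≈-refl) (≈-refl {shift r}) ⟩
      scale b (a ∷ p) + shift r    ≈⟨ ≈-sym (*-∷ (a ∷ p) b q) ⟩
      (a ∷ p) * (b ∷ q)            ≈⟨ e ⟩
      []                           ∎)
      where
      r : Poly
      r = (a ∷ p) * q

  integralDomain : IntegralDomain
  integralDomain = record
    { commutativeRing = commutativeRing
    ; 1≉0 = 1≉0 ; noZeroDivisors = noZeroDivisors }

module Fractions (D : IntegralDomain) where
  private module R = IntegralDomain D

  infix  4 _≃_
  infixl 6 _+_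
  infixl 7 _*_

  record Fraction : Set where
    constructor fraction
    field
      numerator   : R.Carrier
      denominator : R.Carrier
      nonzero     : ¬ (denominator R.≈ R.0#)

  _≃_ : Rel Fraction 0ℓ
  fraction a b _ ≃ fraction c d _ = a R.* d R.≈ c R.* b

  _+_ : Fraction → Fraction → Fraction
  fraction a b b≉0 + fraction c d d≉0 =
    fraction (a R.* d R.+ c R.* b) (b R.* d) (R.*-nonzero b≉0 d≉0)

  _*_ : Fraction → Fraction → Fraction
  fraction a b b≉0 * fraction c d d≉0 = fraction (a R.* c) (b R.* d) (R.*-nonzero b≉0 d≉0)

  fromRing : R.Carrier → Fraction
  fromRing a = fraction a R.1# R.1≉0

  0# 1# : Fraction
  0# = fromRing R.0#
  1# = fromRing R.1#

  rawSemiring : RawSemiring 0ℓ 0ℓ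
  rawSemiring = record
    { Carrier = Fraction ; _≈_ = _≃_ ; _+_ = _+_ ; _*_ = _*_ ; 0# = 0# ; 1# = 1# }

  open RawSemiringDefs rawSemiring public using (_^_)

-- ℤ[x₁,x₂] = ℤ[x₁][x₂], and its fraction field ℚ(x₁,x₂)

ℤ-integralDomain : IntegralDomain
ℤ-integralDomain = record
  { commutativeRing = ℤ.+-*-commutativeRing
  ; 1≉0 = λ ()
  ; noZeroDivisors = λ i j → ℤ.i*j≡0⇒i≡0∨j≡0 i }

module ℤ[x₁]    = Polynomials ℤ-integralDomain
module ℤ[x₁,x₂] = Polynomials ℤ[x₁].integralDomain

module Pol = IntegralDomain ℤ[x₁,x₂].integralDomain
module Rat = Fractions ℤ[x₁,x₂].integralDomain

Polynomial : Set
Polynomial = Pol.Carrier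

RationalFunction : Set
RationalFunction = Rat.Fraction

x₁ x₂ : Polynomial
x₁ = ℤ[x₁].X ∷ []
x₂ = ℤ[x₁,x₂].X

x₁≉0 : ¬ (x₁ Pol.≈ Pol.0#)
x₁≉0 e = ℤ[x₁].X≉0 (ℤ[x₁,x₂].at e 0)

x₂≉0 : ¬ (x₂ Pol.≈ Pol.0#)
x₂≉0 = ℤ[x₁,x₂].X≉0

Even Odd : ℤ → Set
Even n = parity ∣ n ∣ ≡ 0ℙ
Odd  n = parity ∣ n ∣ ≡ 1ℙ

record IsClusterSequence (x : ℤ → RationalFunction) : Set where
  open Rat
  field
    initial₁ : x (+ 1) ≃ fromRing x₁
    initial₂ : x (+ 2) ≃ fromRing x₂
    odd      : ∀ n → Odd  n → x n * x (n ℤ.- + 2) ≃ x (n ℤ.- + 1) + 1#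
    even     : ∀ n → Even n → x n * x (n ℤ.- + 2) ≃ x (n ℤ.- + 1) ^ 4 + 1#

infix 0 ifOdd_then_else_
ifOdd_then_else_ : ∀ {a} {A : Set a} → ℕ → A → A → A
ifOdd i then o else e with parity i
... | 1ℙ = o
... | 0ℙ = e

-- For odd n, |n/2 - 1| - 1/2 = (|n - 2| - 1)/2 with |n - 2| odd.
-- For n ≢ 1, 2 no subtraction below truncates.
sq oct : ℤ → ℕ
sq  n = ifOdd ∣ n ∣ then ∣ n ℤ.- + 1 ∣ ∸ 1 else ∣ + 2 ℤ.* n ℤ.- + 2 ∣ ∸ 2
oct n = ifOdd ∣ n ∣ then ⌊ (∣ n ℤ.- + 2 ∣ ∸ 1) /2⌋ else ∣ n ℤ.- + 2 ∣ ∸ 1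

m : ℤ → Polynomial
m n = x₁ Pol.^ sq n Pol.* x₂ Pol.^ oct n

m≉0 : ∀ n → ¬ (m n Pol.≈ Pol.0#)
m≉0 n = Pol.*-nonzero (Pol.^-nonzero (sq n) x₁≉0) (Pol.^-nonzero (oct n) x₂≉0)

-- Edge lists are used without repetitions, so sublists are exactly subsets.
subsets : ∀ {a} {A : Set a} → List A → List (List A)
subsets []       = [] ∷ []
subsets (x ∷ xs) = map (x ∷_) (subsets xs) ++ subsets xs

Edge : Set → Set
Edge V = V × V × Polynomial

weight : ∀ {V} → Edge V → Polynomial
weight (_ , _ , w) = w

_∈ᵉ_ : ∀ {V} → V → Edge V → Set
v ∈ᵉ (a , b , _) = v ≡ a ⊎ v ≡ b

-- The vertex set consists of the listed elements of V.
record WeightedGraph : Set₁ where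
  field
    V        : Set
    _≟_      : DecidableEquality V
    vertices : List V
    edges    : List (Edge V)

  _∈ᵉ?_ : ∀ v (e : Edge V) → Dec (v ∈ᵉ e)
  v ∈ᵉ? (a , b , _) = (v ≟ a) ⊎-dec (v ≟ b)

  IsPerfectMatching : List (Edge V) → Set
  IsPerfectMatching S = All (λ v → length (filter (v ∈ᵉ?_) S) ≡ 1) vertices

  isPerfectMatching? : ∀ S → Dec (IsPerfectMatching S)
  isPerfectMatching? S = all? (λ v → length (filter (v ∈ᵉ?_) S) ℕ.≟ 1) vertices

  perfectMatchings : List (List (Edge V))
  perfectMatchings = filter isPerfectMatching? (subsets edges)

  matchingWeight : List (Edge V) → Polynomial
  matchingWeight S = foldr Pol._*_ Pol.1# (map weight S)

  p : Polynomial
  p = foldr Pol._+_ Pol.0# (map matchingWeight perfectMatchings)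

data Corner : Set where
  nl nr et eb sr sl wb wt : Corner

data Side : Set where
  north south east west : Side

data End : Set where
  start finish : End

-- The square on side s consists of foot s start, u, v, foot s finish.
foot : Side → End → Corner
foot north start  = nl
foot north finish = nr
foot south start  = sl
foot south finish = sr
foot east  start  = et
foot east  finish = eb
foot west  start  = wt
foot west  finish = wb

-- new i s start and new i s finish are the vertices u and v of the square
-- on side s of octagon i.
data Vertex : Set where
  corner : ℤ → Corner → Vertex
  new    : ℤ → Side → End → Vertex

module _ {A : Set} (f : A → ℕ) (g : ℕ → A) (gf : ∀ a → g (f a) ≡ a) where
  retract-≟ : DecidableEquality A
  retract-≟ a b = map′ (λ e → trans (sym (gf a)) (trans (cong g e) (gf b))) (cong f) (f a ℕ.≟ f b)

_≟ᶜ_ : DecidableEquality Corner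
_≟ᶜ_ = retract-≟
  (λ { nl → 0 ; nr → 1 ; et → 2 ; eb → 3 ; sr → 4 ; sl → 5 ; wb → 6 ; wt → 7 })
  (λ { 0 → nl ; 1 → nr ; 2 → et ; 3 → eb ; 4 → sr ; 5 → sl ; 6 → wb ; _ → wt })
  (λ { nl → refl ; nr → refl ; et → refl ; eb → refl ; sr → refl ; sl → refl ; wb → refl ; wt → refl })

_≟ˢ_ : DecidableEquality Side
_≟ˢ_ = retract-≟
  (λ { north → 0 ; south → 1 ; east → 2 ; west → 3 })
  (λ { 0 → north ; 1 → south ; 2 → east ; _ → west })
  (λ { north → refl ; south → refl ; east → refl ; west → refl })

_≟ᵉ_ : DecidableEquality End
_≟ᵉ_ = retract-≟ (λ { start → 0 ; finish → 1 }) (λ { 0 → start ; _ → finish })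
  (λ { start → refl ; finish → refl })

_≟ᵛ_ : DecidableEquality Vertex
corner i c ≟ᵛ corner j d = map′ (λ (e , f) → cong₂ corner e f) (λ { refl → refl , refl })
                                ((i ℤ.≟ j) ×-dec (c ≟ᶜ d))
corner _ _ ≟ᵛ new _ _ _  = no λ ()
new _ _ _  ≟ᵛ corner _ _ = no λ ()
new i s a  ≟ᵛ new j t b  = map′ (λ { (refl , refl , refl) → refl }) (λ { refl → refl , refl , refl })
                                ((i ℤ.≟ j) ×-dec ((s ≟ˢ t) ×-dec (a ≟ᵉ b)))

data Height : Set where
  top bottom : Height

record Link : Set where
  constructor link
  field
    left right : ℤ
    x₂-edge    : Height

record Layout : Set where
  field
    octagons : List ℤ
    squares  : List (ℤ × Side)
    links    : List Link
    arcs     : List (Vertex × Vertex)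

-- The foot of the vertical edge of weight x₂ of each attached square.
Choice : Set
Choice = ℤ → Side → End

-- An end square's feet lie on no arc, so its choice stays free.
Admissible : Layout → Choice → Set
Admissible L χ = All (λ (i , s) → All (Avoids (corner i (foot s (χ i s)))) arcs) squares
  where
  open Layout L
  Avoids : Vertex → Vertex × Vertex → Set
  Avoids v (a , b) = ¬ (v ≡ a) × ¬ (v ≡ b)

octagonVertices : ℤ → List Vertex
octagonVertices i = map (corner i) (nl ∷ nr ∷ et ∷ eb ∷ sr ∷ sl ∷ wb ∷ wt ∷ [])

squareVertices : ℤ × Side → List Vertex
squareVertices (i , s) = new i s start ∷ new i s finish ∷ []

octagonEdges : ℤ → List (Edge Vertex)
octagonEdges i =
  (corner i nl , corner i nr , Pol.1#) ∷ (corner i nr , corner i et , x₁) ∷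
  (corner i et , corner i eb , Pol.1#) ∷ (corner i eb , corner i sr , x₁) ∷
  (corner i sr , corner i sl , Pol.1#) ∷ (corner i sl , corner i wb , x₁) ∷
  (corner i wb , corner i wt , Pol.1#) ∷ (corner i wt , corner i nl , x₁) ∷ []

squareEdges : Choice → ℤ × Side → List (Edge Vertex)
squareEdges χ (i , s) =
  (corner i (foot s start) , new i s start , startWeight (χ i s)) ∷
  (new i s start , new i s finish , Pol.1#) ∷
  (new i s finish , corner i (foot s finish) , finishWeight (χ i s)) ∷ []
  where
  startWeight finishWeight : End → Polynomial
  startWeight  start  = x₂
  startWeight  finish = Pol.1#
  finishWeight start  = Pol.1#
  finishWeight finish = x₂

linkEdges : Link → List (Edge Vertex)
linkEdges (link l r h) =
  (corner l et , corner r wt , topWeight h) ∷ (corner l eb , corner r wb , bottomWeight h) ∷ []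
  where
  topWeight bottomWeight : Height → Polynomial
  topWeight    top    = x₂
  topWeight    bottom = Pol.1#
  bottomWeight top    = Pol.1#
  bottomWeight bottom = x₂

arcEdge : Vertex × Vertex → Edge Vertex
arcEdge (a , b) = a , b , Pol.1#

chain : Layout → Choice → WeightedGraph
chain L χ = record
  { V        = Vertex
  ; _≟_      = _≟ᵛ_
  ; vertices = concatMap octagonVertices octagons ++ concatMap squareVertices squares
  ; edges    = concatMap octagonEdges octagons ++ concatMap (squareEdges χ) squares
               ++ concatMap linkEdges links ++ map arcEdge arcs
  }
  where open Layout L

square : WeightedGraph
square = record
  { V        = Fin 4
  ; _≟_      = Fin._≟_
  ; vertices = allFin 4
  ; edges    = (0F , 1F , x₂) ∷ (1F , 2F , Pol.1#) ∷ (2F , 3F , Pol.1#) ∷ (3F , 0F , Pol.1#) ∷ []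
  }

[1⋯_] : ℕ → List ℕ
[1⋯ k ] = map suc (upTo k)

[-_⋯_] : ℕ → ℕ → List ℤ
[- k ⋯ l ] = map (λ j → + j ℤ.- + k) (upTo (suc (k ℕ.+ l)))

pos neg : ℕ → ℤ
pos i = + i
neg i = ℤ.- (+ i)

oddPositive : ℕ → Layout
oddPositive k = record
  { octagons = map pos [1⋯ k ]
  ; squares  = map (λ i → pos i , (ifOdd i then south else north)) [1⋯ k ]
               ++ (pos 1 , east) ∷ (pos k , west) ∷ []
  ; links    = map (λ i → link (pos (suc i)) (pos i) (ifOdd i then top else bottom)) [1⋯ k ∸ 1 ]
  ; arcs     = map (λ i → v i , v (suc i)) [1⋯ k ∸ 1 ]
  }
  where
  v : ℕ → Vertex
  v i = corner (pos i) (ifOdd i then sr else nr)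

oddNegative : ℕ → Layout
oddNegative k = record
  { octagons = map pos [1⋯ k ]
  ; squares  = map (λ i → pos i , (ifOdd i then north else south)) [1⋯ k ]
  ; links    = map (λ i → link (pos (suc i)) (pos i) (ifOdd i then top else bottom)) [1⋯ k ∸ 1 ]
  ; arcs     = map (λ i → v i , v (suc i)) [1⋯ k ∸ 1 ]
  }
  where
  v : ℕ → Vertex
  v i = corner (pos i) (ifOdd i then nl else sl)

-- In the two even families the sequences v and u start at index 0, which
-- counts as even.
evenPositive : ℕ → Layout
evenPositive k = record
  { octagons = [- k ∸ 1 ⋯ k ∸ 1 ]
  ; squares  = (pos 0 , north) ∷ (pos 0 , south) ∷ []
               ++ map (λ i → pos i , (ifOdd i then north else south)) [1⋯ k ∸ 1 ]
               ++ map (λ i → neg i , (ifOdd i then south else north)) [1⋯ k ∸ 1 ]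
               ++ (pos (k ∸ 1) , east) ∷ (neg (k ∸ 1) , west) ∷ []
  ; links    = map (λ i → link (pos (i ∸ 1)) (pos i) (ifOdd i then top else bottom)) [1⋯ k ∸ 1 ]
               ++ map (λ i → link (neg i) (neg (i ∸ 1)) (ifOdd i then bottom else top)) [1⋯ k ∸ 1 ]
  ; arcs     = map (λ i → v (i ∸ 1) , v i) [1⋯ k ∸ 1 ]
               ++ map (λ i → u (i ∸ 1) , u i) [1⋯ k ∸ 1 ]
  }
  where
  v u : ℕ → Vertex
  v j = corner (pos j) (ifOdd j then nl else sl)
  u j = corner (neg j) (ifOdd j then sr else nr)

evenNegative : ℕ → Layout
evenNegative k = record
  { octagons = [- k ∸ 1 ⋯ k ∸ 1 ]
  ; squares  = map (λ i → pos i , (ifOdd i then north else south)) [1⋯ k ∸ 1 ]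
               ++ map (λ i → neg i , (ifOdd i then south else north)) [1⋯ k ∸ 1 ]
  ; links    = map (λ i → link (pos (i ∸ 1)) (pos i) (ifOdd i then bottom else top)) [1⋯ k ∸ 1 ]
               ++ map (λ i → link (neg i) (neg (i ∸ 1)) (ifOdd i then top else bottom)) [1⋯ k ∸ 1 ]
  ; arcs     = map (λ i → v (i ∸ 1) , v i) [1⋯ k ∸ 1 ]
               ++ map (λ i → u (i ∸ 1) , u i) [1⋯ k ∸ 1 ]
  }
  where
  v u : ℕ → Vertex
  v j = corner (pos j) (ifOdd j then nr else sr)
  u j = corner (neg j) (ifOdd j then sl else nl)

-- IsG n G: G is the graph G_n for some admissible placement of the
-- weights x₂ on its attached squares.
data IsG : ℤ → WeightedGraph → Set₁ where
  G-three : IsG (+ 3) square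
  G-odd⁺  : ∀ k → 1 ℕ.≤ k → ∀ χ → Admissible (oddPositive k) χ →
            IsG (+ 2 ℤ.* + k ℤ.+ + 3) (chain (oddPositive k) χ)
  G-odd⁻  : ∀ k → 1 ℕ.≤ k → ∀ χ → Admissible (oddNegative k) χ →
            IsG (ℤ.- (+ 2) ℤ.* + k ℤ.+ + 1) (chain (oddNegative k) χ)
  G-even⁺ : ∀ k → 1 ℕ.≤ k → ∀ χ → Admissible (evenPositive k) χ →
            IsG (+ 2 ℤ.* + k ℤ.+ + 2) (chain (evenPositive k) χ)
  G-even⁻ : ∀ k → 1 ℕ.≤ k → ∀ χ → Admissible (evenNegative k) χ →
            IsG (ℤ.- (+ 2) ℤ.* + k ℤ.+ + 2) (chain (evenNegative k) χ)

p/m : WeightedGraph → ℤ → RationalFunction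
p/m G n = Rat.fraction (WeightedGraph.p G) (m n) (m≉0 n)

{-# OPTIONS --safe #-}
-- The sum over perfect matchings is a transfer matrix product. Cutting G_n between two octagons, the part
-- beyond the cut acts on the rest through at most three edges; for parity and colouring reasons only three
-- of the eight subsets of these edges can be completed to a perfect matching, so the part amounts to three
-- polynomials A, B, C. Passing an octagon multiplies (A, B, C) by a fixed 3 × 3 matrix, whose entries are
-- matching sums of one octagon and are found by evaluation. The matrix has rank 2 and, on its image,
-- determinant x₁⁴x₂², so the Casoratian of two consecutive states is a power of x₁⁴x₂². The odd p_n are
-- linear and the even p_n quadratic in the state, and both exchange relations reduce to the Casoratian, the
-- second one by Brahmagupta's identity. Since no p_n vanishes, the exchange relations determine all x_n.

module Submission where

-- The graphs are bipartite, and every part beyond a cut has as many vertices of one colour as of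
-- the other. Among the three cut edges, the `x₂`-edge meets the part in one colour, the other link
-- edge and the arc in the other colour. Hence a completable subset is empty or consists of the
-- `x₂`-edge and one of the other two. The rank drops for different reasons: for positive n, the
-- weights leading to A are x₁ times those leading to C plus those leading to B; for negative n, the
-- weights leading to B and to C are proportional. In two coordinates the determinant comes from (1
-- + x₂)² - (1 + 2x₂) = x₂². The even numerators are values of the form x₁⁴d² + u². Its polar form
-- on two consecutive states is the square of the odd numerator between them, so Brahmagupta's
-- identity yields the fourth power. The summand 1 of the exchange relations is the Casoratian term
-- divided by the denominators: that term, the product of the outer denominators, and the middle
-- denominator or its fourth power are the same monomial.

open import Defs
open import Algebra.Bundles using (CommutativeMonoid; CommutativeRing; CommutativeSemiring; Semiring)
import Algebra.Definitions.RawSemiring as RawSemiringDefs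
import Algebra.Properties.CommutativeSemigroup as CommutativeSemigroupProperties
import Algebra.Properties.Group as GroupProperties
import Algebra.Properties.Ring as RingProperties
open import Data.Bool.Base using (true; false; if_then_else_)
open import Data.Empty using (⊥)
open import Data.Integer.Base as ℤ using (ℤ; +_; -[1+_])
import Data.Integer.Properties as ℤ
open import Data.List.Base using (List; []; _∷_; _++_; map; concatMap; filter; foldr; length; upTo; applyUpTo)
open import Data.List.Membership.Propositional using (_∈_; _∉_)
open import Data.List.Membership.Propositional.Properties using (∈-filter⁺; ∈-filter⁻; ∈-++⁺ˡ; ∈-++⁺ʳ; ∈-++⁻; ∈-map⁺; ∈-map⁻)
import Data.List.Membership.DecPropositional as DecMembership
open import Data.List.Properties using (++-assoc; ++-identityʳ; concatMap-++; filter-all; filter-++; filter-accept; filter-reject; map-++; map-cong; map-upTo; map-∘; upTo-∷ʳ)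
open import Data.List.Relation.Binary.Permutation.Propositional as ↭ using (_↭_; ↭-reflexive; ↭-sym; ↭-trans)
open import Data.List.Relation.Binary.Permutation.Propositional.Properties using (All-resp-↭; filter-↭; map⁺; shifts; ++⁺; ++⁺ˡ; ++⁺ʳ; ++-comm; ++-commutativeMonoid; ∈-resp-↭)
import Data.List.Relation.Binary.Permutation.Propositional.Properties as ↭ₚ using (shift)
open import Data.List.Relation.Unary.All as All using (All; []; _∷_; all?)
import Data.List.Relation.Unary.All.Properties as All
open import Data.List.Relation.Unary.Any using (here; there)
open import Data.Nat.Base as ℕ using (ℕ; zero; suc; _≤_; z≤n; s≤s; parity; ⌊_/2⌋)
import Data.Nat.Properties as ℕ
open import Data.Parity.Base using (0ℙ; 1ℙ)
open import Data.Product.Base using (_×_; _,_; proj₁; proj₂; ∃)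
open import Data.Sum.Base using (_⊎_; inj₁; inj₂; [_,_]′)
open import Data.Unit.Base using (⊤; tt)
open import Function.Base using (_∘_; id)
open import Function.Bundles using (_⇔_; mk⇔)
open import Level using (0ℓ)
open import Relation.Binary.Definitions using (DecidableEquality)
open import Relation.Binary.PropositionalEquality as ≡ using (_≡_; _≢_; _≗_; cong; cong₂; subst)
open import Relation.Nullary using (¬_; Dec; yes; no; does; contradiction)
open import Relation.Nullary.Decidable using (dec-false; dec-true; does-⇔; from-yes; map′; ¬?; _×-dec_; _⊎-dec_)
open import Relation.Unary using (Decidable; Pred)

-- Matching sums

module MatchingSums (R : CommutativeSemiring 0ℓ 0ℓ) where
  open CommutativeSemiring R renaming (refl to ≈-refl; trans to ≈-trans; sym to ≈-sym)
  open import Algebra.Solver.Ring.NaturalCoefficients.Default R using (solve; _:+_; _:*_; _:=_)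
  open import Relation.Binary.Reasoning.Setoid setoid

  WEdge : Set → Set
  WEdge V = V × V × Carrier

  module Removal {V : Set} (_≟_ : DecidableEquality V) where
    open DecMembership _≟_ using (_∈?_)

    infixl 7 _∖_
    _∖_ : List V → V → List V
    vs ∖ v = filter (λ u → ¬? (u ≟ v)) vs

    opaque
      -- Removal deletes every copy of `v`, so `D v` squares to zero even on lists with repetitions.
      -- Outside of its basic laws the operator is unfolded only where tables of closed values are
      -- evaluated; everywhere else matching sums stay symbolic.
      D : V → (List V → Carrier) → List V → Carrier
      D v f vs = if does (v ∈? vs) then f (vs ∖ v) else 0#

    ∈-∖⁺ : ∀ {u v vs} → u ≢ v → u ∈ vs → u ∈ vs ∖ v
    ∈-∖⁺ u≢v u∈ = ∈-filter⁺ _ u∈ u≢v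

    ∈-∖⁻ : ∀ {u v vs} → u ∈ vs ∖ v → u ∈ vs × u ≢ v
    ∈-∖⁻ = ∈-filter⁻ _

    ∖-comm : ∀ vs a b → vs ∖ a ∖ b ≡ vs ∖ b ∖ a
    ∖-comm []       a b = ≡.refl
    ∖-comm (v ∷ vs) a b with v ≟ a in p | v ≟ b in q
    ... | yes _ | yes _ = ∖-comm vs a b
    ... | yes _ | no  _ rewrite p = ∖-comm vs a b
    ... | no  _ | yes _ rewrite q = ∖-comm vs a b
    ... | no  _ | no  _ rewrite p | q = cong (v ∷_) (∖-comm vs a b)

    ∖-all : ∀ {p} {P : Pred V p} {vs} v → All P vs → All P (vs ∖ v)
    ∖-all v = All.filter⁺ _

    opaque
      unfolding D

      D-∈ : ∀ {v} f {vs} → v ∈ vs → D v f vs ≡ f (vs ∖ v)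
      D-∈ {v} f {vs} v∈ with v ∈? vs
      ... | yes _ = ≡.refl
      ... | no v∉ = contradiction v∈ v∉

      D-∉ : ∀ {v} f {vs} → v ∉ vs → D v f vs ≡ 0#
      D-∉ {v} f {vs} v∉ with v ∈? vs
      ... | yes v∈ = contradiction v∈ v∉
      ... | no _   = ≡.refl

      D-cong : ∀ v {f g vs} → f (vs ∖ v) ≈ g (vs ∖ v) → D v f vs ≈ D v g vs
      D-cong v {vs = vs} e with v ∈? vs
      ... | yes _ = e
      ... | no  _ = ≈-refl

      D-resp-↭ : ∀ v {f} → (∀ {vs ws} → vs ↭ ws → f vs ≈ f ws) →
                 ∀ {vs ws} → vs ↭ ws → D v f vs ≈ D v f ws
      D-resp-↭ v {f} resp {vs} {ws} π with v ∈? vs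
      ... | yes v∈ = ≈-trans (resp (filter-↭ _ π)) (reflexive (≡.sym (D-∈ f (∈-resp-↭ π v∈))))
      ... | no v∉  = reflexive (≡.sym (D-∉ f (v∉ ∘ ∈-resp-↭ (↭-sym π))))

      D-+ : ∀ v f g vs → D v (λ us → f us + g us) vs ≈ D v f vs + D v g vs
      D-+ v f g vs with v ∈? vs
      ... | yes _ = ≈-refl
      ... | no  _ = ≈-sym (+-identityˡ 0#)

      D-* : ∀ v c f vs → D v (λ us → c * f us) vs ≈ c * D v f vs
      D-* v c f vs with v ∈? vs
      ... | yes _ = ≈-refl
      ... | no  _ = ≈-sym (zeroʳ c)

      D-*ʳ : ∀ v c f vs → D v (λ us → f us * c) vs ≈ D v f vs * c
      D-*ʳ v c f vs with v ∈? vs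
      ... | yes _ = ≈-refl
      ... | no  _ = ≈-sym (zeroˡ c)

      D-0 : ∀ v vs → D v (λ _ → 0#) vs ≡ 0#
      D-0 v vs with v ∈? vs
      ... | yes _ = ≡.refl
      ... | no  _ = ≡.refl

      D-comm : ∀ a b f vs → D a (D b f) vs ≡ D b (D a f) vs
      D-comm a b f vs with a ≟ b
      ... | yes ≡.refl = ≡.refl
      ... | no a≢b with a ∈? vs | b ∈? vs
      ... | yes a∈ | yes b∈ = ≡.trans (D-∈ f (∈-∖⁺ (a≢b ∘ ≡.sym) b∈))
                                (≡.trans (cong f (∖-comm vs a b)) (≡.sym (D-∈ f (∈-∖⁺ a≢b a∈))))
      ... | yes a∈ | no b∉  = D-∉ f (b∉ ∘ proj₁ ∘ ∈-∖⁻)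
      ... | no a∉  | yes b∈ = ≡.sym (D-∉ f (a∉ ∘ proj₁ ∘ ∈-∖⁻))
      ... | no _   | no _   = ≡.refl

    -- M es vs sums the weights of the sets of disjoint edges in es that cover exactly vs; every edge
    -- contributes a factor 1 + w D a D b, where the operators D v commute and square to zero.
    U : WEdge V → (List V → Carrier) → List V → Carrier
    U (a , b , w) f vs = f vs + w * D a (D b f) vs

    M : List (WEdge V) → List V → Carrier
    M []       []      = 1#
    M []       (_ ∷ _) = 0#
    M (e ∷ es) vs      = U e (M es) vs

    U-cong : ∀ e {f g} → (∀ vs → f vs ≈ g vs) → ∀ vs → U e f vs ≈ U e g vs
    U-cong (a , b , w) e vs = +-cong (e vs) (*-congˡ (D-cong a (D-cong b (e _))))

    DD-U : ∀ a b c d w f vs → D a (D b (U (c , d , w) f)) vs ≈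
           D a (D b f) vs + w * D a (D b (D c (D d f))) vs
    DD-U a b c d w f vs = begin
      D a (D b (U (c , d , w) f)) vs
        ≈⟨ D-cong a (≈-trans (D-+ b f _ _) (+-congˡ (D-* b w _ _))) ⟩
      D a (λ us → D b f us + w * D b (D c (D d f)) us) vs
        ≈⟨ ≈-trans (D-+ a (D b f) _ vs) (+-congˡ (D-* a w _ vs)) ⟩
      D a (D b f) vs + w * D a (D b (D c (D d f))) vs ∎

    DD-comm : ∀ a b c d f vs → D a (D b (D c (D d f))) vs ≈ D c (D d (D a (D b f))) vs
    DD-comm a b c d f vs = begin
      D a (D b (D c (D d f))) vs ≈⟨ D-cong a (reflexive (D-comm b c (D d f) _)) ⟩
      D a (D c (D b (D d f))) vs ≡⟨ D-comm a c (D b (D d f)) vs ⟩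
      D c (D a (D b (D d f))) vs ≈⟨ D-cong c (D-cong a (reflexive (D-comm b d f _))) ⟩
      D c (D a (D d (D b f))) vs ≈⟨ D-cong c (reflexive (D-comm a d (D b f) _)) ⟩
      D c (D d (D a (D b f))) vs ∎

    -- Only the mixed term with four removals has to be compared, and it is symmetric by `DD-comm`.
    -- Edges with a common end need no case of their own, since both mixed terms then vanish.
    U-comm : ∀ e e′ f vs → U e (U e′ f) vs ≈ U e′ (U e f) vs
    U-comm (a , b , w) (c , d , w′) f vs = begin
      (f vs + w′ * D c (D d f) vs) + w * D a (D b (U (c , d , w′) f)) vs
        ≈⟨ +-congˡ (*-congˡ (≈-trans (DD-U a b c d w′ f vs) (+-congˡ (*-congˡ (DD-comm a b c d f vs))))) ⟩
      (f vs + w′ * D c (D d f) vs) + w * (D a (D b f) vs + w′ * D c (D d (D a (D b f))) vs)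
        ≈⟨ solve 6 (λ x p q r w w′ → (x :+ w′ :* p) :+ w :* (q :+ w′ :* r) :=
                                     (x :+ w :* q) :+ w′ :* (p :+ w :* r)) ≈-refl
             (f vs) _ _ _ w w′ ⟩
      (f vs + w * D a (D b f) vs) + w′ * (D c (D d f) vs + w * D c (D d (D a (D b f))) vs)
        ≈⟨ +-congˡ (*-congˡ (DD-U c d a b w f vs)) ⟨
      (f vs + w * D a (D b f) vs) + w′ * D c (D d (U (a , b , w) f)) vs ∎

    infix 4 _≅_
    record _≅_ (es es′ : List (WEdge V)) : Set where
      constructor equivalent
      field sums : ∀ vs → M es vs ≈ M es′ vs
    open _≅_ public

    ≅-trans : ∀ {es es′ es″} → es ≅ es′ → es′ ≅ es″ → es ≅ es″
    ≅-trans p q = equivalent λ vs → ≈-trans (sums p vs) (sums q vs)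

    ≅-∷ : ∀ e {es es′} → es ≅ es′ → e ∷ es ≅ e ∷ es′
    ≅-∷ e p = equivalent (U-cong e (sums p))

    ↭⇒≅ : ∀ {es es′} → es ↭ es′ → es ≅ es′
    ↭⇒≅ ↭.refl         = equivalent λ _ → ≈-refl
    ↭⇒≅ (↭.prep e π)   = ≅-∷ e (↭⇒≅ π)
    ↭⇒≅ {e ∷ e′ ∷ es} (↭.swap _ _ π) = equivalent λ vs →
      ≈-trans (U-comm e e′ (M es) vs) (U-cong e′ (U-cong e (sums (↭⇒≅ π))) vs)
    ↭⇒≅ (↭.trans π π′) = ≅-trans (↭⇒≅ π) (↭⇒≅ π′)

    ≅-reverse : ∀ a b w es → (a , b , w) ∷ es ≅ (b , a , w) ∷ es
    ≅-reverse a b w es = equivalent λ vs → +-congˡ (*-congˡ (reflexive (D-comm a b (M es) vs)))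

    M-resp-↭ : ∀ es {vs ws} → vs ↭ ws → M es vs ≈ M es ws
    M-resp-↭ (( a , b , w) ∷ es) π =
      +-cong (M-resp-↭ es π) (*-congˡ (D-resp-↭ a (D-resp-↭ b (M-resp-↭ es)) π))
    M-resp-↭ [] {[]}     {[]}     π = ≈-refl
    M-resp-↭ [] {_ ∷ _}  {_ ∷ _}  π = ≈-refl
    M-resp-↭ [] {[]}     {w ∷ ws} π with () ← ∈-resp-↭ (↭-sym π) (here ≡.refl)
    M-resp-↭ [] {v ∷ vs} {[]}     π with () ← ∈-resp-↭ π (here ≡.refl)

    EndsIn : Pred V 0ℓ → Pred (WEdge V) 0ℓ
    EndsIn P (a , b , _) = P a × P b

  module Restriction {K V : Set} (_≟ᴷ_ : DecidableEquality K) (_≟ⱽ_ : DecidableEquality V) where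
    private
      module K = Removal _≟ᴷ_
      module V = Removal _≟ⱽ_
      open DecMembership _≟ᴷ_ using (_∈?_)

    -- The common source of the laws for appending vertices on either side and for relabelling: it
    -- is enough that membership and removal correspond along `φ`.
    D-restrict : ∀ (φ : List K → List V) {k v} f ks →
                 (k ∈ ks → v ∈ φ ks) → (v ∈ φ ks → k ∈ ks) → φ ks V.∖ v ≡ φ (ks K.∖ k) →
                 V.D v f (φ ks) ≡ K.D k (f ∘ φ) ks
    D-restrict φ {k} f ks to from e with k ∈? ks
    ... | yes k∈ = ≡.trans (V.D-∈ f (to k∈)) (≡.trans (cong f e) (≡.sym (K.D-∈ (f ∘ φ) k∈)))
    ... | no k∉  = ≡.trans (V.D-∉ f (k∉ ∘ from)) (≡.sym (K.D-∉ (f ∘ φ) k∉))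

  module _ {V : Set} (_≟_ : DecidableEquality V) where
    open Removal _≟_
    open Restriction _≟_ _≟_

    ∖-∉ : ∀ {v vs} → v ∉ vs → vs ∖ v ≡ vs
    ∖-∉ {v} v∉ = filter-all _ (All.tabulate λ { u∈ ≡.refl → v∉ u∈ })

    D-++ˡ : ∀ {v} f us ws → v ∉ ws → D v f (us ++ ws) ≡ D v (λ us′ → f (us′ ++ ws)) us
    D-++ˡ {v} f us ws v∉ = D-restrict (_++ ws) f us ∈-++⁺ˡ
      (λ v∈ → [ id , (λ v∈ws → contradiction v∈ws v∉) ]′ (∈-++⁻ us v∈))
      (≡.trans (filter-++ _ us ws) (cong (us ∖ v ++_) (∖-∉ v∉)))

    D-++ʳ : ∀ {v} f us ws → v ∉ us → D v f (us ++ ws) ≡ D v (λ ws′ → f (us ++ ws′)) ws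
    D-++ʳ {v} f us ws v∉ = D-restrict (us ++_) f ws (∈-++⁺ʳ us)
      (λ v∈ → [ (λ v∈us → contradiction v∈us v∉) , id ]′ (∈-++⁻ us v∈))
      (≡.trans (filter-++ _ us ws) (cong (_++ ws ∖ v) (∖-∉ v∉)))

    module _ (P : Pred V 0ℓ) where
      private
        ∁P : Pred V 0ℓ
        ∁P v = ¬ P v

        apart : ∀ {v ws} → P v → All ∁P ws → v ∉ ws
        apart Pv q v∈ = All.lookup q v∈ Pv

        apart′ : ∀ {v ws} → ∁P v → All P ws → v ∉ ws
        apart′ ¬Pv q v∈ = ¬Pv (All.lookup q v∈)

      -- Without edges between the two parts, each removal acts on one factor and passes through the
      -- other. The induction consumes `es` first; the clauses with empty `es` then consume `es′`.
      M-++ : ∀ {es es′ vs vs′} → All (EndsIn P) es → All P vs → All (EndsIn ∁P) es′ → All ∁P vs′ →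
             M (es ++ es′) (vs ++ vs′) ≈ M es vs * M es′ vs′
      M-++ {[]} {[]} {[]}     {vs′} [] ps [] qs = ≈-sym (*-identityˡ _)
      M-++ {[]} {[]} {_ ∷ vs} {vs′} [] ps [] qs = ≈-sym (zeroˡ _)
      M-++ {[]} {(a , b , w) ∷ es′} {vs} {vs′} [] ps ((pa , pb) ∷ es′∉) qs = begin
        M es′ (vs ++ vs′) + w * D a (D b (M es′)) (vs ++ vs′)
          ≡⟨ cong (λ t → M es′ (vs ++ vs′) + w * t) (D-++ʳ _ vs vs′ (apart′ pa ps)) ⟩
        M es′ (vs ++ vs′) + w * D a (λ ws → D b (M es′) (vs ++ ws)) vs′
          ≈⟨ +-cong (M-++ {[]} {es′} [] ps es′∉ qs) (*-congˡ (D-cong a (≈-trans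
               (reflexive (D-++ʳ (M es′) vs _ (apart′ pb ps)))
               (D-cong b {vs = vs′ ∖ a} (M-++ {[]} {es′} [] ps es′∉ (∖-all b (∖-all a qs))))))) ⟩
        M [] vs * M es′ vs′ + w * D a (D b (λ ws → M [] vs * M es′ ws)) vs′
          ≈⟨ +-congˡ (*-congˡ (≈-trans (D-cong a (D-* b _ (M es′) (vs′ ∖ a))) (D-* a _ (D b (M es′)) vs′))) ⟩
        M [] vs * M es′ vs′ + w * (M [] vs * D a (D b (M es′)) vs′)
          ≈⟨ solve 4 (λ x y z w → x :* y :+ w :* (x :* z) := x :* (y :+ w :* z)) ≈-refl (M [] vs) (M es′ vs′) _ w ⟩
        M [] vs * (M es′ vs′ + w * D a (D b (M es′)) vs′) ∎
      M-++ {(a , b , w) ∷ es} {es′} {vs} {vs′} ((pa , pb) ∷ es∈) ps qes qs = begin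
        M (es ++ es′) (vs ++ vs′) + w * D a (D b (M (es ++ es′))) (vs ++ vs′)
          ≡⟨ cong (λ t → M (es ++ es′) (vs ++ vs′) + w * t) (D-++ˡ _ vs vs′ (apart pa qs)) ⟩
        M (es ++ es′) (vs ++ vs′) + w * D a (λ us → D b (M (es ++ es′)) (us ++ vs′)) vs
          ≈⟨ +-cong (M-++ es∈ ps qes qs) (*-congˡ (D-cong a (≈-trans
               (reflexive (D-++ˡ (M (es ++ es′)) _ vs′ (apart pb qs)))
               (D-cong b {vs = vs ∖ a} (M-++ es∈ (∖-all b (∖-all a ps)) qes qs))))) ⟩
        M es vs * M es′ vs′ + w * D a (D b (λ us → M es us * M es′ vs′)) vs
          ≈⟨ +-congˡ (*-congˡ (≈-trans (D-cong a (D-*ʳ b _ (M es) (vs ∖ a))) (D-*ʳ a _ (D b (M es)) vs))) ⟩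
        M es vs * M es′ vs′ + w * (D a (D b (M es)) vs * M es′ vs′)
          ≈⟨ solve 4 (λ x y z w → x :* y :+ w :* (z :* y) := (x :+ w :* z) :* y) ≈-refl (M es vs) (M es′ vs′) _ w ⟩
        (M es vs + w * D a (D b (M es)) vs) * M es′ vs′ ∎

  -- Parts of a graph as operators

  module Operators {V : Set} (_≟_ : DecidableEquality V) where
    open Removal _≟_

    Op : Set
    Op = List (Carrier × List V)

    Dˢ : List V → (List V → Carrier) → List V → Carrier
    Dˢ Y f = foldr D f Y

    ⟦_⟧ : Op → (List V → Carrier) → List V → Carrier
    ⟦ [] ⟧           f vs = 0#
    ⟦ (c , Y) ∷ op ⟧ f vs = c * Dˢ Y f vs + ⟦ op ⟧ f vs

    module _ {Q : Pred V 0ℓ} {f g : List V → Carrier} (f≈g : ∀ {us} → All Q us → f us ≈ g us) where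
      Dˢ-cong : ∀ Y {vs} → All Q vs → Dˢ Y f vs ≈ Dˢ Y g vs
      Dˢ-cong []      q = f≈g q
      Dˢ-cong (a ∷ Y) q = D-cong a (Dˢ-cong Y (∖-all a q))

      ⟦⟧-cong : ∀ op {vs} → All Q vs → ⟦ op ⟧ f vs ≈ ⟦ op ⟧ g vs
      ⟦⟧-cong []             q = ≈-refl
      ⟦⟧-cong ((c , Y) ∷ op) q = +-cong (*-congˡ (Dˢ-cong Y q)) (⟦⟧-cong op q)

    module _ (c : Carrier) (f : List V → Carrier) where
      Dˢ-*ʳ : ∀ Y vs → Dˢ Y (λ us → f us * c) vs ≈ Dˢ Y f vs * c
      Dˢ-*ʳ []      vs = ≈-refl
      Dˢ-*ʳ (a ∷ Y) vs = ≈-trans (D-cong a (Dˢ-*ʳ Y _)) (D-*ʳ a c (Dˢ Y f) vs)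

      ⟦⟧-*ʳ : ∀ op vs → ⟦ op ⟧ (λ us → f us * c) vs ≈ ⟦ op ⟧ f vs * c
      ⟦⟧-*ʳ []             vs = ≈-sym (zeroˡ c)
      ⟦⟧-*ʳ ((d , Y) ∷ op) vs = begin
        d * Dˢ Y (λ us → f us * c) vs + ⟦ op ⟧ (λ us → f us * c) vs
          ≈⟨ +-cong (*-congˡ (Dˢ-*ʳ Y vs)) (⟦⟧-*ʳ op vs) ⟩
        d * (Dˢ Y f vs * c) + ⟦ op ⟧ f vs * c
          ≈⟨ ≈-trans (+-congʳ (≈-sym (*-assoc _ _ _))) (≈-sym (distribʳ _ _ _)) ⟩
        (d * Dˢ Y f vs + ⟦ op ⟧ f vs) * c ∎

    use : V → Carrier → Op → Op
    use a w = map λ (c , Y) → w * c , a ∷ Y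

    ⟦++⟧ : ∀ op op′ f vs → ⟦ op ++ op′ ⟧ f vs ≈ ⟦ op ⟧ f vs + ⟦ op′ ⟧ f vs
    ⟦++⟧ []            op′ f vs = ≈-sym (+-identityˡ _)
    ⟦++⟧ ((c , Y) ∷ op) op′ f vs = ≈-trans (+-congˡ (⟦++⟧ op op′ f vs)) (≈-sym (+-assoc _ _ _))

    ⟦use⟧ : ∀ a w op f vs → w * D a (⟦ op ⟧ f) vs ≈ ⟦ use a w op ⟧ f vs
    ⟦use⟧ a w []             f vs = ≈-trans (*-congˡ (reflexive (D-0 a vs))) (zeroʳ w)
    ⟦use⟧ a w ((c , Y) ∷ op) f vs = begin
      w * D a (λ us → c * Dˢ Y f us + ⟦ op ⟧ f us) vs
        ≈⟨ *-congˡ (≈-trans (D-+ a _ (⟦ op ⟧ f) vs) (+-congʳ (D-* a c (Dˢ Y f) vs))) ⟩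
      w * (c * D a (Dˢ Y f) vs + D a (⟦ op ⟧ f) vs)
        ≈⟨ ≈-trans (distribˡ _ _ _) (+-cong (≈-sym (*-assoc _ _ _)) (⟦use⟧ a w op f vs)) ⟩
      (w * c) * D a (Dˢ Y f) vs + ⟦ use a w op ⟧ f vs ∎

    infix 4 _⇝_
    -- Coefficients are compared up to `_≈_`, but the vertex lists and the order of the terms stay
    -- literally the same. Reducing an operator thus amounts to deciding for each coefficient
    -- whether it vanishes.
    data _⇝_ : Op → Op → Set where
      []   : [] ⇝ []
      drop : ∀ {c Y op op′} → c ≈ 0# → op ⇝ op′ → (c , Y) ∷ op ⇝ op′
      keep : ∀ {c c′ Y op op′} → c ≈ c′ → op ⇝ op′ → (c , Y) ∷ op ⇝ (c′ , Y) ∷ op′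

    ⇝-sound : ∀ {op op′} → op ⇝ op′ → ∀ f vs → ⟦ op ⟧ f vs ≈ ⟦ op′ ⟧ f vs
    ⇝-sound []         f vs = ≈-refl
    ⇝-sound (drop e p) f vs = ≈-trans (+-cong (≈-trans (*-congʳ e) (zeroˡ _)) (⇝-sound p f vs)) (+-identityˡ _)
    ⇝-sound (keep e p) f vs = +-cong (*-congʳ e) (⇝-sound p f vs)

    -- A part of a graph, with vertices vs₀ and edges es₀ (some of which may end in Q, outside of
    -- the part), acts on the matching sums of the rest of the graph as an operator.
    record Simulates (Q : Pred V 0ℓ) (vs₀ : List V) (es₀ : List (WEdge V)) (op : Op) : Set₁ where
      constructor simulates
      field
        inside : All (λ v → ¬ Q v) vs₀
        sum    : ∀ {vs es} → All Q vs → All (EndsIn Q) es → M (es₀ ++ es) (vs₀ ++ vs) ≈ ⟦ op ⟧ (M es) vs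

    simulates-cong : ∀ {Q vs₀ es₀ es₁ op op′} → (∀ es → es₁ ++ es ≅ es₀ ++ es) → op ⇝ op′ →
                     Simulates Q vs₀ es₀ op → Simulates Q vs₀ es₁ op′
    simulates-cong e p (simulates i s) = simulates i λ qv qe →
      ≈-trans (sums (e _) _) (≈-trans (s qv qe) (⇝-sound p _ _))

    simulates-weaken : ∀ {Q Q′ vs₀ es₀ op} → (∀ {v} → Q′ v → Q v) → All (λ v → ¬ Q′ v) vs₀ →
                       Simulates Q vs₀ es₀ op → Simulates Q′ vs₀ es₀ op
    simulates-weaken Q′⊆Q i (simulates _ s) = simulates i λ qv qe →
      s (All.map Q′⊆Q qv) (All.map (λ (p , q) → Q′⊆Q p , Q′⊆Q q) qe)

    ⟦⟧-pad : ∀ {x α β γ a b Y Y′} → 1# ≈ α → γ ≈ 0# → β ≈ x → (∀ f vs → Dˢ (a ∷ b ∷ []) f vs ≈ Dˢ Y′ f vs) →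
             ∀ f vs → ⟦ (1# , []) ∷ (x , a ∷ b ∷ []) ∷ [] ⟧ f vs ≈ ⟦ (α , []) ∷ (γ , Y) ∷ (β , Y′) ∷ [] ⟧ f vs
    ⟦⟧-pad {x} {α} {β} {γ} {a} {b} {Y} {Y′} p q r e f vs = +-cong (*-congʳ p) (begin
      x * Dˢ (a ∷ b ∷ []) f vs + 0#                 ≈⟨ +-congʳ (*-cong (≈-sym r) (e f vs)) ⟩
      β * Dˢ Y′ f vs + 0#                            ≈⟨ +-identityˡ _ ⟨
      0# + (β * Dˢ Y′ f vs + 0#)                     ≈⟨ +-congʳ (≈-trans (*-congʳ q) (zeroˡ _)) ⟨
      γ * Dˢ Y f vs + (β * Dˢ Y′ f vs + 0#)          ∎)

    pad-simulates : ∀ {Q vs₀ es₀ x α β γ a b Y Y′} → 1# ≈ α → γ ≈ 0# → β ≈ x →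
                    (∀ f vs → Dˢ (a ∷ b ∷ []) f vs ≈ Dˢ Y′ f vs) →
                    Simulates Q vs₀ es₀ ((1# , []) ∷ (x , a ∷ b ∷ []) ∷ []) →
                    Simulates Q vs₀ es₀ ((α , []) ∷ (γ , Y) ∷ (β , Y′) ∷ [])
    pad-simulates {Y = Y} {Y′} p q r e (simulates i s) = simulates i λ qv qe →
      ≈-trans (s qv qe) (⟦⟧-pad {Y = Y} {Y′} p q r e _ _)

    empty-simulates : ∀ {Q α β γ Y Y′} → 1# ≈ α → γ ≈ 0# → β ≈ 0# →
                      Simulates Q [] [] ((α , []) ∷ (γ , Y) ∷ (β , Y′) ∷ [])
    empty-simulates {Q} {α} {β} {γ} {Y} {Y′} p q r = simulates [] λ {vs} {es} _ _ → ≈-sym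
      (≈-trans (⇝-sound {(α , []) ∷ (γ , Y) ∷ (β , Y′) ∷ []} {(1# , []) ∷ []}
                        (keep (≈-sym p) (drop q (drop r []))) (M es) vs)
               (≈-trans (+-identityʳ _) (*-identityˡ _)))

  -- Gluing and cutting along labelled vertices

  module Blocks {K V : Set} (_≟ᴷ_ : DecidableEquality K) (_≟ⱽ_ : DecidableEquality V) where
    private
      module K where
        open Removal _≟ᴷ_ public
        open Operators _≟ᴷ_ public
      module V where
        open Removal _≟ⱽ_ public
        open Operators _≟ⱽ_ public
    open Restriction _≟ᴷ_ _≟ⱽ_
    open DecMembership _≟ᴷ_ using (_∈?_)

    relabel : (K → V) → WEdge K → WEdge V
    relabel ι (a , b , w) = ι a , ι b , w

    embed : (K → V) → K.Op → V.Op
    embed ι = map λ (c , Y) → c , map ι Y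

    cutEdge : (K → V) → V × K × Carrier → WEdge V
    cutEdge ι (a , k , w) = a , ι k , w

    -- The edges of c are the only ones between a block and the rest; a subset of them demands vertices
    -- of the rest (the second components) and removes vertices from the block.
    cutOp : List (V × K × Carrier) → (List K → Carrier) → List K → V.Op
    cutOp []                H ks = (H ks , []) ∷ []
    cutOp ((a , k , w) ∷ c) H ks =
      cutOp c H ks ++ (if does (k ∈? ks) then V.use a w (cutOp c H (ks K.∖ k)) else [])

    cutOp-∷ : ∀ {a k w} c H {ks} → k ∈ ks →
              cutOp ((a , k , w) ∷ c) H ks ≡ cutOp c H ks ++ V.use a w (cutOp c H (ks K.∖ k))
    cutOp-∷ {a} {k} {w} c H {ks} k∈ = cong (λ b → cutOp c H ks ++ (if b then V.use a w (cutOp c H (ks K.∖ k)) else []))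
      (dec-true (k ∈? ks) k∈)

    module _ (a₁ a₂ a₃ : V) (k₁ k₂ k₃ : K) (w₁ w₂ w₃ : Carrier) (H : List K → Carrier) (ks : List K) where
      -- All eight subsets of three edges, the last edge varying fastest.
      cutOp₃ : V.Op
      cutOp₃ =
        (H ks , []) ∷
        (w₃ * H (ks K.∖ k₃) , a₃ ∷ []) ∷
        (w₂ * H (ks K.∖ k₂) , a₂ ∷ []) ∷
        (w₂ * (w₃ * H (ks K.∖ k₂ K.∖ k₃)) , a₂ ∷ a₃ ∷ []) ∷
        (w₁ * H (ks K.∖ k₁) , a₁ ∷ []) ∷
        (w₁ * (w₃ * H (ks K.∖ k₁ K.∖ k₃)) , a₁ ∷ a₃ ∷ []) ∷
        (w₁ * (w₂ * H (ks K.∖ k₁ K.∖ k₂)) , a₁ ∷ a₂ ∷ []) ∷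
        (w₁ * (w₂ * (w₃ * H (ks K.∖ k₁ K.∖ k₂ K.∖ k₃))) , a₁ ∷ a₂ ∷ a₃ ∷ []) ∷ []

      cutOp₃-≡ : k₁ ∈ ks → k₂ ∈ ks → k₃ ∈ ks → k₂ ≢ k₁ → k₃ ≢ k₁ → k₃ ≢ k₂ →
                 cutOp ((a₁ , k₁ , w₁) ∷ (a₂ , k₂ , w₂) ∷ (a₃ , k₃ , w₃) ∷ []) H ks ≡ cutOp₃
      cutOp₃-≡ ∈₁ ∈₂ ∈₃ ≢₂₁ ≢₃₁ ≢₃₂ = ≡.trans (cutOp-∷ c₂₃ H ∈₁) (cong₂ (λ xs ys → xs ++ V.use a₁ w₁ ys)
        (two ks ∈₂ ∈₃) (two (ks K.∖ k₁) (K.∈-∖⁺ ≢₂₁ ∈₂) (K.∈-∖⁺ ≢₃₁ ∈₃)))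
        where
        c₃ c₂₃ : List (V × K × Carrier)
        c₃  = (a₃ , k₃ , w₃) ∷ []
        c₂₃ = (a₂ , k₂ , w₂) ∷ c₃

        two : ∀ js → k₂ ∈ js → k₃ ∈ js → cutOp c₂₃ H js ≡
              (H js , []) ∷ (w₃ * H (js K.∖ k₃) , a₃ ∷ []) ∷ (w₂ * H (js K.∖ k₂) , a₂ ∷ []) ∷
              (w₂ * (w₃ * H (js K.∖ k₂ K.∖ k₃)) , a₂ ∷ a₃ ∷ []) ∷ []
        two js ∈₂ ∈₃ = ≡.trans (cutOp-∷ c₃ H ∈₂) (cong₂ (λ xs ys → xs ++ V.use a₂ w₂ ys)
          (cutOp-∷ [] H ∈₃) (cutOp-∷ [] H (K.∈-∖⁺ ≢₃₂ ∈₃)))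

    -- Of the labelled vertices only those in `ks` are still to be covered, while all of `vs₀`
    -- always are. No edge of a block leads to `Q`, so the sum splits into a product, whereas
    -- `Simulates` needs an operator.
    record Block (Q : Pred V 0ℓ) (ι : K → V) (vs₀ : List V) (es₀ : List (WEdge V))
                 (H : List K → Carrier) : Set₁ where
      constructor block
      field
        inside  : All (λ v → ¬ Q v) vs₀
        apart   : ∀ k → ι k ∉ vs₀
        insideᴷ : ∀ k → ¬ Q (ι k)
        sum     : ∀ ks {vs es} → All Q vs → All (V.EndsIn Q) es →
                  V.M (es₀ ++ es) (vs₀ ++ map ι ks ++ vs) ≈ H ks * V.M es vs

    module _ {ι : K → V} (ι-injective : ∀ {j k} → ι j ≡ ι k → j ≡ k) where

      map-∖ : ∀ k ks → map ι ks V.∖ ι k ≡ map ι (ks K.∖ k)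
      map-∖ k []       = ≡.refl
      map-∖ k (j ∷ ks) with j ≟ᴷ k | ι j ≟ⱽ ι k
      ... | yes _  | yes _  = map-∖ k ks
      ... | no  _  | no  _  = cong (ι j ∷_) (map-∖ k ks)
      ... | yes e  | no ¬e  = contradiction (cong ι e) ¬e
      ... | no ¬e  | yes e  = contradiction (ι-injective e) ¬e

      ∈-map⁻′ : ∀ {k ks} → ι k ∈ map ι ks → k ∈ ks
      ∈-map⁻′ {k} ιk∈ with j , j∈ , e ← ∈-map⁻ ι ιk∈ = subst (_∈ _) (≡.sym (ι-injective e)) j∈

      D-map : ∀ k f ks → V.D (ι k) f (map ι ks) ≡ K.D k (f ∘ map ι) ks
      D-map k f ks = D-restrict (map ι) f ks (∈-map⁺ ι) ∈-map⁻′ (map-∖ k ks)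

      M-map : ∀ es ks → V.M (map (relabel ι) es) (map ι ks) ≈ K.M es ks
      M-map []                 []      = ≈-refl
      M-map []                 (_ ∷ _) = ≈-refl
      M-map ((a , b , w) ∷ es) ks = +-cong (M-map es ks) (*-congˡ (begin
        V.D (ι a) (V.D (ι b) (V.M (map (relabel ι) es))) (map ι ks)
          ≡⟨ D-map a _ ks ⟩
        K.D a (λ js → V.D (ι b) (V.M (map (relabel ι) es)) (map ι js)) ks
          ≈⟨ K.D-cong a (reflexive (D-map b _ _)) ⟩
        K.D a (K.D b (λ js → V.M (map (relabel ι) es) (map ι js))) ks
          ≈⟨ K.D-cong a (K.D-cong b (M-map es _)) ⟩
        K.D a (K.D b (K.M es)) ks ∎))

      module _ {us ws : List V} (∉us : ∀ k → ι k ∉ us) (∉ws : ∀ k → ι k ∉ ws) where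
        private
          φ : List K → List V
          φ ks = us ++ map ι ks ++ ws

        D-chart : ∀ k f ks → V.D (ι k) f (φ ks) ≡ K.D k (f ∘ φ) ks
        D-chart k f ks = ≡.trans (D-++ʳ _≟ⱽ_ f us _ (∉us k)) (≡.trans
          (D-++ˡ _≟ⱽ_ _ (map ι ks) ws (∉ws k)) (D-map k _ ks))

        Dˢ-chart : ∀ Y f ks → V.Dˢ (map ι Y) f (φ ks) ≈ K.Dˢ Y (f ∘ φ) ks
        Dˢ-chart []      f ks = ≈-refl
        Dˢ-chart (k ∷ Y) f ks = ≈-trans (reflexive (D-chart k _ ks)) (K.D-cong k (Dˢ-chart Y f _))

        ⟦⟧-chart : ∀ op f ks → V.⟦ embed ι op ⟧ f (φ ks) ≈ K.⟦ op ⟧ (f ∘ φ) ks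
        ⟦⟧-chart []             f ks = ≈-refl
        ⟦⟧-chart ((c , Y) ∷ op) f ks = +-cong (*-congˡ (Dˢ-chart Y f ks)) (⟦⟧-chart op f ks)

      module _ {Q : Pred V 0ℓ} where
        private
          avoid : ∀ {v vs} → ¬ Q v → All Q vs → v ∉ vs
          avoid ¬q q v∈ = ¬q (All.lookup q v∈)

        local : (∀ k → ¬ Q (ι k)) → ∀ es → Block Q ι [] (map (relabel ι) es) (K.M es)
        local ¬Qι es₀ = block [] (λ _ ()) ¬Qι λ ks {vs} {es} qv qe → begin
          V.M (map (relabel ι) es₀ ++ es) (map ι ks ++ vs)
            ≈⟨ M-++ _≟ⱽ_ Image (labelled es₀) (All.map⁺ (All.universal (λ k → k , ≡.refl) ks))
                 (All.map (λ (p , q) → ∉-image p , ∉-image q) qe) (All.map ∉-image qv) ⟩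
          V.M (map (relabel ι) es₀) (map ι ks) * V.M es vs
            ≈⟨ *-congʳ (M-map es₀ ks) ⟩
          K.M es₀ ks * V.M es vs ∎
          where
          Image : Pred V 0ℓ
          Image v = ∃ λ k → v ≡ ι k
          ∉-image : ∀ {v} → Q v → ¬ Image v
          ∉-image q (k , ≡.refl) = ¬Qι k q
          labelled : ∀ es → All (V.EndsIn Image) (map (relabel ι) es)
          labelled []                 = []
          labelled ((a , b , _) ∷ es) = ((a , ≡.refl) , (b , ≡.refl)) ∷ labelled es

        -- Along a chain `attach` and `cut` alternate: the first absorbs a part that acts on the
        -- labelled vertices alone, so that its operator becomes a change of `H`; the second makes
        -- the block an operator on what follows. Seen from the attached part, the outside `Q′`
        -- comprises the block as well as `Q`.
        attach : ∀ {Q′ vs₀ es₀ H vs₁ es₁ op} → V.Simulates Q′ vs₁ es₁ (embed ι op) → Block Q ι vs₀ es₀ H →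
                 (∀ {v} → Q v → Q′ v) → (∀ k → Q′ (ι k)) → All Q′ vs₀ → All (V.EndsIn Q′) es₀ →
                 Block Q ι (vs₁ ++ vs₀) (es₁ ++ es₀) (K.⟦ op ⟧ H)
        attach {Q′} {vs₀} {es₀} {H} {vs₁} {es₁} {op} (V.simulates ins s) (block ins₀ ap insᴷ b) Q⊆Q′ Q′ι Q′v Q′e =
          block (All.++⁺ (All.map (λ ¬q q → ¬q (Q⊆Q′ q)) ins) ins₀) apart insᴷ λ ks {vs} {es} qv qe → begin
            V.M ((es₁ ++ es₀) ++ es) ((vs₁ ++ vs₀) ++ map ι ks ++ vs)
              ≡⟨ cong₂ V.M (++-assoc es₁ es₀ es) (++-assoc vs₁ vs₀ _) ⟩
            V.M (es₁ ++ es₀ ++ es) (vs₁ ++ vs₀ ++ map ι ks ++ vs)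
              ≈⟨ s (All.++⁺ Q′v (All.++⁺ (All.map⁺ (All.universal Q′ι ks)) (All.map Q⊆Q′ qv)))
                   (All.++⁺ Q′e (All.map (λ (p , q) → Q⊆Q′ p , Q⊆Q′ q) qe)) ⟩
            V.⟦ embed ι op ⟧ (V.M (es₀ ++ es)) (vs₀ ++ map ι ks ++ vs)
              ≈⟨ ⟦⟧-chart ap (λ k → avoid (insᴷ k) qv) op _ ks ⟩
            K.⟦ op ⟧ (λ js → V.M (es₀ ++ es) (vs₀ ++ map ι js ++ vs)) ks
              ≈⟨ K.⟦⟧-cong {λ _ → ⊤} (λ _ → b _ qv qe) op (All.universal (λ _ → tt) ks) ⟩
            K.⟦ op ⟧ (λ js → H js * V.M es vs) ks
              ≈⟨ K.⟦⟧-*ʳ _ H op ks ⟩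
            K.⟦ op ⟧ H ks * V.M es vs ∎
          where
          apart : ∀ k → ι k ∉ vs₁ ++ vs₀
          apart k ιk∈ = [ (λ v∈ → All.lookup ins v∈ (Q′ι k)) , ap k ]′ (∈-++⁻ vs₁ ιk∈)

        cut : ∀ {vs₀ es₀ H} → Block Q ι vs₀ es₀ H → ∀ c → All (Q ∘ proj₁) c → ∀ ks →
              V.Simulates Q (vs₀ ++ map ι ks) (map (cutEdge ι) c ++ es₀) (cutOp c H ks)
        cut {vs₀} {es₀} {H} (block ins ap insᴷ b) c qc ks = V.simulates
          (All.++⁺ ins (All.map⁺ (All.universal insᴷ ks)))
          λ {vs} {es} qv qe → begin
            V.M ((map (cutEdge ι) c ++ es₀) ++ es) ((vs₀ ++ map ι ks) ++ vs)
              ≡⟨ cong₂ V.M (++-assoc (map (cutEdge ι) c) es₀ es) (++-assoc vs₀ (map ι ks) vs) ⟩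
            V.M (map (cutEdge ι) c ++ es₀ ++ es) (vs₀ ++ map ι ks ++ vs)
              ≈⟨ expand c qc ks qe qv ⟩
            V.⟦ cutOp c H ks ⟧ (V.M es) vs ∎
          where
          expand : ∀ c → All (Q ∘ proj₁) c → ∀ ks {vs es} → All (V.EndsIn Q) es → All Q vs →
                   V.M (map (cutEdge ι) c ++ es₀ ++ es) (vs₀ ++ map ι ks ++ vs) ≈ V.⟦ cutOp c H ks ⟧ (V.M es) vs
          expand [] [] ks {vs} {es} qe qv = ≈-trans (b ks qv qe) (≈-sym (+-identityʳ _))
          expand ((a , k , w) ∷ c) (qa ∷ qc) ks {vs} {es} qe qv = ≈-trans
            (+-cong (expand c qc ks qe qv) used) (≈-sym (V.⟦++⟧ (cutOp c H ks) _ _ vs))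
            where
            f : List V → Carrier
            f = V.M (map (cutEdge ι) c ++ es₀ ++ es)

            a∉ : ∀ js → a ∉ map ι js
            a∉ js a∈ with j , _ , ≡.refl ← ∈-map⁻ ι a∈ = insᴷ j qa

            used : w * V.D a (V.D (ι k) f) (vs₀ ++ map ι ks ++ vs) ≈
                   V.⟦ if does (k ∈? ks) then V.use a w (cutOp c H (ks K.∖ k)) else [] ⟧ (V.M es) vs
            used = ≈-trans (*-congˡ (begin
              V.D a (V.D (ι k) f) (vs₀ ++ map ι ks ++ vs)
                ≡⟨ D-++ʳ _≟ⱽ_ _ vs₀ _ (λ a∈ → All.lookup ins a∈ qa) ⟩
              V.D a (λ ws → V.D (ι k) f (vs₀ ++ ws)) (map ι ks ++ vs)
                ≡⟨ D-++ʳ _≟ⱽ_ _ (map ι ks) vs (a∉ ks) ⟩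
              V.D a (λ ws → V.D (ι k) f (vs₀ ++ map ι ks ++ ws)) vs
                ≈⟨ V.D-cong a (≈-trans (reflexive (D-chart ap (λ j → avoid (insᴷ j) (V.∖-all a qv)) k f ks))
                     (K.D-cong k (expand c qc _ qe (V.∖-all a qv)))) ⟩
              V.D a (λ ws → K.D k (λ js → V.⟦ cutOp c H js ⟧ (V.M es) ws) ks) vs ∎))
              last
              where
              last : w * V.D a (λ ws → K.D k (λ js → V.⟦ cutOp c H js ⟧ (V.M es) ws) ks) vs ≈
                     V.⟦ if does (k ∈? ks) then V.use a w (cutOp c H (ks K.∖ k)) else [] ⟧ (V.M es) vs
              last with k ∈? ks
              ... | yes k∈ = ≈-trans (*-congˡ (V.D-cong a (reflexive (K.D-∈ _ k∈))))
                                     (V.⟦use⟧ a w (cutOp c H (ks K.∖ k)) _ vs)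
              ... | no  k∉ = ≈-trans (*-congˡ (≈-trans (V.D-cong a (reflexive (K.D-∉ _ k∉))) (reflexive (V.D-0 a vs))))
                                     (zeroʳ w)

-- Perfect matchings as subsets of the edges

module SubsetSums (R : CommutativeSemiring 0ℓ 0ℓ) {V : Set} (_≟_ : DecidableEquality V) where
  open CommutativeSemiring R renaming (refl to ≈-refl; trans to ≈-trans; sym to ≈-sym)
  open import Relation.Binary.Reasoning.Setoid setoid
  open MatchingSums R
  open Removal _≟_
  open DecMembership _≟_ using (_∈?_)

  total : List Carrier → Carrier
  total = foldr _+_ 0#

  weightOf : List (WEdge V) → Carrier
  weightOf S = foldr _*_ 1# (map (proj₂ ∘ proj₂) S)

  sumOver : ∀ {P : Pred (List (WEdge V)) 0ℓ} → Decidable P → List (List (WEdge V)) → Carrier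
  sumOver P? Ss = total (map weightOf (filter P? Ss))

  sumOver-++ : ∀ {P} (P? : Decidable P) Ss Ts → sumOver P? (Ss ++ Ts) ≈ sumOver P? Ss + sumOver P? Ts
  sumOver-++ P? []       Ts = ≈-sym (+-identityˡ _)
  sumOver-++ P? (S ∷ Ss) Ts with does (P? S)
  ... | true  = ≈-trans (+-congˡ (sumOver-++ P? Ss Ts)) (≈-sym (+-assoc _ _ _))
  ... | false = sumOver-++ P? Ss Ts

  sumOver-⇔ : ∀ {P Q} (P? : Decidable P) (Q? : Decidable Q) → (∀ S → P S ⇔ Q S) → ∀ Ss → sumOver P? Ss ≈ sumOver Q? Ss
  sumOver-⇔ P? Q? P⇔Q []       = ≈-refl
  sumOver-⇔ P? Q? P⇔Q (S ∷ Ss) with does (P? S) | does (Q? S) | does-⇔ (P⇔Q S) (P? S) (Q? S)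
  ... | true  | true  | _ = +-congˡ (sumOver-⇔ P? Q? P⇔Q Ss)
  ... | false | false | _ = sumOver-⇔ P? Q? P⇔Q Ss

  module _ {P Q : Pred (List (WEdge V)) 0ℓ} (P? : Decidable P) (Q? : Decidable Q) (a b : V) (w : Carrier) where
    private
      e : WEdge V
      e = a , b , w

    sumOver-∷ : (∀ S → P (e ∷ S) ⇔ Q S) → ∀ Ss → sumOver P? (map (e ∷_) Ss) ≈ w * sumOver Q? Ss
    sumOver-∷ P⇔Q []       = ≈-sym (zeroʳ w)
    sumOver-∷ P⇔Q (S ∷ Ss) with does (P? (e ∷ S)) | does (Q? S) | does-⇔ (P⇔Q S) (P? (e ∷ S)) (Q? S)
    ... | true  | true  | _ = ≈-trans (+-congˡ (sumOver-∷ P⇔Q Ss)) (≈-sym (distribˡ _ _ _))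
    ... | false | false | _ = sumOver-∷ P⇔Q Ss

    sumOver-none : (∀ S → ¬ P (e ∷ S)) → ∀ Ss → sumOver P? (map (e ∷_) Ss) ≈ 0#
    sumOver-none ¬P []       = ≈-refl
    sumOver-none ¬P (S ∷ Ss) with does (P? (e ∷ S)) | dec-false (P? (e ∷ S)) (¬P S)
    ... | false | _ = sumOver-none ¬P Ss

  _∈ᵉ′_ : V → WEdge V → Set
  v ∈ᵉ′ (a , b , _) = v ≡ a ⊎ v ≡ b

  _∈ᵉ′?_ : ∀ v (e : WEdge V) → Dec (v ∈ᵉ′ e)
  v ∈ᵉ′? (a , b , _) = (v ≟ a) ⊎-dec (v ≟ b)

  degree : V → List (WEdge V) → ℕ
  degree v S = length (filter (v ∈ᵉ′?_) S)

  degree-∈ : ∀ {v e} S → v ∈ᵉ′ e → degree v (e ∷ S) ≡ suc (degree v S)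
  degree-∈ {v} {e} S v∈e = cong length (filter-accept (v ∈ᵉ′?_) {e} {S} v∈e)

  degree-∉ : ∀ {v e} S → ¬ v ∈ᵉ′ e → degree v (e ∷ S) ≡ degree v S
  degree-∉ {v} {e} S v∉e = cong length (filter-reject (v ∈ᵉ′?_) {e} {S} v∉e)

  opaque
    indicator : V → List V → ℕ
    indicator v vs = if does (v ∈? vs) then 1 else 0

    indicator-∈ : ∀ {v vs} → v ∈ vs → indicator v vs ≡ 1
    indicator-∈ {v} {vs} v∈ = cong (if_then 1 else 0) (dec-true (v ∈? vs) v∈)

    indicator-∉ : ∀ {v vs} → v ∉ vs → indicator v vs ≡ 0
    indicator-∉ {v} {vs} v∉ = cong (if_then 1 else 0) (dec-false (v ∈? vs) v∉)

    indicator-∖ : ∀ {u v vs} → u ≢ v → indicator u (vs ∖ v) ≡ indicator u vs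
    indicator-∖ {u} {v} {vs} u≢v = cong (if_then 1 else 0)
      (does-⇔ (mk⇔ (proj₁ ∘ ∈-∖⁻ {vs = vs}) (∈-∖⁺ u≢v)) (u ∈? vs ∖ v) (u ∈? vs))

  module _ (W : List V) where

    -- Being perfect does not survive the removal of an edge, but degrees prescribed by an indicator
    -- do: `W` stays fixed while `vs` shrinks.
    Covers : List V → List (WEdge V) → Set
    Covers vs S = All (λ v → degree v S ≡ indicator v vs) W

    covers? : ∀ vs → Decidable (Covers vs)
    covers? vs S = all? (λ v → degree v S ℕ.≟ indicator v vs) W

    -- An end outside `W` would escape the degree test. A loop would have degree one at its vertex,
    -- while the corresponding product of two removals is zero.
    ProperEdge : Pred (WEdge V) 0ℓ
    ProperEdge (a , b , _) = a ∈ W × b ∈ W × a ≢ b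

    module _ {a b : V} {w : Carrier} {vs : List V} where
      private
        e : WEdge V
        e = a , b , w

      covers-∷ : a ∈ vs → b ∈ vs → a ≢ b → ∀ S → Covers vs (e ∷ S) ⇔ Covers (vs ∖ a ∖ b) S
      covers-∷ a∈ b∈ a≢b S = mk⇔ (All.map (λ {v} → proj₁ (pointwise v))) (All.map (λ {v} → proj₂ (pointwise v)))
        where
        Transfer : V → Set
        Transfer v = (degree v (e ∷ S) ≡ indicator v vs → degree v S ≡ indicator v (vs ∖ a ∖ b)) ×
                     (degree v S ≡ indicator v (vs ∖ a ∖ b) → degree v (e ∷ S) ≡ indicator v vs)

        covered : ∀ {v} → v ∈ᵉ′ e → v ∈ vs → v ∉ vs ∖ a ∖ b → Transfer v
        covered {v} v∈e v∈ v∉ =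
          (λ p → ≡.trans (ℕ.suc-injective (≡.trans (≡.sym (degree-∈ S v∈e)) (≡.trans p (indicator-∈ v∈))))
                         (≡.sym (indicator-∉ v∉))) ,
          (λ p → ≡.trans (degree-∈ S v∈e) (≡.trans (cong suc (≡.trans p (indicator-∉ v∉))) (≡.sym (indicator-∈ v∈))))

        pointwise : ∀ v → Transfer v
        pointwise v with v ∈ᵉ′? e
        ... | yes (inj₁ ≡.refl) = covered (inj₁ ≡.refl) a∈ λ v∈ → proj₂ (∈-∖⁻ {vs = vs} (proj₁ (∈-∖⁻ {vs = vs ∖ a} v∈))) ≡.refl
        ... | yes (inj₂ ≡.refl) = covered (inj₂ ≡.refl) b∈ λ v∈ → proj₂ (∈-∖⁻ {vs = vs ∖ a} v∈) ≡.refl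
        ... | no v∉e = (λ p → ≡.trans (≡.sym (degree-∉ S v∉e)) (≡.trans p (≡.sym same))) ,
                       (λ p → ≡.trans (degree-∉ S v∉e) (≡.trans p same))
          where
          same : indicator v (vs ∖ a ∖ b) ≡ indicator v vs
          same = ≡.trans (indicator-∖ (v∉e ∘ inj₂)) (indicator-∖ (v∉e ∘ inj₁))

      ¬covers : ∀ {v} → v ∈ᵉ′ e → v ∈ W → v ∉ vs → ∀ S → ¬ Covers vs (e ∷ S)
      ¬covers v∈e v∈W v∉ S c
        with () ← ≡.trans (≡.sym (degree-∈ S v∈e)) (≡.trans (All.lookup c v∈W) (indicator-∉ v∉))

    -- Both sides obey the same recursion on the first edge. Sets containing an edge with an end
    -- outside `vs` contribute nothing, since they have positive degree where zero is prescribed.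
    sum-covers : ∀ {es} → All ProperEdge es → ∀ {vs} → All (_∈ W) vs →
                 sumOver (covers? vs) (subsets es) ≈ M es vs
    sum-covers [] {[]} [] with does (covers? [] []) | dec-true (covers? [] []) (All.universal (λ _ → ≡.sym (indicator-∉ λ ())) W)
    ... | true | _ = +-identityʳ 1#
    sum-covers [] {v ∷ vs} (v∈W ∷ _)
      with does (covers? (v ∷ vs) []) | dec-false (covers? (v ∷ vs) []) not
      where
      not : ¬ Covers (v ∷ vs) []
      not c with () ← ≡.trans (All.lookup c v∈W) (indicator-∈ {vs = v ∷ vs} (here ≡.refl))
    ... | false | _ = ≈-refl
    sum-covers {(a , b , w) ∷ es} ((a∈W , b∈W , a≢b) ∷ ps) {vs} vs⊆W = begin
      sumOver (covers? vs) (map ((a , b , w) ∷_) (subsets es) ++ subsets es)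
        ≈⟨ sumOver-++ (covers? vs) (map ((a , b , w) ∷_) (subsets es)) (subsets es) ⟩
      sumOver (covers? vs) (map ((a , b , w) ∷_) (subsets es)) + sumOver (covers? vs) (subsets es)
        ≈⟨ +-cong used (sum-covers ps vs⊆W) ⟩
      w * D a (D b (M es)) vs + M es vs
        ≈⟨ +-comm _ _ ⟩
      M es vs + w * D a (D b (M es)) vs ∎
      where
      used : sumOver (covers? vs) (map ((a , b , w) ∷_) (subsets es)) ≈ w * D a (D b (M es)) vs
      used with a ∈? vs | b ∈? vs
      ... | no a∉  | _ = ≈-trans (sumOver-none (covers? vs) (covers? vs) a b w (¬covers (inj₁ ≡.refl) a∈W a∉) (subsets es))
                           (≈-sym (≈-trans (*-congˡ (reflexive (D-∉ _ a∉))) (zeroʳ w)))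
      ... | yes a∈ | no b∉  = ≈-trans (sumOver-none (covers? vs) (covers? vs) a b w (¬covers (inj₂ ≡.refl) b∈W b∉) (subsets es))
                           (≈-sym (≈-trans (*-congˡ (reflexive (≡.trans (D-∈ _ a∈) (D-∉ (M es) (b∉ ∘ proj₁ ∘ ∈-∖⁻))))) (zeroʳ w)))
      ... | yes a∈ | yes b∈ = begin
        sumOver (covers? vs) (map ((a , b , w) ∷_) (subsets es))
          ≈⟨ sumOver-∷ (covers? vs) (covers? (vs ∖ a ∖ b)) a b w (covers-∷ a∈ b∈ a≢b) (subsets es) ⟩
        w * sumOver (covers? (vs ∖ a ∖ b)) (subsets es)
          ≈⟨ *-congˡ (sum-covers ps (∖-all b (∖-all a vs⊆W))) ⟩
        w * M es (vs ∖ a ∖ b)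
          ≡⟨ cong (w *_) (≡.sym (≡.trans (D-∈ _ a∈) (D-∈ (M es) (∈-∖⁺ (a≢b ∘ ≡.sym) b∈)))) ⟩
        w * D a (D b (M es)) vs ∎

    perfect? : Decidable (λ S → All (λ v → degree v S ≡ 1) W)
    perfect? S = all? (λ v → degree v S ℕ.≟ 1) W

    sum-perfect : ∀ {es} → All ProperEdge es → sumOver perfect? (subsets es) ≈ M es W
    sum-perfect {es} ps = ≈-trans
      (sumOver-⇔ perfect? (covers? W)
        (λ S → mk⇔ (λ c → All.tabulate λ v∈ → ≡.trans (All.lookup c v∈) (≡.sym (indicator-∈ v∈)))
                   (λ c → All.tabulate λ v∈ → ≡.trans (All.lookup c v∈) (indicator-∈ v∈)))
        (subsets es))
      (sum-covers ps (All.tabulate id))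

-- The exchange relations

data Kind : Set where
  positive negative : Kind

module Recurrences (R : CommutativeRing 0ℓ 0ℓ) (X Y : CommutativeRing.Carrier R) where
  open CommutativeRing R
  open RawSemiringDefs (Semiring.rawSemiring semiring) using (_^_)
  open import Relation.Binary.Reasoning.Setoid setoid
  open import Algebra.Solver.Ring.NaturalCoefficients.Default commutativeSemiring
    using (con; solve; _:+_; _:*_; _:^_; _:=_)
  open GroupProperties +-group using () renaming (∙-cancelʳ to +-cancelʳ)

  Z : Carrier
  Z = X ^ 4

  -- The transfer matrices on the triples (A, C, B) below have rank two; seq k n holds the coordinates of
  -- the n-th triple in their image.
  seq : Kind → ℕ → Carrier × Carrier
  seq positive zero    = 0# , 1#
  seq negative zero    = 1# , 0#
  -- The new `d` is the old `A`, because `c₀` is the only nonzero weight leading to `C`.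
  seq positive (suc n) =
    let d , u = seq positive n in
    Z * d + u , (1# + Y + Y) * (Z * d) + (1# + Y) * (1# + Y) * u
  -- The new `u` is the old `A + B`, because `c₀` and `c₂` agree and `c₁` vanishes; the new `d` is
  -- what `A` has beyond `(1 + Y) u`.
  seq negative (suc n) =
    let d , u = seq negative n in
    Z * (d + (1# + Y + Y) * u) , d + (1# + Y) * (1# + Y) * u

  fst snd : Kind → ℕ → Carrier
  fst k n = proj₁ (seq k n)
  snd k n = proj₂ (seq k n)

  -- A chain of n octagons beyond an octagon acts on it as A + B D r D s + C D r D a, where r and s are the
  -- ends of the connecting square and a is the end of the arc.
  A B C : Kind → ℕ → Carrier
  A positive n = Z * fst positive n + snd positive n
  A negative n = fst negative n + (1# + Y) * snd negative n
  B positive n = Y * snd positive n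
  B negative n = Y * (1# + Y) * snd negative n
  C positive n = X ^ 3 * Y * fst positive n
  C negative n = X * Y * snd negative n

  row : Kind → ℕ → Carrier → Carrier → Carrier → Carrier
  row k n a c b = A k n * a + (C k n * c + (B k n * b + 0#))

  row-cong : ∀ k n {a a′ c c′ b b′} → a ≈ a′ → c ≈ c′ → b ≈ b′ → row k n a c b ≈ row k n a′ c′ b′
  row-cong k n p q r = +-cong (*-congˡ p) (+-cong (*-congˡ q) (+-congʳ (*-congˡ r)))

  row-0 : ∀ k n → row k n 0# 0# 0# ≈ 0#
  row-0 k n = solve 3 (λ a b c → a :* con 0 :+ (c :* con 0 :+ (b :* con 0 :+ con 0)) := con 0)
                refl (A k n) (B k n) (C k n)

  -- The weights of a new octagon in the three states of the chain beyond it, by the demands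
  -- made on the octagon from the other side.
  a₀ a₁ a₂ c₀ c₁ c₂ b₀ b₁ b₂ : Kind → Carrier
  a₀ _ = 1# + Y + X ^ 4
  a₁ positive = X
  a₁ negative = X ^ 3
  a₂ _ = 1# + Y
  c₀ positive = X ^ 3
  c₀ negative = X
  c₁ _ = 0#
  c₂ positive = 0#
  c₂ negative = X
  b₀ _ = 1# + Y
  b₁ positive = X
  b₁ negative = 0#
  b₂ _ = 1# + Y

  scaled-zero : ∀ w {x} → x ≈ 0# → w * x ≈ 0#
  scaled-zero w e = trans (*-congˡ e) (zeroʳ w)

  scaled-one : ∀ {w x} → x ≈ 1# → w * (1# * x) ≈ w
  scaled-one e = trans (*-congˡ (trans (*-identityˡ _) e)) (*-identityʳ _)

  scaled-one′ : ∀ {w x} → x ≈ 1# → 1# * (w * x) ≈ w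
  scaled-one′ e = trans (*-identityˡ _) (trans (*-congˡ e) (*-identityʳ _))

  row-zero : ∀ k n {a c b} → a ≈ 0# → c ≈ 0# → b ≈ 0# → row k n a c b ≈ 0#
  row-zero k n p q r = trans (row-cong k n p q r) (row-0 k n)

  A-step : ∀ k n → row k n (a₀ k) (a₁ k) (a₂ k) ≈ A k (suc n)
  A-step positive n = solve 4 (λ x y d u → let z = x :^ 4 in
      (z :* d :+ u) :* (con 1 :+ y :+ z) :+ (x :^ 3 :* y :* d :* x :+ (y :* u :* (con 1 :+ y) :+ con 0))
      := z :* (z :* d :+ u) :+ ((con 1 :+ y :+ y) :* (z :* d) :+ (con 1 :+ y) :* (con 1 :+ y) :* u))
    refl X Y (fst positive n) (snd positive n)
  A-step negative n = solve 4 (λ x y d u → let z = x :^ 4 in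
      (d :+ (con 1 :+ y) :* u) :* (con 1 :+ y :+ z) :+
        (x :* y :* u :* x :^ 3 :+ (y :* (con 1 :+ y) :* u :* (con 1 :+ y) :+ con 0))
      := z :* (d :+ (con 1 :+ y :+ y) :* u) :+ (con 1 :+ y) :* (d :+ (con 1 :+ y) :* (con 1 :+ y) :* u))
    refl X Y (fst negative n) (snd negative n)

  -- The factors `Y` and `1#` are the weights of the two cut edges in use, in the shape in which
  -- `cutOp₃` delivers them.
  B-step : ∀ k n → Y * (1# * row k n (b₀ k) (b₁ k) (b₂ k)) ≈ B k (suc n)
  B-step positive n = solve 4 (λ x y d u → let z = x :^ 4 in
      y :* (con 1 :* ((z :* d :+ u) :* (con 1 :+ y) :+
        (x :^ 3 :* y :* d :* x :+ (y :* u :* (con 1 :+ y) :+ con 0))))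
      := y :* ((con 1 :+ y :+ y) :* (z :* d) :+ (con 1 :+ y) :* (con 1 :+ y) :* u))
    refl X Y (fst positive n) (snd positive n)
  B-step negative n = solve 4 (λ x y d u →
      y :* (con 1 :* ((d :+ (con 1 :+ y) :* u) :* (con 1 :+ y) :+
        (x :* y :* u :* con 0 :+ (y :* (con 1 :+ y) :* u :* (con 1 :+ y) :+ con 0))))
      := y :* (con 1 :+ y) :* (d :+ (con 1 :+ y) :* (con 1 :+ y) :* u))
    refl X Y (fst negative n) (snd negative n)

  C-step : ∀ k n → Y * (1# * row k n (c₀ k) (c₁ k) (c₂ k)) ≈ C k (suc n)
  C-step positive n = solve 4 (λ x y d u → let z = x :^ 4 in
      y :* (con 1 :* ((z :* d :+ u) :* x :^ 3 :+
        (x :^ 3 :* y :* d :* con 0 :+ (y :* u :* con 0 :+ con 0))))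
      := x :^ 3 :* y :* (z :* d :+ u))
    refl X Y (fst positive n) (snd positive n)
  C-step negative n = solve 4 (λ x y d u →
      y :* (con 1 :* ((d :+ (con 1 :+ y) :* u) :* x :+
        (x :* y :* u :* con 0 :+ (y :* (con 1 :+ y) :* u :* x :+ con 0))))
      := x :* y :* (d :+ (con 1 :+ y) :* (con 1 :+ y) :* u))
    refl X Y (fst negative n) (snd negative n)

  A-entry : ∀ k n {a c b} → a ≈ a₀ k → c ≈ a₁ k → b ≈ a₂ k → row k n a c b ≈ A k (suc n)
  A-entry k n p q r = trans (row-cong k n p q r) (A-step k n)

  B-entry : ∀ k n {a c b} → a ≈ b₀ k → c ≈ b₁ k → b ≈ b₂ k → Y * (1# * row k n a c b) ≈ B k (suc n)
  B-entry k n p q r = trans (*-congˡ (*-congˡ (row-cong k n p q r))) (B-step k n)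

  C-entry : ∀ k n {a c b} → a ≈ c₀ k → c ≈ c₁ k → b ≈ c₂ k → Y * (1# * row k n a c b) ≈ C k (suc n)
  C-entry k n p q r = trans (*-congˡ (*-congˡ (row-cong k n p q r))) (C-step k n)

  A-zero : ∀ k → 1# ≈ A k 0
  A-zero positive = solve 1 (λ z → con 1 := z :* con 0 :+ con 1) refl Z
  A-zero negative = solve 1 (λ y → con 1 := con 1 :+ (con 1 :+ y) :* con 0) refl Y

  C-zero : ∀ k → C k 0 ≈ 0#
  C-zero positive = zeroʳ _
  C-zero negative = zeroʳ _

  B-zero⁺ : B positive 0 ≈ Y
  B-zero⁺ = *-identityʳ Y

  B-zero⁻ : B negative 0 ≈ 0#
  B-zero⁻ = zeroʳ _

  O⁺ : ℕ → Carrier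
  O⁺ n = Z * fst positive n + (1# + Y) * snd positive n

  -- The norm of `u + d √(-Z)`, which is what makes Brahmagupta's identity applicable.
  E⁺ : ℕ → Carrier
  E⁺ n = Z * (fst positive n * fst positive n) + snd positive n * snd positive n

  O⁻ : ℕ → Carrier
  O⁻ n = fst negative n + (1# + Y) * snd negative n

  -- This is `fst negative (suc n)` without its factor `Z`, so that `E⁻` is again a value of the
  -- form `Z d² + u²`.
  next : ℕ → Carrier
  next n = fst negative n + (1# + Y + Y) * snd negative n

  E⁻ : ℕ → Carrier
  E⁻ n = Z * (next n * next n) + snd negative (suc n) * snd negative (suc n)

  -- The Casoratian of consecutive states, with a term moved so that no subtraction occurs.
  casoratian⁺ : ∀ n → snd positive n * fst positive (suc n) ≈
                      fst positive n * snd positive (suc n) + (Z * (Y * Y)) ^ n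
  casoratian⁺ zero    = solve 2 (λ z y → con 1 :* (z :* con 0 :+ con 1) := con 0 :* ((con 1 :+ y :+ y) :* (z :* con 0) :+ (con 1 :+ y) :* (con 1 :+ y) :* con 1) :+ con 1) refl Z Y
  -- One step multiplies `u d′ - d u′` by the determinant `Z Y²`. Adding the negative part of that
  -- product to both sides leaves an identity between polynomials with natural coefficients.
  casoratian⁺ (suc n) = +-cancelʳ (Z * (Y * Y) * (d * u′)) _ _ (begin
    u′ * (Z * d′ + u′) + Z * (Y * Y) * (d * u′)
      ≈⟨ solve 4 (λ z y d u → let d′ = z :* d :+ u
                                  u′ = (con 1 :+ y :+ y) :* (z :* d) :+ (con 1 :+ y) :* (con 1 :+ y) :* u in
           u′ :* (z :* d′ :+ u′) :+ z :* (y :* y) :* (d :* u′) :=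
           d′ :* ((con 1 :+ y :+ y) :* (z :* d′) :+ (con 1 :+ y) :* (con 1 :+ y) :* u′) :+ z :* (y :* y) :* (u :* d′))
           refl Z Y d u ⟩
    d′ * snd positive (suc (suc n)) + Z * (Y * Y) * (u * d′)
      ≈⟨ +-congˡ (*-congˡ (casoratian⁺ n)) ⟩
    d′ * snd positive (suc (suc n)) + Z * (Y * Y) * (d * u′ + (Z * (Y * Y)) ^ n)
      ≈⟨ solve 4 (λ a c e w → a :+ c :* (e :+ w) := a :+ c :* w :+ c :* e) refl _ (Z * (Y * Y)) (d * u′) _ ⟩
    d′ * snd positive (suc (suc n)) + (Z * (Y * Y)) ^ suc n + Z * (Y * Y) * (d * u′) ∎)
    where
    d u d′ u′ : Carrier
    d  = fst positive n
    u  = snd positive n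
    d′ = fst positive (suc n)
    u′ = snd positive (suc n)

  -- The orientation is opposite to that of `casoratian⁺` because this sequence starts at `1 , 0`
  -- instead of `0 , 1`; the determinant is the same.
  casoratian⁻ : ∀ n → fst negative n * snd negative (suc n) ≈
                      snd negative n * fst negative (suc n) + (Z * (Y * Y)) ^ n
  casoratian⁻ zero    = solve 2 (λ z y → con 1 :* (con 1 :+ (con 1 :+ y) :* (con 1 :+ y) :* con 0) := con 0 :* (z :* (con 1 :+ (con 1 :+ y :+ y) :* con 0)) :+ con 1) refl Z Y
  casoratian⁻ (suc n) = +-cancelʳ (Z * (Y * Y) * (u * d′)) _ _ (begin
    d′ * (d′ + (1# + Y) * (1# + Y) * u′) + Z * (Y * Y) * (u * d′)
      ≈⟨ solve 4 (λ z y d u → let d′ = z :* (d :+ (con 1 :+ y :+ y) :* u)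
                                  u′ = d :+ (con 1 :+ y) :* (con 1 :+ y) :* u in
           d′ :* (d′ :+ (con 1 :+ y) :* (con 1 :+ y) :* u′) :+ z :* (y :* y) :* (u :* d′) :=
           u′ :* (z :* (d′ :+ (con 1 :+ y :+ y) :* u′)) :+ z :* (y :* y) :* (d :* u′))
           refl Z Y d u ⟩
    u′ * fst negative (suc (suc n)) + Z * (Y * Y) * (d * u′)
      ≈⟨ +-congˡ (*-congˡ (casoratian⁻ n)) ⟩
    u′ * fst negative (suc (suc n)) + Z * (Y * Y) * (u * d′ + (Z * (Y * Y)) ^ n)
      ≈⟨ solve 4 (λ a c e w → a :+ c :* (e :+ w) := a :+ c :* w :+ c :* e) refl _ (Z * (Y * Y)) (u * d′) _ ⟩
    u′ * fst negative (suc (suc n)) + (Z * (Y * Y)) ^ suc n + Z * (Y * Y) * (u * d′) ∎)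
    where
    d u d′ u′ : Carrier
    d  = fst negative n
    u  = snd negative n
    d′ = fst negative (suc n)
    u′ = snd negative (suc n)

  -- The product exceeds `E⁺ (suc n)` by `Z Y` times the Casoratian `u d′ - d u′`.
  O⁺-recurrence : ∀ n → O⁺ (suc n) * O⁺ n ≈ E⁺ (suc n) + Z * Y * (Z * (Y * Y)) ^ n
  O⁺-recurrence n = +-cancelʳ (Z * Y * (d * u′)) _ _ (begin
    O⁺ (suc n) * O⁺ n + Z * Y * (d * u′)
      ≈⟨ solve 4 (λ z y d u → let d′ = z :* d :+ u
                                  u′ = (con 1 :+ y :+ y) :* (z :* d) :+ (con 1 :+ y) :* (con 1 :+ y) :* u in
           (z :* d′ :+ (con 1 :+ y) :* u′) :* (z :* d :+ (con 1 :+ y) :* u) :+ z :* y :* (d :* u′) :=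
           (z :* (d′ :* d′) :+ u′ :* u′) :+ z :* y :* (u :* d′))
           refl Z Y d u ⟩
    E⁺ (suc n) + Z * Y * (u * d′)
      ≈⟨ +-congˡ (*-congˡ (casoratian⁺ n)) ⟩
    E⁺ (suc n) + Z * Y * (d * u′ + (Z * (Y * Y)) ^ n)
      ≈⟨ solve 4 (λ a c e w → a :+ c :* (e :+ w) := a :+ c :* w :+ c :* e) refl _ (Z * Y) (d * u′) _ ⟩
    E⁺ (suc n) + Z * Y * (Z * (Y * Y)) ^ n + Z * Y * (d * u′) ∎)
    where
    d u d′ u′ : Carrier
    d  = fst positive n
    u  = snd positive n
    d′ = fst positive (suc n)
    u′ = snd positive (suc n)

  O⁻-recurrence : ∀ n → O⁻ n * O⁻ (suc n) ≈ E⁻ n + Y * (Z * (Y * Y)) ^ n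
  O⁻-recurrence n = +-cancelʳ (Y * (u * d′)) _ _ (begin
    O⁻ n * O⁻ (suc n) + Y * (u * d′)
      ≈⟨ solve 4 (λ z y d u → let d′ = z :* (d :+ (con 1 :+ y :+ y) :* u)
                                  h  = d :+ (con 1 :+ y :+ y) :* u
                                  u′ = d :+ (con 1 :+ y) :* (con 1 :+ y) :* u in
           (d :+ (con 1 :+ y) :* u) :* (d′ :+ (con 1 :+ y) :* u′) :+ y :* (u :* d′) :=
           (z :* (h :* h) :+ u′ :* u′) :+ y :* (d :* u′))
           refl Z Y d u ⟩
    E⁻ n + Y * (d * u′)
      ≈⟨ +-congˡ (*-congˡ (casoratian⁻ n)) ⟩
    E⁻ n + Y * (u * d′ + (Z * (Y * Y)) ^ n)
      ≈⟨ solve 4 (λ a c e w → a :+ c :* (e :+ w) := a :+ c :* w :+ c :* e) refl _ Y (u * d′) _ ⟩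
    E⁻ n + Y * (Z * (Y * Y)) ^ n + Y * (u * d′) ∎)
    where
    d u d′ u′ : Carrier
    d  = fst negative n
    u  = snd negative n
    d′ = fst negative (suc n)
    u′ = snd negative (suc n)

  -- Brahmagupta's identity (d² z + u²)(d′² z + u′²) = (d d′ z + u u′)² + z (u d′ − d u′)².
  brahmagupta : ∀ z d u d′ u′ w → u * d′ ≈ d * u′ + w →
                (z * (d′ * d′) + u′ * u′) * (z * (d * d) + u * u) ≈
                (z * (d * d′) + u * u′) * (z * (d * d′) + u * u′) + z * (w * w)
  brahmagupta z d u d′ u′ w e = +-cancelʳ (z * (2d * u′ * (u * d′))) _ _ (begin
    (z * (d′ * d′) + u′ * u′) * (z * (d * d) + u * u) + z * (2d * u′ * (u * d′))
      ≈⟨ solve 5 (λ z d u d′ u′ → (z :* (d′ :* d′) :+ u′ :* u′) :* (z :* (d :* d) :+ u :* u) :+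
             z :* ((d :+ d) :* u′ :* (u :* d′)) :=
             (z :* (d :* d′) :+ u :* u′) :* (z :* (d :* d′) :+ u :* u′) :+
             z :* (u :* d′ :* (u :* d′) :+ d :* u′ :* (d :* u′))) refl z d u d′ u′ ⟩
    G + z * (u * d′ * (u * d′) + d * u′ * (d * u′))
      ≈⟨ +-congˡ (*-congˡ (+-congʳ (*-cong e e))) ⟩
    G + z * ((d * u′ + w) * (d * u′ + w) + d * u′ * (d * u′))
      ≈⟨ solve 5 (λ g z d u′ w → g :+ z :* ((d :* u′ :+ w) :* (d :* u′ :+ w) :+ d :* u′ :* (d :* u′)) :=
             g :+ z :* (w :* w) :+ z :* ((d :+ d) :* u′ :* (d :* u′ :+ w))) refl G z d u′ w ⟩
    G + z * (w * w) + z * (2d * u′ * (d * u′ + w))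
      ≈⟨ +-congˡ (*-congˡ (*-congˡ (sym e))) ⟩
    G + z * (w * w) + z * (2d * u′ * (u * d′)) ∎)
    where
    2d G : Carrier
    2d = d + d
    G  = (z * (d * d′) + u * u′) * (z * (d * d′) + u * u′)

  E⁺-recurrence : ∀ n → E⁺ (suc n) * E⁺ n ≈ O⁺ n ^ 4 + Z * ((Z * (Y * Y)) ^ n * (Z * (Y * Y)) ^ n)
  E⁺-recurrence n = trans (brahmagupta Z d u (fst positive (suc n)) (snd positive (suc n)) _ (casoratian⁺ n))
    -- The polar form `Z d d′ + u u′` equals `(Z d + (1 + Y) u)²`, the square of `O⁺ n`.
    (+-congʳ (solve 4 (λ z y d u →
       let d′ = z :* d :+ u
           u′ = (con 1 :+ y :+ y) :* (z :* d) :+ (con 1 :+ y) :* (con 1 :+ y) :* u in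
       (z :* (d :* d′) :+ u :* u′) :* (z :* (d :* d′) :+ u :* u′) := (z :* d :+ (con 1 :+ y) :* u) :^ 4)
       refl Z Y d u))
    where
    d u : Carrier
    d = fst positive n
    u = snd positive n

  -- In the coordinates `h = next n` and `v = snd negative (suc n)` a step is
  -- `h′ = Z h + (1 + 2Y) v`, `v′ = Z h + (1 + Y)² v`, and the polar form is the square of
  -- `Z h + (1 + Y) v = O⁻ (suc n)`. The later state enters `brahmagupta` first, so that the
  -- Casoratian has a positive sign.
  E⁻-recurrence : ∀ n → E⁻ n * E⁻ (suc n) ≈
                 O⁻ (suc n) ^ 4 + Z * (Y * Y * (Z * (Y * Y)) ^ n * (Y * Y * (Z * (Y * Y)) ^ n))
  E⁻-recurrence n = trans
    (brahmagupta Z (next (suc n)) (snd negative (suc (suc n))) h v _ step)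
    (+-congʳ (solve 4 (λ z y h v →
       let h′ = z :* h :+ (con 1 :+ y :+ y) :* v
           v′ = z :* h :+ (con 1 :+ y) :* (con 1 :+ y) :* v in
       (z :* (h′ :* h) :+ v′ :* v) :* (z :* (h′ :* h) :+ v′ :* v) := (z :* h :+ (con 1 :+ y) :* v) :^ 4)
       refl Z Y h v))
    where
    d u h v w : Carrier
    d = fst negative n
    u = snd negative n
    h = next n
    v = snd negative (suc n)
    w = (Z * (Y * Y)) ^ n

    step : snd negative (suc (suc n)) * h ≈ next (suc n) * v + Y * Y * w
    step = +-cancelʳ (Y * Y * (u * (Z * h))) _ _ (begin
      snd negative (suc (suc n)) * h + Y * Y * (u * (Z * h))
        ≈⟨ solve 4 (λ z y d u →
             let h = d :+ (con 1 :+ y :+ y) :* u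
                 v = d :+ (con 1 :+ y) :* (con 1 :+ y) :* u in
             (z :* h :+ (con 1 :+ y) :* (con 1 :+ y) :* v) :* h :+ y :* y :* (u :* (z :* h)) :=
             (z :* h :+ (con 1 :+ y :+ y) :* v) :* v :+ y :* y :* (d :* v)) refl Z Y d u ⟩
      next (suc n) * v + Y * Y * (d * v)
        ≈⟨ +-congˡ (*-congˡ (casoratian⁻ n)) ⟩
      next (suc n) * v + Y * Y * (u * (Z * h) + w)
        ≈⟨ solve 4 (λ a c e w → a :+ c :* (e :+ w) := a :+ c :* w :+ c :* e) refl _ (Y * Y) _ w ⟩
      next (suc n) * v + Y * Y * w + Y * Y * (u * (Z * h)) ∎)

  odd-closing : ∀ n → row positive n ((1# + Y) * (1# + Y) + X ^ 4) (X * (1# + Y)) ((1# + Y) * (1# + Y)) ≈ O⁺ (suc n)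
  odd-closing n = solve 4 (λ x y d u → let z = x :^ 4 in
      (z :* d :+ u) :* ((con 1 :+ y) :* (con 1 :+ y) :+ z) :+
        (x :^ 3 :* y :* d :* (x :* (con 1 :+ y)) :+ (y :* u :* ((con 1 :+ y) :* (con 1 :+ y)) :+ con 0))
      := z :* (z :* d :+ u) :+ (con 1 :+ y) :* ((con 1 :+ y :+ y) :* (z :* d) :+ (con 1 :+ y) :* (con 1 :+ y) :* u))
    refl X Y (fst positive n) (snd positive n)

  -- The outer `row` runs over the states of the right tail, the inner ones over those of the left
  -- tail. The array of weights is symmetric, as the even graphs have a half-turn symmetry.
  center : Kind → ℕ → Carrier
  center positive n =
    row positive n (row positive n ((1# + Y) * (1# + Y) + X ^ 4) (X * (1# + Y)) ((1# + Y) * (1# + Y)))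
                   (row positive n (X * (1# + Y)) (X * X) (X * (1# + Y)))
                   (row positive n ((1# + Y) * (1# + Y)) (X * (1# + Y)) ((1# + Y) * (1# + Y)))
  center negative n =
    row negative n (row negative n (1# + X ^ 4) (X ^ 3) 1#)
                   (row negative n (X ^ 3) (X * X) 0#)
                   (row negative n 1# 0# 1#)

  even-closing : Kind → ℕ → Carrier
  even-closing positive n = E⁺ (suc n)
  even-closing negative n = E⁻ n

  center-closing : ∀ k n → center k n ≈ even-closing k n
  center-closing positive n = solve 4 (λ x y d u →
      let z = x :^ 4
          α = z :* d :+ u
          β = y :* u
          γ = x :^ 3 :* y :* d
          s = con 1 :+ y
          r = λ a c b → α :* a :+ (γ :* c :+ (β :* b :+ con 0))
          u′ = (con 1 :+ y :+ y) :* (z :* d) :+ s :* s :* u in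
      r (r (s :* s :+ z) (x :* s) (s :* s)) (r (x :* s) (x :* x) (x :* s)) (r (s :* s) (x :* s) (s :* s))
      := z :* (α :* α) :+ u′ :* u′)
    refl X Y (fst positive n) (snd positive n)
  center-closing negative n = solve 4 (λ x y d u →
      let z = x :^ 4
          s = con 1 :+ y
          α = d :+ s :* u
          β = y :* s :* u
          γ = x :* y :* u
          r = λ a c b → α :* a :+ (γ :* c :+ (β :* b :+ con 0))
          h = d :+ (con 1 :+ y :+ y) :* u
          v = d :+ s :* s :* u in
      r (r (con 1 :+ z) (x :^ 3) (con 1)) (r (x :^ 3) (x :* x) (con 0)) (r (con 1) (con 0) (con 1))
      := z :* (h :* h) :+ v :* v)
    refl X Y (fst negative n) (snd negative n)

double : ℕ → ℕ
double zero    = zero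
double (suc k) = suc (suc (double k))

-- Denominators and cleared exchange relations

module Denominators (R : CommutativeRing 0ℓ 0ℓ) (X Y : CommutativeRing.Carrier R) where
  open CommutativeRing R
  open RawSemiringDefs (Semiring.rawSemiring semiring) using (_^_)
  open import Algebra.Properties.Semiring.Exp semiring using (^-homo-*)
  open import Relation.Binary.Reasoning.Setoid setoid
  open import Algebra.Solver.Ring.NaturalCoefficients.Default commutativeSemiring
    using (con; solve; _:+_; _:*_; _:^_; _:=_)
  open Recurrences R X Y

  ^4-cong : ∀ {a b} → a ≈ b → a ^ 4 ≈ b ^ 4
  ^4-cong e = *-cong e (*-cong e (*-cong e (*-congʳ e)))

  ^-double : ∀ a k → a ^ double k ≈ a ^ k * a ^ k
  ^-double a zero    = sym (*-identityˡ 1#)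
  ^-double a (suc k) = trans (*-congˡ (*-congˡ (^-double a k)))
    (solve 2 (λ a p → a :* (a :* (p :* p)) := a :* p :* (a :* p)) refl a (a ^ k))

  ^-quadruple : ∀ a k → a ^ (double k ℕ.+ double k) ≈ (a ^ k) ^ 4
  ^-quadruple a k = trans (^-homo-* a (double k) (double k)) (trans (*-cong (^-double a k) (^-double a k))
    (solve 1 (λ p → p :* p :* (p :* p) := p :^ 4) refl (a ^ k)))

  determinant-^ : ∀ k → (Z * (Y * Y)) ^ k ≈ (X ^ k) ^ 4 * (Y ^ k * Y ^ k)
  determinant-^ zero    = solve 0 (con 1 := con 1 :^ 4 :* (con 1 :* con 1)) refl
  determinant-^ (suc k) = trans (*-congˡ (determinant-^ k))
    (solve 4 (λ x y p t → x :^ 4 :* (y :* y) :* (p :^ 4 :* (t :* t)) := (x :* p) :^ 4 :* (y :* t :* (y :* t)))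
      refl X Y (X ^ k) (Y ^ k))

  -- The values of `m` at `2k + 3`, `2k + 4`, `-(2k + 1)` and `-(2k + 2)`. Except for `mO⁺`, the
  -- indices are shifted against the numerators: these denominators belong to `O⁺ k`, `E⁺ (suc k)`,
  -- `O⁻ (suc k)` and `E⁻ (suc k)`.
  mO⁺ mE⁺ mO⁻ mE⁻ : ℕ → Carrier
  mO⁺ k = X ^ suc (double k) * Y ^ k
  mE⁺ k = X ^ (4 ℕ.+ (double k ℕ.+ double k)) * Y ^ suc (double k)
  mO⁻ k = X ^ suc (double k) * Y ^ suc k
  mE⁻ k = X ^ (4 ℕ.+ (double k ℕ.+ double k)) * Y ^ (3 ℕ.+ double k)

  module _ (k : ℕ) where
    private
      p t : Carrier
      p = X ^ k
      t = Y ^ k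

    mO⁺-^ : mO⁺ k ≈ X * (p * p) * t
    mO⁺-^ = *-congʳ (*-congˡ (^-double X k))

    mO⁻-^ : mO⁻ k ≈ X * (p * p) * (Y * t)
    mO⁻-^ = *-congʳ (*-congˡ (^-double X k))

    mE⁺-^ : mE⁺ k ≈ X ^ 4 * p ^ 4 * (Y * (t * t))
    mE⁺-^ = *-cong (trans (^-homo-* X 4 (double k ℕ.+ double k)) (*-congˡ (^-quadruple X k))) (*-congˡ (^-double Y k))

    mE⁻-^ : mE⁻ k ≈ X ^ 4 * p ^ 4 * (Y ^ 3 * (t * t))
    mE⁻-^ = *-cong (trans (^-homo-* X 4 (double k ℕ.+ double k)) (*-congˡ (^-quadruple X k)))
                   (trans (^-homo-* Y 3 (double k)) (*-congˡ (^-double Y k)))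

  module _ (k : ℕ) where
    private
      p t : Carrier
      p = X ^ k
      t = Y ^ k

    mO⁺-product : mO⁺ (suc k) * mO⁺ k ≈ mE⁺ k
    mO⁺-product = trans (*-cong (mO⁺-^ (suc k)) (mO⁺-^ k)) (trans
      (solve 4 (λ x y p t → x :* (x :* p :* (x :* p)) :* (y :* t) :* (x :* (p :* p) :* t) := x :^ 4 :* p :^ 4 :* (y :* (t :* t))) refl X Y p t)
      (sym (mE⁺-^ k)))

    mO⁻-product : mO⁻ k * mO⁻ (suc k) ≈ mE⁻ k
    mO⁻-product = trans (*-cong (mO⁻-^ k) (mO⁻-^ (suc k))) (trans
      (solve 4 (λ x y p t → x :* (p :* p) :* (y :* t) :* (x :* (x :* p :* (x :* p)) :* (y :* (y :* t))) := x :^ 4 :* p :^ 4 :* (y :^ 3 :* (t :* t))) refl X Y p t)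
      (sym (mE⁻-^ k)))

    mE⁺-product : mE⁺ (suc k) * mE⁺ k ≈ mO⁺ (suc k) ^ 4
    mE⁺-product = trans (*-cong (mE⁺-^ (suc k)) (mE⁺-^ k)) (trans
      (solve 4 (λ x y p t → x :^ 4 :* (x :* p) :^ 4 :* (y :* (y :* t :* (y :* t))) :* (x :^ 4 :* p :^ 4 :* (y :* (t :* t)))
         := (x :* (x :* p :* (x :* p)) :* (y :* t)) :^ 4) refl X Y p t)
      (sym (^4-cong (mO⁺-^ (suc k)))))

    mE⁻-product : mE⁻ k * mE⁻ (suc k) ≈ mO⁻ (suc k) ^ 4
    mE⁻-product = trans (*-cong (mE⁻-^ k) (mE⁻-^ (suc k))) (trans
      (solve 4 (λ x y p t → x :^ 4 :* p :^ 4 :* (y :^ 3 :* (t :* t)) :* (x :^ 4 :* (x :* p) :^ 4 :* (y :^ 3 :* (y :* t :* (y :* t))))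
         := (x :* (x :* p :* (x :* p)) :* (y :* (y :* t))) :^ 4) refl X Y p t)
      (sym (^4-cong (mO⁻-^ (suc k)))))

    mE⁺-determinant : Z * Y * (Z * (Y * Y)) ^ k ≈ mE⁺ k
    mE⁺-determinant = trans (*-congˡ (determinant-^ k)) (trans
      (solve 4 (λ x y p t → x :^ 4 :* y :* (p :^ 4 :* (t :* t)) := x :^ 4 :* p :^ 4 :* (y :* (t :* t))) refl X Y p t)
      (sym (mE⁺-^ k)))

    mE⁻-determinant : Y * (Z * (Y * Y)) ^ suc k ≈ mE⁻ k
    mE⁻-determinant = trans (*-congˡ (determinant-^ (suc k))) (trans
      (solve 4 (λ x y p t → y :* ((x :* p) :^ 4 :* (y :* t :* (y :* t))) := x :^ 4 :* p :^ 4 :* (y :^ 3 :* (t :* t))) refl X Y p t)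
      (sym (mE⁻-^ k)))

    mE⁺-determinant² : Z * ((Z * (Y * Y)) ^ suc k * (Z * (Y * Y)) ^ suc k) ≈ mE⁺ (suc k) * mE⁺ k
    mE⁺-determinant² = trans (*-congˡ (*-cong (determinant-^ (suc k)) (determinant-^ (suc k)))) (trans
      (solve 4 (λ x y p t → let w = (x :* p) :^ 4 :* (y :* t :* (y :* t)) in x :^ 4 :* (w :* w) :=
         x :^ 4 :* (x :* p) :^ 4 :* (y :* (y :* t :* (y :* t))) :* (x :^ 4 :* p :^ 4 :* (y :* (t :* t)))) refl X Y p t)
      (sym (*-cong (mE⁺-^ (suc k)) (mE⁺-^ k))))

    mE⁻-determinant² : Z * (Y * Y * (Z * (Y * Y)) ^ suc k * (Y * Y * (Z * (Y * Y)) ^ suc k)) ≈ mE⁻ k * mE⁻ (suc k)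
    mE⁻-determinant² = trans (*-congˡ (*-cong (*-congˡ (determinant-^ (suc k))) (*-congˡ (determinant-^ (suc k))))) (trans
      (solve 4 (λ x y p t → let w = y :* y :* ((x :* p) :^ 4 :* (y :* t :* (y :* t))) in x :^ 4 :* (w :* w) :=
         x :^ 4 :* p :^ 4 :* (y :^ 3 :* (t :* t)) :* (x :^ 4 :* (x :* p) :^ 4 :* (y :^ 3 :* (y :* t :* (y :* t))))) refl X Y p t)
      (sym (*-cong (mE⁻-^ k) (mE⁻-^ (suc k)))))

  monomial : ℕ → ℕ → Carrier
  monomial a b = X ^ a * Y ^ b

  -- The relation a c = b + 1 (resp. a c = b⁴ + 1) between the fractions a / d, b / e and c / f, with
  -- denominators cleared.
  record OddRelation (a b c d e f : Carrier) : Set where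
    constructor relation
    field cleared : a * c * e ≈ (b + e) * (d * f)

  record EvenRelation (a b c d e f : Carrier) : Set where
    constructor relation
    field cleared : a * c * e ^ 4 ≈ (b ^ 4 + e ^ 4) * (d * f)

  -- Here `μ` is the Casoratian term, `f` the middle denominator or its fourth power, and `g` the
  -- product of the outer denominators. As all three coincide, no further computation with the
  -- numerators is needed.
  clear : ∀ {a c f g μ} → a ≈ c + μ → μ ≈ f → g ≈ f → a * f ≈ (c + f) * g
  clear p q r = *-cong (trans p (+-congˡ q)) (sym r)

  O⁺-cleared : ∀ k → OddRelation (O⁺ (suc k)) (E⁺ (suc k)) (O⁺ k) (mO⁺ (suc k)) (mE⁺ k) (mO⁺ k)
  O⁺-cleared k = relation (clear (O⁺-recurrence k) (mE⁺-determinant k) (mO⁺-product k))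

  E⁺-cleared : ∀ k → EvenRelation (E⁺ (suc (suc k))) (O⁺ (suc k)) (E⁺ (suc k)) (mE⁺ (suc k)) (mO⁺ (suc k)) (mE⁺ k)
  E⁺-cleared k = relation (clear (E⁺-recurrence (suc k)) (trans (mE⁺-determinant² k) (mE⁺-product k)) (mE⁺-product k))

  O⁻-cleared : ∀ k → OddRelation (O⁻ (suc k)) (E⁻ (suc k)) (O⁻ (suc (suc k))) (mO⁻ k) (mE⁻ k) (mO⁻ (suc k))
  O⁻-cleared k = relation (clear (O⁻-recurrence (suc k)) (mE⁻-determinant k) (mO⁻-product k))

  E⁻-cleared : ∀ k → EvenRelation (E⁻ (suc k)) (O⁻ (suc (suc k))) (E⁻ (suc (suc k))) (mE⁻ k) (mO⁻ (suc k)) (mE⁻ (suc k))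
  E⁻-cleared k = relation (clear (E⁻-recurrence (suc k)) (trans (mE⁻-determinant² k) (mE⁻-product k)) (mE⁻-product k))

  -- The relations at n = 0, ..., 4 involve an index 0, 1 or 2, where the general formulas for
  -- numerator and denominator do not both apply.
  cleared₀ : EvenRelation (E⁻ 0) (O⁻ 1) (E⁻ 1) (monomial 0 1) (monomial 1 1) (mE⁻ 0)
  cleared₀ = relation (clear (E⁻-recurrence 0)
    (solve 2 (λ x y → x :^ 4 :* (y :* y :* con 1 :* (y :* y :* con 1)) := (x :^ 1 :* y :^ 1) :^ 4) refl X Y)
    (solve 2 (λ x y → con 1 :* y :^ 1 :* (x :^ 4 :* y :^ 3) := (x :^ 1 :* y :^ 1) :^ 4) refl X Y))

  cleared₁ : OddRelation X (E⁻ 0) (O⁻ 1) (monomial 0 0) (monomial 0 1) (monomial 1 1)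
  cleared₁ = relation (solve 2 (λ x y →
    let z = x :^ 4
        h = con 1 :+ (con 1 :+ y :+ y) :* con 0
        v = con 1 :+ (con 1 :+ y) :* (con 1 :+ y) :* con 0 in
    x :* (z :* h :+ (con 1 :+ y) :* v) :* (x :^ 0 :* y :^ 1) :=
    (z :* (h :* h) :+ v :* v :+ x :^ 0 :* y :^ 1) :* (x :^ 0 :* y :^ 0 :* (x :^ 1 :* y :^ 1))) refl X Y)

  cleared₂ : EvenRelation Y X (E⁻ 0) (monomial 0 0) (monomial 0 0) (monomial 0 1)
  cleared₂ = relation (solve 2 (λ x y →
    let z = x :^ 4
        h = con 1 :+ (con 1 :+ y :+ y) :* con 0
        v = con 1 :+ (con 1 :+ y) :* (con 1 :+ y) :* con 0 in
    y :* (z :* (h :* h) :+ v :* v) :* (x :^ 0 :* y :^ 0) :^ 4 :=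
    (x :^ 4 :+ (x :^ 0 :* y :^ 0) :^ 4) :* (x :^ 0 :* y :^ 0 :* (x :^ 0 :* y :^ 1))) refl X Y)

  cleared₃ : OddRelation (O⁺ 0) Y X (monomial 1 0) (monomial 0 0) (monomial 0 0)
  cleared₃ = relation (solve 2 (λ x y →
    (x :^ 4 :* con 0 :+ (con 1 :+ y) :* con 1) :* x :* (x :^ 0 :* y :^ 0) :=
    (y :+ x :^ 0 :* y :^ 0) :* (x :^ 1 :* y :^ 0 :* (x :^ 0 :* y :^ 0))) refl X Y)

  cleared₄ : EvenRelation (E⁺ 1) (O⁺ 0) Y (monomial 4 1) (monomial 1 0) (monomial 0 0)
  cleared₄ = relation (solve 2 (λ x y →
    let z = x :^ 4
        d = z :* con 0 :+ con 1
        u = (con 1 :+ y :+ y) :* (z :* con 0) :+ (con 1 :+ y) :* (con 1 :+ y) :* con 1 in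
    (z :* (d :* d) :+ u :* u) :* y :* (x :^ 1 :* y :^ 0) :^ 4 :=
    ((z :* con 0 :+ (con 1 :+ y) :* con 1) :^ 4 :+ (x :^ 1 :* y :^ 0) :^ 4) :* (x :^ 4 :* y :^ 1 :* (x :^ 0 :* y :^ 0))) refl X Y)

-- Constant terms of the numerators

module ConstantTerms (R : CommutativeRing 0ℓ 0ℓ) (X Y : CommutativeRing.Carrier R) where
  open CommutativeRing R
  open Recurrences R X Y

  module Augmented (ε : Carrier → ℤ)
    (ε-+ : ∀ a b → ε (a + b) ≡ ε a ℤ.+ ε b) (ε-* : ∀ a b → ε (a * b) ≡ ε a ℤ.* ε b)
    (ε-0 : ε 0# ≡ + 0) (ε-1 : ε 1# ≡ + 1) (ε-X : ε X ≡ + 0) (ε-Y : ε Y ≡ + 0) where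

    Unit Vanishing : Carrier → Set
    Unit a      = ε a ≡ + 1
    Vanishing a = ε a ≡ + 0

    module _ {a b : Carrier} where
      0+1 : Vanishing a → Unit b → Unit (a + b)
      0+1 p q = ≡.trans (ε-+ a b) (cong₂ ℤ._+_ p q)

      1+0 : Unit a → Vanishing b → Unit (a + b)
      1+0 p q = ≡.trans (ε-+ a b) (cong₂ ℤ._+_ p q)

      1*1 : Unit a → Unit b → Unit (a * b)
      1*1 p q = ≡.trans (ε-* a b) (cong₂ ℤ._*_ p q)

      0*- : Vanishing a → Vanishing (a * b)
      0*- p = ≡.trans (ε-* a b) (≡.trans (cong (ℤ._* ε b) p) (ℤ.*-zeroˡ (ε b)))

      -*0 : Vanishing b → Vanishing (a * b)
      -*0 p = ≡.trans (ε-* a b) (≡.trans (cong (ε a ℤ.*_) p) (ℤ.*-zeroʳ (ε a)))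

    ε-Z : Vanishing Z
    ε-Z = 0*- ε-X

    ε-1+Y : Unit (1# + Y)
    ε-1+Y = 1+0 ε-1 ε-Y

    ε-snd⁺ : ∀ n → Unit (snd positive n)
    ε-snd⁺ zero    = ε-1
    ε-snd⁺ (suc n) = 0+1 (-*0 (0*- ε-Z)) (1*1 (1*1 ε-1+Y ε-1+Y) (ε-snd⁺ n))

    -- The index is shifted because `snd negative 0` is zero.
    ε-snd⁻ : ∀ n → Unit (snd negative (suc n))
    ε-snd⁻ zero    = 1+0 ε-1 (-*0 ε-0)
    ε-snd⁻ (suc n) = 0+1 (0*- ε-Z) (1*1 (1*1 ε-1+Y ε-1+Y) (ε-snd⁻ n))

    ε-O⁺ : ∀ n → Unit (O⁺ n)
    ε-O⁺ n = 0+1 (0*- ε-Z) (1*1 ε-1+Y (ε-snd⁺ n))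

    ε-E⁺ : ∀ n → Unit (E⁺ n)
    ε-E⁺ n = 0+1 (0*- ε-Z) (1*1 (ε-snd⁺ n) (ε-snd⁺ n))

    ε-O⁻ : ∀ n → Unit (O⁻ (suc n))
    ε-O⁻ n = 0+1 (0*- ε-Z) (1*1 ε-1+Y (ε-snd⁻ n))

    ε-E⁻ : ∀ n → Unit (E⁻ n)
    ε-E⁻ n = 0+1 (0*- ε-Z) (1*1 (ε-snd⁻ n) (ε-snd⁻ n))

-- Chains of octagons

module DecidablePolynomials (D : IntegralDomain)
  (_≟_ : ∀ a b → Dec (IntegralDomain._≈_ D a b)) where
  private module R = IntegralDomain D
  open Polynomials D

  _≟ᴾ_ : ∀ p q → Dec (p ≈ q)
  []      ≟ᴾ []      = yes ≈-refl
  (a ∷ p) ≟ᴾ []      = map′ (λ (e , f) → ∷-zero e f) (λ e → at e 0 , tail-zero e) ((a ≟ R.0#) ×-dec (p ≟ᴾ []))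
  []      ≟ᴾ (b ∷ q) = map′ (λ (e , f) → ≈-sym (∷-zero e (≈-sym f))) (λ e → R.sym (at e 0) , ≈-sym (tail-zero (≈-sym e)))
                         ((b ≟ R.0#) ×-dec ([] ≟ᴾ q))
  (a ∷ p) ≟ᴾ (b ∷ q) = map′ (λ (e , f) → ∷-cong e f) (λ e → at e 0 , tail-≈ e) ((a ≟ b) ×-dec (p ≟ᴾ q))

open DecidablePolynomials ℤ-integralDomain ℤ._≟_ using () renaming (_≟ᴾ_ to _≟₁_)
open DecidablePolynomials ℤ[x₁].integralDomain _≟₁_ using () renaming (_≟ᴾ_ to _≟²_) public

open MatchingSums Pol.commutativeSemiring
open Recurrences Pol.commutativeRing x₁ x₂

module V where
  open Removal _≟ᵛ_ public
  open Operators _≟ᵛ_ public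
module C where
  open Removal _≟ᶜ_ public
  open Operators _≟ᶜ_ public
module E where
  open Removal _≟ᵉ_ public
  open Operators _≟ᵉ_ public
module BC = Blocks _≟ᶜ_ _≟ᵛ_
module BE = Blocks _≟ᵉ_ _≟ᵛ_

corners : List Corner
corners = nl ∷ nr ∷ et ∷ eb ∷ sr ∷ sl ∷ wb ∷ wt ∷ []

octagon : List (Edge Corner)
octagon =
  (nl , nr , Pol.1#) ∷ (nr , et , x₁) ∷ (et , eb , Pol.1#) ∷ (eb , sr , x₁) ∷
  (sr , sl , Pol.1#) ∷ (sl , wb , x₁) ∷ (wb , wt , Pol.1#) ∷ (wt , nl , x₁) ∷ []

-- The two new vertices are matched with each other, or each with its foot.
squareOp : Side → C.Op
squareOp s = (Pol.1# , []) ∷ (x₂ , foot s start ∷ foot s finish ∷ []) ∷ []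

infixr 5 _◂_
_◂_ : Side → (List Corner → Polynomial) → List Corner → Polynomial
s ◂ H = C.⟦ squareOp s ⟧ H

-- The cells of a chain are mirror images of one cell: the one that has its square on the north, and the
-- rest of the chain on its right.
data Dir : Set where
  rightward leftward : Dir

data Vert : Set where
  up down : Vert

flip : Vert → Vert
flip up   = down
flip down = up

mirrorV mirrorH : Corner → Corner
mirrorV nl = sl
mirrorV nr = sr
mirrorV et = eb
mirrorV eb = et
mirrorV sr = nr
mirrorV sl = nl
mirrorV wb = wt
mirrorV wt = wb
mirrorH nl = nr
mirrorH nr = nl
mirrorH et = wt
mirrorH eb = wb
mirrorH sr = sl
mirrorH sl = sr
mirrorH wb = eb
mirrorH wt = et

place : Dir → Vert → Corner → Corner
place rightward up   c = c
place rightward down c = mirrorV c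
place leftward  up   c = mirrorH c
place leftward  down c = mirrorV (mirrorH c)

side : Vert → Side
side up   = north
side down = south

endSide : Dir → Side
endSide rightward = east
endSide leftward  = west

-- The outer corners face the next octagon of the chain, the inner ones the previous octagon. Index
-- 1 marks the ends of the link edge of weight `x₂`, index 2 those of the link edge of weight 1.
arcEnd inner₁ inner₂ outer₁ outer₂ : Kind → Dir → Vert → Corner
arcEnd positive d v = place d v nl
arcEnd negative d v = place d v nr
inner₁ positive d v = place d v wt
inner₁ negative d v = place d v wb
inner₂ positive d v = place d v wb
inner₂ negative d v = place d v wt
outer₁ positive d v = place d v eb
outer₁ negative d v = place d v et
outer₂ positive d v = place d v et
outer₂ negative d v = place d v eb

tailOp : Kind → Dir → Vert → ℕ → C.Op
tailOp k d v l =
  (A k l , []) ∷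
  (C k l , outer₁ k d v ∷ arcEnd k d v ∷ []) ∷
  (B k l , outer₁ k d v ∷ outer₂ k d v ∷ []) ∷ []

Values : List (Polynomial × Polynomial) → Set
Values = All λ (p , q) → p Pol.≈ q

values? : ∀ ps → Dec (Values ps)
values? = all? λ (p , q) → p ≟² q

-- ks are the corners left by the near side; the three values belong to the three states of the far side.
triple : Kind → Dir → Vert → (List Corner → Polynomial) → List Corner → (Polynomial × Polynomial × Polynomial) →
         List (Polynomial × Polynomial)
triple k d v H ks (a , c , b) =
  (H ks , a) ∷
  (C.Dˢ (outer₁ k d v ∷ arcEnd k d v ∷ []) H ks , c) ∷
  (C.Dˢ (outer₁ k d v ∷ outer₂ k d v ∷ []) H ks , b) ∷ []

nothing-left : Polynomial × Polynomial × Polynomial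
nothing-left = Pol.0# , Pol.0# , Pol.0#

-- The corner lists follow the order of the terms of `cutOp₃`. The five with `nothing-left` are
-- those in which the two colours are not balanced.
table : Kind → Dir → Vert → List (Polynomial × Polynomial)
table k d v =
  t corners (a₀ k , a₁ k , a₂ k) ++
  t (corners C.∖ arcEnd k d v) nothing-left ++
  t (corners C.∖ inner₂ k d v) nothing-left ++
  t (corners C.∖ inner₂ k d v C.∖ arcEnd k d v) nothing-left ++
  t (corners C.∖ inner₁ k d v) nothing-left ++
  t (corners C.∖ inner₁ k d v C.∖ arcEnd k d v) (c₀ k , c₁ k , c₂ k) ++
  t (corners C.∖ inner₁ k d v C.∖ inner₂ k d v) (b₀ k , b₁ k , b₂ k) ++
  t (corners C.∖ inner₁ k d v C.∖ inner₂ k d v C.∖ arcEnd k d v) nothing-left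
  where
  t : List Corner → (Polynomial × Polynomial × Polynomial) → List (Polynomial × Polynomial)
  t = triple k d v (side v ◂ C.M octagon)

1+x₂ : Polynomial
1+x₂ = Pol.1# Pol.+ x₂

centerSum : Kind → List Corner → Polynomial
centerSum positive = north ◂ south ◂ C.M octagon
centerSum negative = C.M octagon

closing-table : List (Polynomial × Polynomial)
closing-table = triple positive leftward down (east ◂ south ◂ C.M octagon) corners
  (1+x₂ Pol.* 1+x₂ Pol.+ x₁ Pol.^ 4 , x₁ Pol.* 1+x₂ , 1+x₂ Pol.* 1+x₂)

center-table : Kind → List (Polynomial × Polynomial)
center-table positive =
  t corners (1+x₂ Pol.* 1+x₂ Pol.+ x₁ Pol.^ 4 , x₁ Pol.* 1+x₂ , 1+x₂ Pol.* 1+x₂) ++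
  t (corners C.∖ et C.∖ sl) (x₁ Pol.* 1+x₂ , x₁ Pol.* x₁ , x₁ Pol.* 1+x₂) ++
  t (corners C.∖ et C.∖ eb) (1+x₂ Pol.* 1+x₂ , x₁ Pol.* 1+x₂ , 1+x₂ Pol.* 1+x₂)
  where
  t : List Corner → Polynomial × Polynomial × Polynomial → List (Polynomial × Polynomial)
  t = triple positive leftward up (centerSum positive)
center-table negative =
  t corners (Pol.1# Pol.+ x₁ Pol.^ 4 , x₁ Pol.^ 3 , Pol.1#) ++
  t (corners C.∖ eb C.∖ sr) (x₁ Pol.^ 3 , x₁ Pol.* x₁ , Pol.0#) ++
  t (corners C.∖ eb C.∖ et) (Pol.1# , Pol.0# , Pol.1#)
  where
  t : List Corner → Polynomial × Polynomial × Polynomial → List (Polynomial × Polynomial)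
  t = triple negative leftward up (centerSum negative)

-- All entries are closed polynomials, so that they can be compared by evaluation.
opaque
  unfolding Removal.D

  table-values : ∀ k d v → Values (table k d v)
  table-values positive rightward up   = from-yes (values? (table positive rightward up))
  table-values positive rightward down = from-yes (values? (table positive rightward down))
  table-values positive leftward  up   = from-yes (values? (table positive leftward up))
  table-values positive leftward  down = from-yes (values? (table positive leftward down))
  table-values negative rightward up   = from-yes (values? (table negative rightward up))
  table-values negative rightward down = from-yes (values? (table negative rightward down))
  table-values negative leftward  up   = from-yes (values? (table negative leftward up))
  table-values negative leftward  down = from-yes (values? (table negative leftward down))

  closing-odd⁺ : ∀ l → C.⟦ tailOp positive leftward down l ⟧ (east ◂ south ◂ C.M octagon) corners Pol.≈ O⁺ (suc l)
  closing-odd⁺ l with a ∷ c ∷ b ∷ [] ← from-yes (values? closing-table) =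
    Pol.trans (row-cong positive l a c b) (odd-closing l)

  -- Having no end square, `O_1` is an ordinary cell, so the total is the entry
  -- `A negative (suc l)`, which is `O⁻ (suc l)` by definition.
  closing-odd⁻ : ∀ l → C.⟦ tailOp negative leftward up l ⟧ (north ◂ C.M octagon) corners Pol.≈ O⁻ (suc l)
  closing-odd⁻ l with a ∷ c ∷ b ∷ _ ← table-values negative leftward up =
    Pol.trans (row-cong negative l a c b) (A-step negative l)

  closing-even : ∀ k l → C.⟦ tailOp k rightward down l ⟧ (C.⟦ tailOp k leftward up l ⟧ (centerSum k)) corners
                         Pol.≈ even-closing k l
  closing-even positive l
    with a₁ ∷ c₁ ∷ b₁ ∷ a₂ ∷ c₂ ∷ b₂ ∷ a₃ ∷ c₃ ∷ b₃ ∷ [] ← from-yes (values? (center-table positive)) =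
    Pol.trans (row-cong positive l (row-cong positive l a₁ c₁ b₁) (row-cong positive l a₂ c₂ b₂) (row-cong positive l a₃ c₃ b₃))
      (center-closing positive l)
  closing-even negative l
    with a₁ ∷ c₁ ∷ b₁ ∷ a₂ ∷ c₂ ∷ b₂ ∷ a₃ ∷ c₃ ∷ b₃ ∷ [] ← from-yes (values? (center-table negative)) =
    Pol.trans (row-cong negative l (row-cong negative l a₁ c₁ b₁) (row-cong negative l a₂ c₂ b₂) (row-cong negative l a₃ c₃ b₃))
      (center-closing negative l)

corner-injective : ∀ {i c d} → corner i c ≡ corner i d → c ≡ d
corner-injective ≡.refl = ≡.refl

new-injective : ∀ {i s a b} → new i s a ≡ new i s b → a ≡ b
new-injective ≡.refl = ≡.refl

octagonEdges-ends : ∀ {P : Pred Vertex 0ℓ} i → (∀ c → P (corner i c)) → All (V.EndsIn P) (octagonEdges i)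
octagonEdges-ends i p =
  (p nl , p nr) ∷ (p nr , p et) ∷ (p et , p eb) ∷ (p eb , p sr) ∷
  (p sr , p sl) ∷ (p sl , p wb) ∷ (p wb , p wt) ∷ (p wt , p nl) ∷ []

squareEdges-ends : ∀ {P : Pred Vertex 0ℓ} χ i s → (∀ c → P (corner i c)) → (∀ e → P (new i s e)) →
                   All (V.EndsIn P) (squareEdges χ (i , s))
squareEdges-ends χ i s p q =
  (p (foot s start) , q start) ∷ (q start , q finish) ∷ (q finish , p (foot s finish)) ∷ []

middle : List (Edge End)
middle = (start , finish , Pol.1#) ∷ []

opaque
  unfolding Removal.D

  middle-both : E.M middle (start ∷ finish ∷ []) Pol.≈ Pol.1#
  middle-both = from-yes (E.M middle (start ∷ finish ∷ []) ≟² Pol.1#)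

  middle-start : E.M middle (start ∷ []) Pol.≈ Pol.0#
  middle-start = from-yes (E.M middle (start ∷ []) ≟² Pol.0#)

  middle-finish : E.M middle (finish ∷ []) Pol.≈ Pol.0#
  middle-finish = from-yes (E.M middle (finish ∷ []) ≟² Pol.0#)

  middle-none : E.M middle [] Pol.≈ Pol.1#
  middle-none = from-yes (E.M middle [] ≟² Pol.1#)

Outside : ℤ → Side → Pred Vertex 0ℓ
Outside i s v = ∀ e → v ≢ new i s e

-- The vertical edges are used both or not at all, so only the product of their weights matters and
-- the operator is the same for every `χ`.
square-simulates : ∀ χ i s → V.Simulates (Outside i s) (squareVertices (i , s)) (squareEdges χ (i , s))
                                         (BC.embed (corner i) (squareOp s))
square-simulates χ i s = go (χ i s) ≡.refl
  where
  outside : ∀ e → ¬ Outside i s (new i s e)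
  outside e o = o e ≡.refl

  weights : End → Polynomial × Polynomial
  weights start  = x₂ , Pol.1#
  weights finish = Pol.1# , x₂

  pieces : End → List (Vertex × End × Polynomial)
  pieces e = (corner i (foot s start) , start , proj₁ (weights e)) ∷
             (corner i (foot s finish) , finish , proj₂ (weights e)) ∷ []

  simulated : ∀ e → V.Simulates (Outside i s) (squareVertices (i , s))
                (map (BE.cutEdge (new i s)) (pieces e) ++ map (BE.relabel (new i s)) middle)
                (BE.cutOp (pieces e) (E.M middle) (start ∷ finish ∷ []))
  simulated e = BE.cut new-injective (BE.local new-injective outside middle) (pieces e)
                  ((λ _ ()) ∷ (λ _ ()) ∷ []) (start ∷ finish ∷ [])

  reorder : ∀ w w′ es →
    (corner i (foot s start) , new i s start , w) ∷ (new i s start , new i s finish , Pol.1#) ∷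
      (new i s finish , corner i (foot s finish) , w′) ∷ es V.≅
    (corner i (foot s start) , new i s start , w) ∷ (corner i (foot s finish) , new i s finish , w′) ∷
      (new i s start , new i s finish , Pol.1#) ∷ es
  reorder w w′ es = V.≅-∷ _ (V.≅-trans (V.≅-∷ _ (V.≅-reverse (new i s finish) (corner i (foot s finish)) w′ es)) (V.↭⇒≅ (↭.swap _ _ ↭.refl)))

  go : ∀ e → χ i s ≡ e → V.Simulates (Outside i s) (squareVertices (i , s)) (squareEdges χ (i , s)) (BC.embed (corner i) (squareOp s))
  go start  eq rewrite eq = V.simulates-cong (reorder x₂ Pol.1#)
    -- A single vertical edge would leave the other new vertex uncovered.
    (V.keep middle-both (V.drop (scaled-zero Pol.1# middle-start)
      (V.drop (scaled-zero x₂ middle-finish) (V.keep (scaled-one middle-none) V.[])))) (simulated start)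
  go finish eq rewrite eq = V.simulates-cong (reorder Pol.1# x₂)
    (V.keep middle-both (V.drop (scaled-zero x₂ middle-start)
      (V.drop (scaled-zero Pol.1# middle-finish) (V.keep (scaled-one′ middle-none) V.[])))) (simulated finish)

joints : Kind → Dir → Vert → ℤ → List (Vertex × Corner × Polynomial)
joints k d v i =
  (corner i (outer₁ k d v) , inner₁ k d (flip v) , x₂) ∷
  (corner i (outer₂ k d v) , inner₂ k d (flip v) , Pol.1#) ∷
  (corner i (arcEnd k d v) , arcEnd k d (flip v) , Pol.1#) ∷ []

height : Kind → Vert → Height
height positive up   = bottom
height positive down = top
height negative up   = top
height negative down = bottom

jointLink : Kind → Dir → Vert → ℤ → ℤ → Link
jointLink k rightward v i j = link i j (height k v)
jointLink k leftward  v i j = link j i (height k v)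

jointArc : Kind → Dir → Vert → ℤ → ℤ → Vertex × Vertex
jointArc k d v i j = corner i (arcEnd k d v) , corner j (arcEnd k d (flip v))

jointEdges : Kind → Dir → Vert → ℤ → ℤ → List (Edge Vertex)
jointEdges k d v i j = linkEdges (jointLink k d v i j) ++ arcEdge (jointArc k d v i j) ∷ []

module _ (a b c d : Vertex) (w w′ : Polynomial) (es : List (Edge Vertex)) where
  swapped : (a , b , w) ∷ (c , d , w′) ∷ es V.≅ (c , d , w′) ∷ (a , b , w) ∷ es
  swapped = V.↭⇒≅ (↭.swap _ _ ↭.refl)

  reversed : (b , a , w) ∷ (d , c , w′) ∷ es V.≅ (a , b , w) ∷ (c , d , w′) ∷ es
  reversed = V.≅-trans (V.≅-reverse b a w _) (V.≅-∷ _ (V.≅-reverse d c w′ es))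

-- A layout lists the top edge first and directs edges from left to right; `joints` lists the
-- `x₂`-edge first and directs edges outwards. Hence a swap where the bottom edge has weight `x₂`,
-- and a reversal in leftward chains.
joint-≅ : ∀ k d v i j es → jointEdges k d v i j ++ es V.≅ map (BC.cutEdge (corner j)) (joints k d v i) ++ es
joint-≅ positive rightward up   i j es = swapped _ _ _ _ _ _ _
joint-≅ positive rightward down i j es = V.↭⇒≅ ↭.refl
joint-≅ negative rightward up   i j es = V.↭⇒≅ ↭.refl
joint-≅ negative rightward down i j es = swapped _ _ _ _ _ _ _
joint-≅ positive leftward  up   i j es = V.≅-trans (swapped _ _ _ _ _ _ _) (reversed _ _ _ _ _ _ _)
joint-≅ positive leftward  down i j es = reversed _ _ _ _ _ _ _
joint-≅ negative leftward  up   i j es = reversed _ _ _ _ _ _ _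
joint-≅ negative leftward  down i j es = V.≅-trans (swapped _ _ _ _ _ _ _) (reversed _ _ _ _ _ _ _)

every : ∀ c → c ∈ corners
every nl = here ≡.refl
every nr = there (here ≡.refl)
every et = there (there (here ≡.refl))
every eb = there (there (there (here ≡.refl)))
every sr = there (there (there (there (here ≡.refl))))
every sl = there (there (there (there (there (here ≡.refl)))))
every wb = there (there (there (there (there (there (here ≡.refl))))))
every wt = there (there (there (there (there (there (there (here ≡.refl)))))))

mirrorV-involutive : ∀ c → mirrorV (mirrorV c) ≡ c
mirrorV-involutive = λ { nl → ≡.refl ; nr → ≡.refl ; et → ≡.refl ; eb → ≡.refl ; sr → ≡.refl ; sl → ≡.refl ; wb → ≡.refl ; wt → ≡.refl }

mirrorH-involutive : ∀ c → mirrorH (mirrorH c) ≡ c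
mirrorH-involutive = λ { nl → ≡.refl ; nr → ≡.refl ; et → ≡.refl ; eb → ≡.refl ; sr → ≡.refl ; sl → ≡.refl ; wb → ≡.refl ; wt → ≡.refl }

V-injective : ∀ {c c′} → mirrorV c ≡ mirrorV c′ → c ≡ c′
V-injective {c} {c′} e = ≡.trans (≡.sym (mirrorV-involutive c)) (≡.trans (cong mirrorV e) (mirrorV-involutive c′))

H-injective : ∀ {c c′} → mirrorH c ≡ mirrorH c′ → c ≡ c′
H-injective {c} {c′} e = ≡.trans (≡.sym (mirrorH-involutive c)) (≡.trans (cong mirrorH e) (mirrorH-involutive c′))

place-injective : ∀ d v {c c′} → place d v c ≡ place d v c′ → c ≡ c′
place-injective rightward up   e = e
place-injective rightward down e = V-injective e
place-injective leftward  up   e = H-injective e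
place-injective leftward  down e = H-injective (V-injective e)

q≢p : ∀ k d v → inner₂ k d v ≢ inner₁ k d v
q≢p positive d v e with () ← place-injective d v e
q≢p negative d v e with () ← place-injective d v e

a≢p : ∀ k d v → arcEnd k d v ≢ inner₁ k d v
a≢p positive d v e with () ← place-injective d v e
a≢p negative d v e with () ← place-injective d v e

a≢q : ∀ k d v → arcEnd k d v ≢ inner₂ k d v
a≢q positive d v e with () ← place-injective d v e
a≢q negative d v e with () ← place-injective d v e

blockSum : Kind → Dir → Vert → ℕ → List Corner → Polynomial
blockSum k d v l = C.⟦ tailOp k d v l ⟧ (side v ◂ C.M octagon)

joints-⇝ : ∀ k d v i l → BC.cutOp (joints k d v i) (blockSum k d (flip v) l) corners V.⇝
                         BC.embed (corner i) (tailOp k d v (suc l))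
-- The membership tests inside `cutOp` do not compute for variable `k`, `d`, `v`, so they are
-- resolved by `cutOp₃-≡` before the table deletes five of the eight terms.
joints-⇝ k d v i l = subst (V._⇝ BC.embed (corner i) (tailOp k d v (suc l)))
  (≡.sym (BC.cutOp₃-≡ ρ σ α p q a x₂ Pol.1# Pol.1# H corners
    (every p) (every q) (every a) (q≢p k d (flip v)) (a≢p k d (flip v)) (a≢q k d (flip v))))
  (prune (table-values k d (flip v)))
  where
  H : List Corner → Polynomial
  H = blockSum k d (flip v) l
  a p q : Corner
  a = arcEnd k d (flip v)
  p = inner₁ k d (flip v)
  q = inner₂ k d (flip v)
  α ρ σ : Vertex
  α = corner i (arcEnd k d v)
  ρ = corner i (outer₁ k d v)
  σ = corner i (outer₂ k d v)

  prune : Values (table k d (flip v)) →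
          BC.cutOp₃ ρ σ α p q a x₂ Pol.1# Pol.1# H corners V.⇝ BC.embed (corner i) (tailOp k d v (suc l))
  prune (t₀ ∷ t₁ ∷ t₂ ∷ u₀ ∷ u₁ ∷ u₂ ∷ v₀ ∷ v₁ ∷ v₂ ∷ w₀ ∷ w₁ ∷ w₂ ∷
         p₀ ∷ p₁ ∷ p₂ ∷ q₀ ∷ q₁ ∷ q₂ ∷ r₀ ∷ r₁ ∷ r₂ ∷ s₀ ∷ s₁ ∷ s₂ ∷ []) =
    V.keep (A-entry k l t₀ t₁ t₂) (
    V.drop (scaled-zero Pol.1# (row-zero k l u₀ u₁ u₂)) (
    V.drop (scaled-zero Pol.1# (row-zero k l v₀ v₁ v₂)) (
    V.drop (scaled-zero Pol.1# (scaled-zero Pol.1# (row-zero k l w₀ w₁ w₂))) (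
    V.drop (scaled-zero x₂ (row-zero k l p₀ p₁ p₂)) (
    V.keep (C-entry k l q₀ q₁ q₂) (
    V.keep (B-entry k l r₀ r₁ r₂) (
    V.drop (scaled-zero x₂ (scaled-zero Pol.1# (scaled-zero Pol.1# (row-zero k l s₀ s₁ s₂)))) V.[])))))))

-- Octagon j of a chain, counted outwards, is octagon index j of the graph.
record Numbering : Set where
  field
    index          : ℕ → ℤ
    position       : ℤ → ℕ
    position-index : ∀ j → position (index j) ≡ j
    direction      : Dir
    origin         : Vert

  vert : ℕ → Vert
  vert zero    = origin
  vert (suc j) = flip (vert j)

  extra : Dir → Side → ℕ
  extra rightward east  = 1
  extra rightward west  = 0
  extra leftward  east  = 0
  extra leftward  west  = 1
  extra _         north = 0
  extra _         south = 0

  -- The chain beyond octagon j consists of the vertices of level > j, which include the end square of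
  -- octagon j itself.
  level : Vertex → ℕ
  level (corner i c) = position i
  level (new i s e)  = extra direction s ℕ.+ position i

  Within : ℕ → Pred Vertex 0ℓ
  Within j v = level v ≤ j

  within-corner : ∀ j c → Within j (corner (index j) c)
  within-corner j c = ℕ.≤-reflexive (position-index j)

  beyond-corner : ∀ j c → ¬ Within j (corner (index (suc j)) c)
  beyond-corner j c rewrite position-index (suc j) = ℕ.1+n≰n

  extra-side : ∀ d v → extra d (side v) ≡ 0
  extra-side rightward up   = ≡.refl
  extra-side rightward down = ≡.refl
  extra-side leftward  up   = ≡.refl
  extra-side leftward  down = ≡.refl

  level-side : ∀ j v e → level (new (index j) (side v) e) ≡ j
  level-side j v e rewrite extra-side direction v = position-index j

  level-end : ∀ j e → level (new (index j) (endSide direction) e) ≡ suc j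
  level-end j e with direction
  ... | rightward = cong suc (position-index j)
  ... | leftward  = cong suc (position-index j)

-- Tails of a chain, by induction on their length

module Tails (F : Numbering) (k : Kind) (χ : Choice) where
  open Numbering F

  sideSquare endSquare : ℕ → ℤ × Side
  sideSquare j = index j , side (vert j)
  endSquare  j = index j , endSide direction

  endVertices : Kind → ℕ → List Vertex
  endVertices positive j = squareVertices (endSquare j)
  endVertices negative j = []

  endEdges : Kind → ℕ → List (Edge Vertex)
  endEdges positive j = squareEdges χ (endSquare j)
  endEdges negative j = []

  joint : ℕ → List (Edge Vertex)
  joint j = jointEdges k direction (vert j) (index j) (index (suc j))

  -- A tail of `l` octagons hangs on octagon `j`, which does not belong to it. The bracketing and
  -- the empty list are those produced by `attach` and `cut`.
  tailVertices : ℕ → ℕ → List Vertex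
  tailVertices zero    j = endVertices k j
  tailVertices (suc l) j =
    (tailVertices l (suc j) ++ squareVertices (sideSquare (suc j)) ++ []) ++ octagonVertices (index (suc j))

  tailEdges : ℕ → ℕ → List (Edge Vertex)
  tailEdges zero    j = endEdges k j
  tailEdges (suc l) j =
    joint j ++ tailEdges l (suc j) ++ squareEdges χ (sideSquare (suc j)) ++ octagonEdges (index (suc j))

  -- The predicate is arbitrary because in the even graphs the left tail has to be located in the
  -- outside of the right one.
  tail-ends : ∀ {P : Pred Vertex 0ℓ} → (∀ j c → P (corner (index j) c)) →
              (∀ j v e → P (new (index j) (side v) e)) → (∀ j e → P (new (index j) (endSide direction) e)) →
              ∀ l j → All P (tailVertices l j) × All (V.EndsIn P) (tailEdges l j)
  tail-ends {P} pc pn pe = go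
    where
    ends : ∀ k j → All P (endVertices k j) × All (V.EndsIn P) (endEdges k j)
    ends positive j = pe j start ∷ pe j finish ∷ [] , squareEdges-ends χ (index j) (endSide direction) (pc j) (pe j)
    ends negative j = [] , []

    joint-ends : ∀ d v j → All (V.EndsIn P) (jointEdges k d v (index j) (index (suc j)))
    joint-ends rightward v j = (pc _ _ , pc _ _) ∷ (pc _ _ , pc _ _) ∷ (pc _ _ , pc _ _) ∷ []
    joint-ends leftward  v j = (pc _ _ , pc _ _) ∷ (pc _ _ , pc _ _) ∷ (pc _ _ , pc _ _) ∷ []

    go : ∀ l j → All P (tailVertices l j) × All (V.EndsIn P) (tailEdges l j)
    go zero    j = ends k j
    go (suc l) j with vs , es ← go l (suc j) =
      All.++⁺ (All.++⁺ vs (pn (suc j) _ start ∷ pn (suc j) _ finish ∷ []))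
              (All.map⁺ {f = corner (index (suc j))} (All.universal (pc (suc j)) corners)) ,
      All.++⁺ (joint-ends direction (vert j) j) (All.++⁺ es (All.++⁺
        (squareEdges-ends χ (index (suc j)) (side (vert (suc j))) (pc (suc j)) (pn (suc j) _))
        (octagonEdges-ends (index (suc j)) (pc (suc j)))))

  outer-pair : ∀ d v i f vs →
    V.Dˢ (corner i (foot (endSide d) start) ∷ corner i (foot (endSide d) finish) ∷ []) f vs Pol.≈
    V.Dˢ (corner i (outer₁ positive d v) ∷ corner i (outer₂ positive d v) ∷ []) f vs
  outer-pair rightward up   i f vs = Pol.reflexive (V.D-comm (corner i et) (corner i eb) f vs)
  outer-pair rightward down i f vs = Pol.refl
  outer-pair leftward  up   i f vs = Pol.reflexive (V.D-comm (corner i wt) (corner i wb) f vs)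
  outer-pair leftward  down i f vs = Pol.refl

  -- The feet of an end square are the two outer corners, so the square is already a tail of length
  -- zero, with `B = x₂` and no `C`. Without an end square only `A = 1` remains.
  end-simulates : ∀ k j → V.Simulates (Within j) (endVertices k j) (endEdges k j)
                                      (BC.embed (corner (index j)) (tailOp k direction (vert j) 0))
  end-simulates negative j = V.empty-simulates (A-zero negative) (C-zero negative) B-zero⁻
  end-simulates positive j = V.pad-simulates (A-zero positive) (C-zero positive) B-zero⁺
    (outer-pair direction (vert j) (index j))
    (V.simulates-weaken outside (out start ∷ out finish ∷ []) (square-simulates χ (index j) (endSide direction)))
    where
    out : ∀ e → ¬ Within j (new (index j) (endSide direction) e)
    out e w = ℕ.1+n≰n (≡.subst (_≤ j) (level-end j e) w)
    outside : ∀ {v} → Within j v → Outside (index j) (endSide direction) v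
    outside w e ≡.refl = out e w

  Sim : ℕ → ℕ → Set₁
  Sim l j = V.Simulates (Within j) (tailVertices l j) (tailEdges l j)
                        (BC.embed (corner (index j)) (tailOp k direction (vert j) l))

  module _ (l j : ℕ) where
    i : ℤ
    i = index (suc j)

    sided : BC.Block (Within j) (corner i) (squareVertices (sideSquare (suc j)) ++ [])
              (squareEdges χ (sideSquare (suc j)) ++ octagonEdges i) (side (vert (suc j)) ◂ C.M octagon)
    sided = BC.attach corner-injective {op = squareOp (side (vert (suc j)))} (square-simulates χ i (side (vert (suc j))))
              (BC.local corner-injective (beyond-corner j) octagon)
              (λ { w e ≡.refl → ℕ.1+n≰n (≡.subst (_≤ j) (level-side (suc j) (vert (suc j)) e) w) })
              (λ _ _ ()) [] (octagonEdges-ends i (λ _ _ ()))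

    tailed : Sim l (suc j) →
             BC.Block (Within j) (corner i)
               (tailVertices l (suc j) ++ squareVertices (sideSquare (suc j)) ++ [])
               (tailEdges l (suc j) ++ squareEdges χ (sideSquare (suc j)) ++ octagonEdges i)
               (blockSum k direction (vert (suc j)) l)
    tailed s = BC.attach corner-injective {op = tailOp k direction (vert (suc j)) l} s sided
                 ℕ.m≤n⇒m≤1+n (within-corner (suc j))
                 (new-within start ∷ new-within finish ∷ [])
                 (All.++⁺ (squareEdges-ends χ i (side (vert (suc j))) (within-corner (suc j)) new-within)
                          (octagonEdges-ends i (within-corner (suc j))))
      where
      new-within : ∀ e → Within (suc j) (new i (side (vert (suc j))) e)
      new-within e = ℕ.≤-reflexive (level-side (suc j) (vert (suc j)) e)

    step : Sim l (suc j) → Sim (suc l) j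
    step s = V.simulates-cong reassociate (joints-⇝ k direction (vert j) (index j) l)
      (BC.cut corner-injective (tailed s) (joints k direction (vert j) (index j))
        (within-corner j (outer₁ k direction (vert j)) ∷ within-corner j (outer₂ k direction (vert j)) ∷
         within-corner j (arcEnd k direction (vert j)) ∷ []) corners)
      where
      rest : List (Edge Vertex)
      rest = tailEdges l (suc j) ++ squareEdges χ (sideSquare (suc j)) ++ octagonEdges i
      reassociate : ∀ es → (joint j ++ rest) ++ es V.≅
                           (map (BC.cutEdge (corner i)) (joints k direction (vert j) (index j)) ++ rest) ++ es
      reassociate es = ≡.subst (V._≅ (map (BC.cutEdge (corner i)) (joints k direction (vert j) (index j)) ++ rest) ++ es)
        (≡.sym (++-assoc (joint j) rest es))
        (joint-≅ k direction (vert j) (index j) i (rest ++ es))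

  tail-simulates : ∀ l j → Sim l j
  tail-simulates zero    j = end-simulates k j
  tail-simulates (suc l) j = step l j (tail-simulates l (suc j))

-- The graphs G_n

module Sums = SubsetSums Pol.commutativeSemiring _≟ᵛ_

interchange : ∀ {A : Set} (as bs cs ds : List A) → (as ++ bs) ++ (cs ++ ds) ↭ (as ++ cs) ++ (bs ++ ds)
interchange {A} = CommutativeSemigroupProperties.interchange
  (CommutativeMonoid.commutativeSemigroup (++-commutativeMonoid {A = A}))

concatMap-↭ : ∀ {A B : Set} (f : A → List B) {xs ys} → xs ↭ ys → concatMap f xs ↭ concatMap f ys
concatMap-↭ f ↭.refl         = ↭.refl
concatMap-↭ f (↭.prep x p)   = ++⁺ˡ (f x) (concatMap-↭ f p)
concatMap-↭ f (↭.swap x y p) = ↭-trans (shifts (f x) (f y)) (++⁺ˡ (f y) (++⁺ˡ (f x) (concatMap-↭ f p)))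
concatMap-↭ f (↭.trans p q)  = ↭.trans (concatMap-↭ f p) (concatMap-↭ f q)

open Layout

verticesOf : Layout → List Vertex
verticesOf L = concatMap octagonVertices (octagons L) ++ concatMap squareVertices (squares L)

edgesOf : Choice → Layout → List (Edge Vertex)
edgesOf χ L = concatMap octagonEdges (octagons L) ++ concatMap (squareEdges χ) (squares L)
              ++ concatMap linkEdges (links L) ++ map arcEdge (arcs L)

infixr 5 _⊕_
_⊕_ : Layout → Layout → Layout
L ⊕ L′ = record
  { octagons = octagons L ++ octagons L′
  ; squares  = squares L ++ squares L′
  ; links    = links L ++ links L′
  ; arcs     = arcs L ++ arcs L′
  }

vertices-⊕ : ∀ L L′ → verticesOf (L ⊕ L′) ↭ verticesOf L ++ verticesOf L′
vertices-⊕ L L′ = ↭-trans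
  (↭-reflexive (cong₂ _++_ (concatMap-++ octagonVertices (octagons L) _) (concatMap-++ squareVertices (squares L) _)))
  (interchange (concatMap octagonVertices (octagons L)) _ _ _)

edges-⊕ : ∀ χ L L′ → edgesOf χ (L ⊕ L′) ↭ edgesOf χ L ++ edgesOf χ L′
edges-⊕ χ L L′ = ↭-trans
  (↭-reflexive (cong₂ _++_ (concatMap-++ octagonEdges (octagons L) _)
    (cong₂ _++_ (concatMap-++ (squareEdges χ) (squares L) _)
      (cong₂ _++_ (concatMap-++ linkEdges (links L) _) (map-++ arcEdge (arcs L) _)))))
  (↭-trans (++⁺ˡ (O L ++ O L′) (↭-trans (++⁺ˡ (S L ++ S L′) (interchange (K L) (K L′) _ _))
                                        (interchange (S L) (S L′) _ _)))
           (interchange (O L) (O L′) _ _))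
  where
  O S K : Layout → List (Edge Vertex)
  O L = concatMap octagonEdges (octagons L)
  S L = concatMap (squareEdges χ) (squares L)
  K L = concatMap linkEdges (links L)

-- Reordering the components is harmless: matching sums are invariant under permutations of the
-- vertices and of the edges.
record _≈ᴸ_ (L L′ : Layout) : Set where
  field
    octagons-↭ : octagons L ↭ octagons L′
    squares-↭  : squares L ↭ squares L′
    links-↭    : links L ↭ links L′
    arcs-↭     : arcs L ↭ arcs L′
open _≈ᴸ_

vertices-≈ᴸ : ∀ {L L′} → L ≈ᴸ L′ → verticesOf L ↭ verticesOf L′
vertices-≈ᴸ e = ++⁺ (concatMap-↭ octagonVertices (octagons-↭ e)) (concatMap-↭ squareVertices (squares-↭ e))

edges-≈ᴸ : ∀ χ {L L′} → L ≈ᴸ L′ → edgesOf χ L ↭ edgesOf χ L′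
edges-≈ᴸ χ e = ++⁺ (concatMap-↭ octagonEdges (octagons-↭ e)) (++⁺ (concatMap-↭ (squareEdges χ) (squares-↭ e))
  (++⁺ (concatMap-↭ linkEdges (links-↭ e)) (map⁺ arcEdge (arcs-↭ e))))

range : ℕ → ℕ → List ℕ
range j zero    = []
range j (suc l) = j ∷ range (suc j) l

range-suc : ∀ j l → map suc (range j l) ≡ range (suc j) l
range-suc j zero    = ≡.refl
range-suc j (suc l) = cong (suc j ∷_) (range-suc (suc j) l)

upTo-range : ∀ l → upTo l ≡ range 0 l
upTo-range zero    = ≡.refl
upTo-range (suc l) = cong (0 ∷_) (≡.trans (≡.sym (map-upTo suc l)) (≡.trans (cong (map suc) (upTo-range l)) (range-suc 0 l)))

map-upFrom : ∀ {A : Set} {f g : ℕ → A} → (∀ i → f (suc i) ≡ g i) → ∀ l → map f [1⋯ l ] ≡ map g (range 0 l)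
map-upFrom {f = f} {g} e l = ≡.trans (≡.sym (map-∘ (upTo l))) (≡.trans (map-cong e (upTo l)) (cong (map g) (upTo-range l)))

map-upFrom′ : ∀ {A : Set} {f g : ℕ → A} → f ≗ g → ∀ l → map f [1⋯ l ] ≡ map g (range 1 l)
map-upFrom′ {f = f} {g} e l = ≡.trans (map-cong e _) (cong (map g) (≡.trans (cong (map suc) (upTo-range l)) (range-suc 0 l)))

square-members : ∀ {i s} {P : Pred Vertex 0ℓ} → (∀ {v} → v ∈ squareVertices (i , s) → P v) → ∀ e → P (new i s e)
square-members f start  = f (here ≡.refl)
square-members f finish = f (there (here ≡.refl))

module _ {W : List Vertex} where
  octagon-proper : ∀ i → (∀ c → corner i c ∈ W) → All (Sums.ProperEdge W) (octagonEdges i)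
  octagon-proper i ∈W =
    (∈W nl , ∈W nr , λ ()) ∷ (∈W nr , ∈W et , λ ()) ∷ (∈W et , ∈W eb , λ ()) ∷ (∈W eb , ∈W sr , λ ()) ∷
    (∈W sr , ∈W sl , λ ()) ∷ (∈W sl , ∈W wb , λ ()) ∷ (∈W wb , ∈W wt , λ ()) ∷ (∈W wt , ∈W nl , λ ()) ∷ []

  square-proper : ∀ χ i s → (∀ c → corner i c ∈ W) → (∀ e → new i s e ∈ W) →
                  All (Sums.ProperEdge W) (squareEdges χ (i , s))
  square-proper χ i s ∈W ∈W′ =
    (∈W (foot s start) , ∈W′ start , λ ()) ∷ (∈W′ start , ∈W′ finish , λ ()) ∷
    (∈W′ finish , ∈W (foot s finish) , λ ()) ∷ []

module TailLayout (F : Numbering) (k : Kind) (χ : Choice) where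
  open Numbering F
  open Tails F k χ

  endSquares : Kind → ℕ → List (ℤ × Side)
  endSquares positive j = endSquare j ∷ []
  endSquares negative j = []

  -- The index `n` of the last octagon is a separate argument because `suc l + j` and `l + suc j`
  -- are equal only up to a proof; with `n` abstract, a tail splits off its first octagon
  -- definitionally.
  layoutEndingAt : ℕ → ℕ → ℕ → Layout
  layoutEndingAt n l j = record
    { octagons = map (index ∘ suc) (range j l)
    ; squares  = map (sideSquare ∘ suc) (range j l) ++ endSquares k n
    ; links    = map (λ i → jointLink k direction (vert i) (index i) (index (suc i))) (range j l)
    ; arcs     = map (λ i → jointArc k direction (vert i) (index i) (index (suc i))) (range j l)
    }

  tailLayout : ℕ → ℕ → Layout
  tailLayout l j = layoutEndingAt (l ℕ.+ j) l j

  stage : ℕ → Layout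
  stage j = record
    { octagons = index (suc j) ∷ []
    ; squares  = sideSquare (suc j) ∷ []
    ; links    = jointLink k direction (vert j) (index j) (index (suc j)) ∷ []
    ; arcs     = jointArc k direction (vert j) (index j) (index (suc j)) ∷ []
    }

  tailLayout-suc : ∀ l j → tailLayout (suc l) j ≡ stage j ⊕ tailLayout l (suc j)
  tailLayout-suc l j = cong (λ n → layoutEndingAt n (suc l) j) (≡.sym (ℕ.+-suc l j))

  vertices-end : ∀ k j → concatMap squareVertices (endSquares k j) ≡ endVertices k j
  vertices-end positive j = ≡.refl
  vertices-end negative j = ≡.refl

  edges-end : ∀ k j → concatMap (squareEdges χ) (endSquares k j) ++ [] ≡ endEdges k j
  edges-end positive j = ≡.refl
  edges-end negative j = ≡.refl

  vertices-tail : ∀ l j → verticesOf (tailLayout l j) ↭ tailVertices l j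
  vertices-tail zero    j = ↭-reflexive (vertices-end k j)
  vertices-tail (suc l) j = ↭-trans (↭-reflexive (cong verticesOf (tailLayout-suc l j))) (↭-trans (vertices-⊕ (stage j) (tailLayout l (suc j))) (↭-trans
    (++-comm (O ++ S) _) (↭-trans (++⁺ʳ (O ++ S) (vertices-tail l (suc j)))
    (↭-trans (++⁺ˡ (tailVertices l (suc j)) (++-comm O S)) (↭-reflexive (≡.sym (++-assoc (tailVertices l (suc j)) S O)))))))
    where
    O S : List Vertex
    O = octagonVertices (index (suc j))
    S = squareVertices (sideSquare (suc j))

  edges-tail : ∀ l j → edgesOf χ (tailLayout l j) ↭ tailEdges l j
  edges-tail zero    j = ↭-reflexive (edges-end k j)
  edges-tail (suc l) j = ↭-trans (↭-reflexive (cong (edgesOf χ) (tailLayout-suc l j))) (↭-trans (edges-⊕ χ (stage j) (tailLayout l (suc j))) (↭-trans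
    (++⁺ (↭-trans (↭-reflexive stage-edges) (shifts′ O S J)) (edges-tail l (suc j)))
    (↭-trans (↭-reflexive (++-assoc J (S ++ O) _)) (++⁺ˡ J (++-comm (S ++ O) _)))))
    where
    O S J : List (Edge Vertex)
    O = octagonEdges (index (suc j))
    S = squareEdges χ (sideSquare (suc j))
    J = joint j

    stage-edges : edgesOf χ (stage j) ≡ O ++ S ++ J
    stage-edges = cong (λ es → O ++ S ++ es ++ arcEdge (jointArc k direction (vert j) (index j) (index (suc j))) ∷ [])
      (++-identityʳ (linkEdges (jointLink k direction (vert j) (index j) (index (suc j)))))

    shifts′ : ∀ (as bs cs : List (Edge Vertex)) → as ++ bs ++ cs ↭ cs ++ bs ++ as
    shifts′ as bs cs = ↭-trans (++-comm as (bs ++ cs)) (↭-trans (++⁺ʳ as (++-comm bs cs)) (↭-reflexive (++-assoc cs bs as)))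

  distinct-corners : ∀ j c d → corner (index j) c ≢ corner (index (suc j)) d
  distinct-corners j c d e = ℕ.1+n≢n (≡.trans (≡.sym (position-index (suc j)))
    (≡.trans (cong position′ (≡.sym e)) (position-index j)))
    where
    position′ : Vertex → ℕ
    position′ (corner i _) = position i
    position′ (new i _ _)  = position i

  module _ {W : List Vertex} where
    joint-proper : ∀ d v j → (∀ c → corner (index j) c ∈ W) → (∀ c → corner (index (suc j)) c ∈ W) →
                   All (Sums.ProperEdge W) (jointEdges k d v (index j) (index (suc j)))
    joint-proper rightward v j ∈W ∈W′ = (∈W et , ∈W′ wt , λ ()) ∷ (∈W eb , ∈W′ wb , λ ()) ∷
      (∈W _ , ∈W′ _ , distinct-corners j _ _) ∷ []
    joint-proper leftward  v j ∈W ∈W′ = (∈W′ et , ∈W wt , λ ()) ∷ (∈W′ eb , ∈W wb , λ ()) ∷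
      (∈W _ , ∈W′ _ , distinct-corners j _ _) ∷ []

    end-proper : ∀ k j → (∀ c → corner (index j) c ∈ W) → (∀ {v} → v ∈ endVertices k j → v ∈ W) →
                 All (Sums.ProperEdge W) (endEdges k j)
    end-proper positive j ∈W ∈W′ = square-proper χ (index j) (endSide direction) ∈W (square-members {s = endSide direction} ∈W′)
    end-proper negative j ∈W ∈W′ = []

    tail-proper : ∀ l j → (∀ c → corner (index j) c ∈ W) → (∀ {v} → v ∈ tailVertices l j → v ∈ W) →
                  All (Sums.ProperEdge W) (tailEdges l j)
    tail-proper zero    j ∈W ⊆W = end-proper k j ∈W ⊆W
    tail-proper (suc l) j ∈W ⊆W = All.++⁺ (joint-proper direction (vert j) j ∈W ∈W′) (All.++⁺
      (tail-proper l (suc j) ∈W′ (⊆W ∘ ∈-++⁺ˡ ∘ ∈-++⁺ˡ)) (All.++⁺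
      (square-proper χ (index (suc j)) (side (vert (suc j))) ∈W′
        (square-members {s = side (vert (suc j))} (⊆W ∘ ∈-++⁺ˡ ∘ ∈-++⁺ʳ (tailVertices l (suc j)))))
      (octagon-proper (index (suc j)) ∈W′)))
      where
      ∈W′ : ∀ c → corner (index (suc j)) c ∈ W
      ∈W′ c = ⊆W (∈-++⁺ʳ (tailVertices l (suc j) ++ squareVertices (sideSquare (suc j)) ++ [])
                   (∈-map⁺ (corner (index (suc j))) (every c)))

proper-resp-↭ : ∀ {W W′ es es′} → W ↭ W′ → es ↭ es′ → All (Sums.ProperEdge W) es → All (Sums.ProperEdge W′) es′
proper-resp-↭ w e p = All-resp-↭ e (All.map (λ (a , b , c) → ∈-resp-↭ w a , ∈-resp-↭ w b , c) p)

Nothing : Pred Vertex 0ℓ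
Nothing _ = ⊥

-- With an empty outside the block is the whole graph, and the factor left over is the empty
-- matching sum 1.
chain-sum : ∀ L χ i {vs es H} → BC.Block Nothing (corner i) vs es H →
            verticesOf L ↭ vs ++ map (corner i) corners → edgesOf χ L ↭ es →
            All (Sums.ProperEdge (vs ++ map (corner i) corners)) es →
            WeightedGraph.p (chain L χ) Pol.≈ H corners
chain-sum L χ i {vs} {es} {H} (BC.block _ _ _ s) vπ eπ proper = Pol.trans
  (Sums.sum-perfect (verticesOf L) (proper-resp-↭ (↭-sym vπ) (↭-sym eπ) proper)) (Pol.trans
  (V.sums (V.↭⇒≅ eπ) (verticesOf L)) (Pol.trans
  (V.M-resp-↭ es vπ) (Pol.trans
  (Pol.reflexive (cong₂ V.M (≡.sym (++-identityʳ es)) (cong (vs ++_) (≡.sym (++-identityʳ (map (corner i) corners)))))) (Pol.trans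
  (s corners {[]} {[]} [] []) (Pol.*-identityʳ (H corners))))))

ifOdd-suc : ∀ {A : Set} i {a b : A} → (ifOdd suc i then a else b) ≡ (ifOdd i then b else a)
ifOdd-suc 0             = ≡.refl
ifOdd-suc 1             = ≡.refl
ifOdd-suc (suc (suc i)) = ifOdd-suc i

module _ (F : Numbering) where
  open Numbering F

  -- A successor exchanges the two branches, so the induction passes from `f` to `f ∘ flip`.
  ifOdd-vert : ∀ {A : Set} (f : Vert → A) i → (ifOdd i then f (flip origin) else f origin) ≡ f (vert i)
  ifOdd-vert f zero    = ≡.refl
  ifOdd-vert f (suc i) = ≡.trans (ifOdd-suc i) (≡.trans
    (cong (λ v → ifOdd i then f v else f (flip origin)) (≡.sym (flip-flip origin)))
    (ifOdd-vert (f ∘ flip) i))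
    where
    flip-flip : ∀ v → flip (flip v) ≡ v
    flip-flip up   = ≡.refl
    flip-flip down = ≡.refl

  ifOdd-arc : ∀ k i → let a = arcEnd k direction in
              (corner (index i) (ifOdd i then a (flip origin) else a origin) ,
               corner (index (suc i)) (ifOdd suc i then a (flip origin) else a origin)) ≡
              jointArc k direction (vert i) (index i) (index (suc i))
  ifOdd-arc k i = cong₂ (λ c d → corner (index i) c , corner (index (suc i)) d)
    (ifOdd-vert (arcEnd k direction) i) (ifOdd-vert (arcEnd k direction) (suc i))

-- Truncation gives the whole opposite half of an even graph the position 0, which places it in the
-- outside of the tail.
positivePart negativePart : ℤ → ℕ
positivePart (+ n)    = n
positivePart -[1+ _ ] = 0
negativePart (+ _)    = 0
negativePart -[1+ n ] = suc n

negativePart-neg : ∀ j → negativePart (neg j) ≡ j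
negativePart-neg zero    = ≡.refl
negativePart-neg (suc j) = ≡.refl

rightTail leftTail : Numbering
rightTail = record
  { index = pos ; position = positivePart ; position-index = λ _ → ≡.refl ; direction = rightward ; origin = down }
leftTail = record
  { index = neg ; position = negativePart ; position-index = negativePart-neg ; direction = leftward ; origin = up }

-- The tail hangs on octagon 1; there is no octagon 0 in the graph, and `origin` is chosen so that
-- `vert 1` is the side of the square of `O_1`.
oddTail : Kind → Numbering
oddTail k = record
  { index = pos ; position = positivePart ; position-index = λ _ → ≡.refl ; direction = leftward ; origin = o k }
  where
  o : Kind → Vert
  o positive = up
  o negative = down

≡⇒≈ᴸ : ∀ {L L′} → Layout.octagons L ≡ Layout.octagons L′ → Layout.squares L ↭ Layout.squares L′ →
       Layout.links L ≡ Layout.links L′ → Layout.arcs L ≡ Layout.arcs L′ → L ≈ᴸ L′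
≡⇒≈ᴸ o s l a = record
  { octagons-↭ = ↭-reflexive o ; squares-↭ = s ; links-↭ = ↭-reflexive l ; arcs-↭ = ↭-reflexive a }

centerLayout : ℤ → List Side → Layout
centerLayout i ss = record { octagons = i ∷ [] ; squares = map (i ,_) ss ; links = [] ; arcs = [] }

module _ (χ : Choice) (i : ℤ) where

  centerVertices : List Side → List Vertex
  centerVertices []       = []
  centerVertices (s ∷ ss) = squareVertices (i , s) ++ centerVertices ss

  centerEdges : List Side → List (Edge Vertex)
  centerEdges []       = octagonEdges i
  centerEdges (s ∷ ss) = squareEdges χ (i , s) ++ centerEdges ss

  centerLocal : List Side → List Corner → Polynomial
  centerLocal []       = C.M octagon
  centerLocal (s ∷ ss) = s ◂ centerLocal ss

  data Distinct : List Side → Set where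
    []  : Distinct []
    _∷_ : ∀ {s ss} → All (s ≢_) ss → Distinct ss → Distinct (s ∷ ss)

  center-ends : ∀ {P : Pred Vertex 0ℓ} ss → (∀ c → P (corner i c)) → All (λ s → ∀ e → P (new i s e)) ss →
                All P (centerVertices ss) × All (V.EndsIn P) (centerEdges ss)
  center-ends []       pc []        = [] , octagonEdges-ends i pc
  center-ends (s ∷ ss) pc (pn ∷ pns) with vs , es ← center-ends ss pc pns =
    pn start ∷ pn finish ∷ vs , All.++⁺ (squareEdges-ends χ i s pc pn) es

  center-block : ∀ {ss} → Distinct ss → BC.Block Nothing (corner i) (centerVertices ss) (centerEdges ss) (centerLocal ss)
  center-block []           = BC.local corner-injective (λ _ ()) octagon
  center-block {s ∷ ss} (d ∷ ds) with vs , es ← center-ends ss (λ _ _ ()) (All.map (λ { s≢t e e′ ≡.refl → s≢t ≡.refl }) d) =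
    BC.attach corner-injective {op = squareOp s} (square-simulates χ i s) (center-block ds) (λ ()) (λ _ _ ()) vs es

  vertices-center : ∀ ss → verticesOf (centerLayout i ss) ↭ centerVertices ss ++ octagonVertices i
  vertices-center ss = ↭-trans (++-comm (octagonVertices i) _) (++⁺ʳ (octagonVertices i) (↭-reflexive (go ss)))
    where
    go : ∀ ss → concatMap squareVertices (map (i ,_) ss) ≡ centerVertices ss
    go []       = ≡.refl
    go (s ∷ ss) = cong (squareVertices (i , s) ++_) (go ss)

  edges-center : ∀ ss → edgesOf χ (centerLayout i ss) ↭ centerEdges ss
  edges-center ss = ↭-trans (++-comm (octagonEdges i) _) (↭-reflexive (go ss))
    where
    go : ∀ ss → (concatMap (squareEdges χ) (map (i ,_) ss) ++ []) ++ octagonEdges i ≡ centerEdges ss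
    go []       = ≡.refl
    go (s ∷ ss) = cong (squareEdges χ (i , s) ++_) (go ss)

  module _ {W : List Vertex} (∈W : ∀ c → corner i c ∈ W) where
    center-proper : ∀ ss → (∀ {v} → v ∈ centerVertices ss → v ∈ W) → All (Sums.ProperEdge W) (centerEdges ss)
    center-proper []       ⊆W = octagon-proper i ∈W
    center-proper (s ∷ ss) ⊆W = All.++⁺ (square-proper χ i s ∈W (square-members {s = s} (⊆W ∘ ∈-++⁺ˡ)))
                                        (center-proper ss (⊆W ∘ ∈-++⁺ʳ (squareVertices (i , s))))

module OddFamily (k : Kind) (χ : Choice) (ss : List Side) (l : ℕ) where
  open Numbering (oddTail k)
  open Tails (oddTail k) k χ
  open TailLayout (oddTail k) k χ

  odd-sum : ∀ L → Distinct χ (+ 1) ss → All (λ s → ∀ e → Within 1 (new (+ 1) s e)) ss →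
            L ≈ᴸ (centerLayout (+ 1) ss ⊕ tailLayout l 1) →
            WeightedGraph.p (chain L χ) Pol.≈ C.⟦ tailOp k leftward (vert 1) l ⟧ (centerLocal χ (+ 1) ss) corners
  odd-sum L d w e = chain-sum L χ (+ 1)
    (BC.attach corner-injective {op = tailOp k leftward (vert 1) l} (tail-simulates l 1) (center-block χ (+ 1) d)
      (λ ()) (within-corner 1) (proj₁ ends) (proj₂ ends))
    (↭-trans (vertices-≈ᴸ e) (↭-trans (vertices-⊕ (centerLayout (+ 1) ss) (tailLayout l 1)) (↭-trans
      (++⁺ (vertices-center χ (+ 1) ss) (vertices-tail l 1)) (↭-trans
      (++-comm (centerVertices χ (+ 1) ss ++ octagonVertices (+ 1)) _)
      (↭-reflexive (≡.sym (++-assoc (tailVertices l 1) (centerVertices χ (+ 1) ss) _)))))))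
    (↭-trans (edges-≈ᴸ χ e) (↭-trans (edges-⊕ χ (centerLayout (+ 1) ss) (tailLayout l 1)) (↭-trans
      (++⁺ (edges-center χ (+ 1) ss) (edges-tail l 1)) (++-comm (centerEdges χ (+ 1) ss) _))))
    (All.++⁺ (tail-proper l 1 ∈W (∈-++⁺ˡ ∘ ∈-++⁺ˡ))
             (center-proper χ (+ 1) ∈W ss (∈-++⁺ˡ ∘ ∈-++⁺ʳ (tailVertices l 1))))
    where
    ends : All (Within 1) (centerVertices χ (+ 1) ss) × All (V.EndsIn (Within 1)) (centerEdges χ (+ 1) ss)
    ends = center-ends χ (+ 1) ss (within-corner 1) w

    ∈W : ∀ c → corner (+ 1) c ∈ (tailVertices l 1 ++ centerVertices χ (+ 1) ss) ++ map (corner (+ 1)) corners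
    ∈W c = ∈-++⁺ʳ (tailVertices l 1 ++ centerVertices χ (+ 1) ss) (∈-map⁺ (corner (+ 1)) (every c))

module EvenFamily (k : Kind) (χ : Choice) (ss : List Side) (l : ℕ) where
  module R where
    open Numbering rightTail public
    open Tails rightTail k χ public
    open TailLayout rightTail k χ public
  module L where
    open Numbering leftTail public
    open Tails leftTail k χ public
    open TailLayout leftTail k χ public

  even-sum : ∀ G → Distinct χ (+ 0) ss → All (λ s → ∀ e → R.Within 0 (new (+ 0) s e)) ss →
             All (λ s → ∀ e → L.Within 0 (new (+ 0) s e)) ss →
             G ≈ᴸ (centerLayout (+ 0) ss ⊕ (R.tailLayout l 0 ⊕ L.tailLayout l 0)) →
             WeightedGraph.p (chain G χ) Pol.≈
             C.⟦ tailOp k rightward down l ⟧ (C.⟦ tailOp k leftward up l ⟧ (centerLocal χ (+ 0) ss)) corners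
  even-sum G d wR wL e = chain-sum G χ (+ 0)
    (BC.attach corner-injective {op = tailOp k rightward down l} (R.tail-simulates l 0)
      (BC.attach corner-injective {op = tailOp k leftward up l} (L.tail-simulates l 0) (center-block χ (+ 0) d)
        (λ ()) (L.within-corner 0) (proj₁ endsL) (proj₂ endsL))
      (λ ()) (R.within-corner 0) (All.++⁺ (proj₁ endsT) (proj₁ endsR)) (All.++⁺ (proj₂ endsT) (proj₂ endsR)))
    (↭-trans (vertices-≈ᴸ e) (↭-trans (vertices-⊕ (centerLayout (+ 0) ss) tails) (↭-trans
      (++⁺ (vertices-center χ (+ 0) ss) (↭-trans (vertices-⊕ (R.tailLayout l 0) (L.tailLayout l 0))
        (++⁺ (R.vertices-tail l 0) (L.vertices-tail l 0)))) (↭-trans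
      (++-comm (centerVertices χ (+ 0) ss ++ octagonVertices (+ 0)) _) (↭-trans
      (↭-reflexive (++-assoc (R.tailVertices l 0) _ _)) (↭-trans
      (++⁺ˡ (R.tailVertices l 0) (↭-reflexive (≡.sym (++-assoc (L.tailVertices l 0) (centerVertices χ (+ 0) ss) _))))
      (↭-reflexive (≡.sym (++-assoc (R.tailVertices l 0) _ _)))))))))
    (↭-trans (edges-≈ᴸ χ e) (↭-trans (edges-⊕ χ (centerLayout (+ 0) ss) tails) (↭-trans
      (++⁺ (edges-center χ (+ 0) ss) (↭-trans (edges-⊕ χ (R.tailLayout l 0) (L.tailLayout l 0))
        (++⁺ (R.edges-tail l 0) (L.edges-tail l 0)))) (↭-trans
      (++-comm (centerEdges χ (+ 0) ss) _) (↭-reflexive (++-assoc (R.tailEdges l 0) _ _))))))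
    (All.++⁺ (R.tail-proper l 0 ∈W (∈-++⁺ˡ ∘ ∈-++⁺ˡ)) (All.++⁺
      (L.tail-proper l 0 ∈W (∈-++⁺ˡ ∘ ∈-++⁺ʳ (R.tailVertices l 0) ∘ ∈-++⁺ˡ))
      (center-proper χ (+ 0) ∈W ss (∈-++⁺ˡ ∘ ∈-++⁺ʳ (R.tailVertices l 0) ∘ ∈-++⁺ʳ (L.tailVertices l 0)))))
    where
    tails : Layout
    tails = R.tailLayout l 0 ⊕ L.tailLayout l 0

    endsL : All (L.Within 0) (centerVertices χ (+ 0) ss) × All (V.EndsIn (L.Within 0)) (centerEdges χ (+ 0) ss)
    endsL = center-ends χ (+ 0) ss (L.within-corner 0) wL

    endsR : All (R.Within 0) (centerVertices χ (+ 0) ss) × All (V.EndsIn (R.Within 0)) (centerEdges χ (+ 0) ss)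
    endsR = center-ends χ (+ 0) ss (R.within-corner 0) wR

    positivePart-neg : ∀ j → positivePart (neg j) ≡ 0
    positivePart-neg zero    = ≡.refl
    positivePart-neg (suc j) = ≡.refl

    endsT : All (R.Within 0) (L.tailVertices l 0) × All (V.EndsIn (R.Within 0)) (L.tailEdges l 0)
    endsT = L.tail-ends
      (λ j c → ℕ.≤-reflexive (positivePart-neg j))
      (λ { j up e → ℕ.≤-reflexive (positivePart-neg j) ; j down e → ℕ.≤-reflexive (positivePart-neg j) })
      (λ j e → ℕ.≤-reflexive (positivePart-neg j)) l 0

    ∈W : ∀ c → corner (+ 0) c ∈ (R.tailVertices l 0 ++ L.tailVertices l 0 ++ centerVertices χ (+ 0) ss) ++ map (corner (+ 0)) corners
    ∈W c = ∈-++⁺ʳ (R.tailVertices l 0 ++ L.tailVertices l 0 ++ centerVertices χ (+ 0) ss) (∈-map⁺ (corner (+ 0)) (every c))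

-- Decomposition of the four families into a closing octagon and tails

odd⁺-layout : ∀ l χ → oddPositive (suc l) ≈ᴸ
  (centerLayout (+ 1) (east ∷ south ∷ []) ⊕ TailLayout.tailLayout (oddTail positive) positive χ l 1)
odd⁺-layout l χ = ≡⇒≈ᴸ
  (map-upFrom {f = pos} {pos ∘ suc} (λ _ → ≡.refl) (suc l))
  (↭-trans (↭-reflexive (cong₂ (λ xs n → xs ++ (+ 1 , east) ∷ (pos n , west) ∷ [])
      (map-upFrom {g = λ i → sideSquare (suc i)} (λ i → cong (pos (suc i) ,_) (ifOdd-vert (oddTail positive) side (suc i))) (suc l))
      (ℕ.+-comm 1 l)))
    -- The east square of `O_1` is listed after the side squares and moves to the front, into the
    -- closing octagon.
    (↭ₚ.shift _ ((+ 1 , south) ∷ map (sideSquare ∘ suc) (range 1 l)) _))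
  (map-upFrom′ (λ i → cong (link (pos (suc i)) (pos i)) (ifOdd-vert (oddTail positive) (height positive) i)) l)
  (map-upFrom′ (ifOdd-arc (oddTail positive) positive) l)
  where
  open Tails (oddTail positive) positive χ

odd⁻-layout : ∀ l χ → oddNegative (suc l) ≈ᴸ
  (centerLayout (+ 1) (north ∷ []) ⊕ TailLayout.tailLayout (oddTail negative) negative χ l 1)
odd⁻-layout l χ = ≡⇒≈ᴸ
  (map-upFrom {f = pos} {pos ∘ suc} (λ _ → ≡.refl) (suc l))
  (↭-reflexive (≡.trans
    (map-upFrom {g = λ i → sideSquare (suc i)} (λ i → cong (pos (suc i) ,_) (ifOdd-vert (oddTail negative) side (suc i))) (suc l))
    (≡.sym (++-identityʳ _))))
  (map-upFrom′ (λ i → cong (link (pos (suc i)) (pos i)) (ifOdd-vert (oddTail negative) (height negative) i)) l)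
  (map-upFrom′ (ifOdd-arc (oddTail negative) negative) l)
  where
  open Tails (oddTail negative) negative χ

interval-↭ : ∀ k l → [- k ⋯ l ] ↭ + 0 ∷ map pos [1⋯ l ] ++ map neg [1⋯ k ]
interval-↭ zero    l = ↭-reflexive (cong (+ 0 ∷_) (≡.trans tail-pos (≡.sym (++-identityʳ _))))
  where
  tail-pos : map (λ j → + j ℤ.- + 0) (applyUpTo suc l) ≡ map pos [1⋯ l ]
  tail-pos = ≡.trans (map-cong (λ j → ℤ.+-identityʳ (+ j)) _) (cong (map pos) (≡.sym (map-upTo suc l)))
interval-↭ (suc k) l = ↭-trans (↭-reflexive (cong (neg (suc k) ∷_) shifted)) (↭-trans
  (↭.prep (neg (suc k)) (interval-↭ k l)) (↭-trans
  (++-comm (neg (suc k) ∷ []) _)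
  (↭-reflexive (cong (+ 0 ∷_) (≡.trans (++-assoc (map pos [1⋯ l ]) _ _) (cong (map pos [1⋯ l ] ++_) last))))))
  where
  shifted : map (λ j → + j ℤ.- + suc k) (applyUpTo suc (suc (k ℕ.+ l))) ≡ [- k ⋯ l ]
  shifted = ≡.trans (cong (map _) (≡.sym (map-upTo suc (suc (k ℕ.+ l)))))
    (≡.trans (≡.sym (map-∘ (upTo (suc (k ℕ.+ l))))) (map-cong (λ j → ≡.trans (ℤ.[1+m]⊖[1+n]≡m⊖n j k) (≡.sym (ℤ.m-n≡m⊖n j k))) _))
  last : map neg [1⋯ k ] ++ neg (suc k) ∷ [] ≡ map neg [1⋯ suc k ]
  last = ≡.trans (≡.sym (map-++ neg [1⋯ k ] _)) (cong (map neg)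
    (≡.trans (≡.sym (map-++ suc (upTo k) _)) (cong (map suc) (upTo-∷ʳ k))))

module _ (l : ℕ) (χ : Choice) where
  private
    module R⁺ = Tails rightTail positive χ
    module L⁺ = Tails leftTail positive χ

  tails-octagons : [- l ⋯ l ] ↭ + 0 ∷ map (pos ∘ suc) (range 0 l) ++ map (neg ∘ suc) (range 0 l)
  tails-octagons = ↭-trans (interval-↭ l l) (↭-reflexive (cong₂ (λ xs ys → + 0 ∷ xs ++ ys)
    (map-upFrom (λ _ → ≡.refl) l) (map-upFrom (λ _ → ≡.refl) l)))

  right-squares : map (λ i → pos i , (ifOdd i then north else south)) [1⋯ l ] ≡ map (R⁺.sideSquare ∘ suc) (range 0 l)
  right-squares = map-upFrom (λ i → cong (pos (suc i) ,_) (ifOdd-vert rightTail side (suc i))) l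

  left-squares : map (λ i → neg i , (ifOdd i then south else north)) [1⋯ l ] ≡ map (L⁺.sideSquare ∘ suc) (range 0 l)
  left-squares = map-upFrom (λ i → cong (neg (suc i) ,_) (ifOdd-vert leftTail side (suc i))) l

  right-link : ∀ k i → link (pos i) (pos (suc i)) (ifOdd suc i then height k down else height k up) ≡
                       jointLink k rightward (Numbering.vert rightTail i) (pos i) (pos (suc i))
  right-link k i = cong (link (pos i) (pos (suc i))) (≡.trans (ifOdd-suc i) (ifOdd-vert rightTail (height k) i))

  left-link : ∀ k i → link (neg (suc i)) (neg i) (ifOdd suc i then height k up else height k down) ≡
                      jointLink k leftward (Numbering.vert leftTail i) (neg i) (neg (suc i))
  left-link k i = cong (link (neg (suc i)) (neg i)) (≡.trans (ifOdd-suc i) (ifOdd-vert leftTail (height k) i))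

  even⁺-layout : evenPositive (suc l) ≈ᴸ
    (centerLayout (+ 0) (north ∷ south ∷ []) ⊕
     (TailLayout.tailLayout rightTail positive χ l 0 ⊕ TailLayout.tailLayout leftTail positive χ l 0))
  even⁺-layout = record
    { octagons-↭ = tails-octagons
    ; squares-↭  = ↭.prep _ (↭.prep _ (↭-trans
        (↭-reflexive (≡.trans (cong₂ (λ xs ys → xs ++ ys ++ (pos l , east) ∷ (neg l , west) ∷ []) right-squares left-squares)
          (cong (λ n → rs ++ ls ++ (pos n , east) ∷ (neg n , west) ∷ []) (≡.sym (ℕ.+-identityʳ l)))))
        (↭-trans (++⁺ˡ rs (↭ₚ.shift _ ls _)) (↭-reflexive (≡.sym (++-assoc rs _ _))))))
    ; links-↭    = ↭-reflexive (cong₂ _++_ (map-upFrom (right-link positive) l) (map-upFrom (left-link positive) l))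
    ; arcs-↭     = ↭-reflexive (cong₂ _++_ (map-upFrom (ifOdd-arc rightTail positive) l) (map-upFrom (ifOdd-arc leftTail positive) l))
    }
    where
    rs ls : List (ℤ × Side)
    rs = map (R⁺.sideSquare ∘ suc) (range 0 l)
    ls = map (L⁺.sideSquare ∘ suc) (range 0 l)

  even⁻-layout : evenNegative (suc l) ≈ᴸ
    (centerLayout (+ 0) [] ⊕
     (TailLayout.tailLayout rightTail negative χ l 0 ⊕ TailLayout.tailLayout leftTail negative χ l 0))
  even⁻-layout = record
    { octagons-↭ = tails-octagons
    ; squares-↭  = ↭-reflexive (cong₂ _++_ (≡.trans right-squares (≡.sym (++-identityʳ _))) (≡.trans left-squares (≡.sym (++-identityʳ _))))
    ; links-↭    = ↭-reflexive (cong₂ _++_ (map-upFrom (right-link negative) l) (map-upFrom (left-link negative) l))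
    ; arcs-↭     = ↭-reflexive (cong₂ _++_ (map-upFrom (ifOdd-arc rightTail negative) l) (map-upFrom (ifOdd-arc leftTail negative) l))
    }

p-odd⁺ : ∀ l χ → WeightedGraph.p (chain (oddPositive (suc l)) χ) Pol.≈ O⁺ (suc l)
p-odd⁺ l χ = Pol.trans
  (OddFamily.odd-sum positive χ (east ∷ south ∷ []) l _ (((λ ()) ∷ []) ∷ [] ∷ [])
    ((λ _ → s≤s z≤n) ∷ (λ _ → s≤s z≤n) ∷ []) (odd⁺-layout l χ))
  (closing-odd⁺ l)

p-odd⁻ : ∀ l χ → WeightedGraph.p (chain (oddNegative (suc l)) χ) Pol.≈ O⁻ (suc l)
p-odd⁻ l χ = Pol.trans
  (OddFamily.odd-sum negative χ (north ∷ []) l _ ([] ∷ []) ((λ _ → s≤s z≤n) ∷ []) (odd⁻-layout l χ))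
  (closing-odd⁻ l)

p-even⁺ : ∀ l χ → WeightedGraph.p (chain (evenPositive (suc l)) χ) Pol.≈ E⁺ (suc l)
p-even⁺ l χ = Pol.trans
  (EvenFamily.even-sum positive χ (north ∷ south ∷ []) l _ (((λ ()) ∷ []) ∷ [] ∷ [])
    ((λ _ → z≤n) ∷ (λ _ → z≤n) ∷ []) ((λ _ → z≤n) ∷ (λ _ → z≤n) ∷ []) (even⁺-layout l χ))
  (closing-even positive l)

p-even⁻ : ∀ l χ → WeightedGraph.p (chain (evenNegative (suc l)) χ) Pol.≈ E⁻ l
p-even⁻ l χ = Pol.trans
  (EvenFamily.even-sum negative χ [] l _ [] [] [] (even⁻-layout l χ))
  (closing-even negative l)

-- Fractions

module FractionProperties (D : IntegralDomain) where
  open IntegralDomain D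
  open Fractions D using (Fraction; fraction; _≃_) renaming (_*_ to _*ᶠ_; _+_ to _+ᶠ_; _^_ to _^ᶠ_; 1# to 1ᶠ)
  open RingProperties ring using (x∙y⁻¹≈ε⇒x≈y; x[y-z]≈xy-xz)
  open import Relation.Binary.Reasoning.Setoid setoid
  open import Algebra.Solver.Ring.NaturalCoefficients.Default commutativeSemiring
    using (con; solve; _:+_; _:*_; _:^_; _:=_)

  *-cancelˡ-nonzero : ∀ {a b c} → ¬ (a ≈ 0#) → a * b ≈ a * c → b ≈ c
  *-cancelˡ-nonzero {a} {b} {c} a≉0 e with noZeroDivisors a (b - c) (trans (x[y-z]≈xy-xz a b c) (trans (+-congʳ e) (-‿inverseʳ (a * c))))
  ... | inj₁ a≈0 = contradiction a≈0 a≉0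
  ... | inj₂ p   = x∙y⁻¹≈ε⇒x≈y b c p

  ≃-sym : ∀ {x y} → x ≃ y → y ≃ x
  ≃-sym {fraction _ _ _} {fraction _ _ _} = sym

  -- Cross-multiplication leaves the middle denominator as a common factor, which cancels in an
  -- integral domain.
  ≃-trans : ∀ {x y z} → x ≃ y → y ≃ z → x ≃ z
  ≃-trans {fraction a b _} {fraction c d d≉0} {fraction e f _} p q = *-cancelˡ-nonzero d≉0 (begin
    d * (a * f)  ≈⟨ solve 3 (λ a d f → d :* (a :* f) := a :* d :* f) refl a d f ⟩
    a * d * f    ≈⟨ *-congʳ p ⟩
    c * b * f    ≈⟨ solve 3 (λ b c f → c :* b :* f := c :* f :* b) refl b c f ⟩
    c * f * b    ≈⟨ *-congʳ q ⟩
    e * d * b    ≈⟨ solve 3 (λ b d e → e :* d :* b := d :* (e :* b)) refl b d e ⟩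
    d * (e * b)  ∎)

  *ᶠ-cong : ∀ {x x′ y y′} → x ≃ x′ → y ≃ y′ → (x *ᶠ y) ≃ (x′ *ᶠ y′)
  *ᶠ-cong {fraction a b _} {fraction a′ b′ _} {fraction c d _} {fraction c′ d′ _} p q = begin
    a * c * (b′ * d′)    ≈⟨ solve 4 (λ a c b′ d′ → a :* c :* (b′ :* d′) := a :* b′ :* (c :* d′)) refl a c b′ d′ ⟩
    a * b′ * (c * d′)    ≈⟨ *-cong p q ⟩
    a′ * b * (c′ * d)    ≈⟨ solve 4 (λ a c b d → a :* b :* (c :* d) := a :* c :* (b :* d)) refl a′ c′ b d ⟩
    a′ * c′ * (b * d)    ∎

  +1-cong : ∀ {x x′} → x ≃ x′ → (x +ᶠ 1ᶠ) ≃ (x′ +ᶠ 1ᶠ)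
  +1-cong {fraction a b _} {fraction a′ b′ _} p = begin
    (a * 1# + 1# * b) * (b′ * 1#)    ≈⟨ solve 3 (λ a b b′ → (a :* con 1 :+ con 1 :* b) :* (b′ :* con 1) := a :* b′ :+ b :* b′) refl a b b′ ⟩
    a * b′ + b * b′                  ≈⟨ +-congʳ p ⟩
    a′ * b + b * b′                  ≈⟨ solve 3 (λ a b b′ → a :* b :+ b :* b′ := (a :* con 1 :+ con 1 :* b′) :* (b :* con 1)) refl a′ b b′ ⟩
    (a′ * 1# + 1# * b′) * (b * 1#)   ∎

  ^ᶠ4-cong : ∀ {x x′} → x ≃ x′ → (x ^ᶠ 4) ≃ (x′ ^ᶠ 4)
  ^ᶠ4-cong {x} {x′} p = step 3 (step 2 (step 1 (step 0 (refl {1# * 1#}))))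
    where
    step : ∀ n → (x ^ᶠ n) ≃ (x′ ^ᶠ n) → (x ^ᶠ suc n) ≃ (x′ ^ᶠ suc n)
    step n = *ᶠ-cong {x} {x′} {x ^ᶠ n} {x′ ^ᶠ n} p

  *ᶠ-cancelʳ : ∀ {x y z w} → ¬ (Fraction.numerator w ≈ 0#) → z ≃ w → (x *ᶠ z) ≃ (y *ᶠ w) → x ≃ y
  *ᶠ-cancelʳ {fraction a b _} {fraction a′ b′ _} {fraction c d d≉0} {fraction c′ d′ _} c′≉0 p q =
    *-cancelˡ-nonzero (*-nonzero c′≉0 d≉0) (begin
      c′ * d * (a * b′)      ≈⟨ *-congʳ p ⟨
      c * d′ * (a * b′)      ≈⟨ solve 4 (λ a b′ c d′ → c :* d′ :* (a :* b′) := a :* c :* (b′ :* d′)) refl a b′ c d′ ⟩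
      a * c * (b′ * d′)      ≈⟨ q ⟩
      a′ * c′ * (b * d)      ≈⟨ solve 4 (λ a′ b c′ d → a′ :* c′ :* (b :* d) := c′ :* d :* (a′ :* b)) refl a′ b c′ d ⟩
      c′ * d * (a′ * b)      ∎)

  *ᶠ-cancelˡ : ∀ {x y z w} → ¬ (Fraction.numerator w ≈ 0#) → z ≃ w → (z *ᶠ x) ≃ (w *ᶠ y) → x ≃ y
  *ᶠ-cancelˡ {x} {y} {z} {w} n p q = *ᶠ-cancelʳ {x} {y} {z} {w} n p
    (≃-trans {x *ᶠ z} {z *ᶠ x} {y *ᶠ w} (comm x z) (≃-trans {z *ᶠ x} {w *ᶠ y} {y *ᶠ w} q (comm w y)))
    where
    comm : ∀ x y → (x *ᶠ y) ≃ (y *ᶠ x)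
    comm (fraction a b _) (fraction c d _) = solve 4 (λ a b c d → a :* c :* (d :* b) := c :* a :* (b :* d)) refl a b c d

  odd-product : ∀ {a c e b d f b≉0 d≉0 f≉0} → a * c * f ≈ (e + f) * (b * d) →
                (fraction a b b≉0 *ᶠ fraction c d d≉0) ≃ (fraction e f f≉0 +ᶠ 1ᶠ)
  odd-product {a} {c} {e} {b} {d} {f} p = begin
    a * c * (f * 1#)                 ≈⟨ *-congˡ (*-identityʳ f) ⟩
    a * c * f                        ≈⟨ p ⟩
    (e + f) * (b * d)                ≈⟨ *-congʳ (+-cong (*-identityʳ e) (*-identityˡ f)) ⟨
    (e * 1# + 1# * f) * (b * d)      ∎

  even-product : ∀ {a c e b d f b≉0 d≉0 f≉0} → a * c * f ^ 4 ≈ (e ^ 4 + f ^ 4) * (b * d) →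
                 (fraction a b b≉0 *ᶠ fraction c d d≉0) ≃ ((fraction e f f≉0 ^ᶠ 4) +ᶠ 1ᶠ)
  even-product {a} {c} {e} {b} {d} {f} p = begin
    a * c * (f ^ 4 * 1#)                     ≈⟨ *-congˡ (*-identityʳ (f ^ 4)) ⟩
    a * c * f ^ 4                            ≈⟨ p ⟩
    (e ^ 4 + f ^ 4) * (b * d)                ≈⟨ *-congʳ (+-cong (*-identityʳ (e ^ 4)) (*-identityˡ (f ^ 4))) ⟨
    (e ^ 4 * 1# + 1# * f ^ 4) * (b * d)      ∎

-- The cluster sequence

open Denominators Pol.commutativeRing x₁ x₂
open FractionProperties ℤ[x₁,x₂].integralDomain

parity-double : ∀ k → parity (double k) ≡ 0ℙ
parity-double zero    = ≡.refl
parity-double (suc k) = parity-double k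

parity-suc-double : ∀ k → parity (suc (double k)) ≡ 1ℙ
parity-suc-double zero    = ≡.refl
parity-suc-double (suc k) = parity-suc-double k

half-double : ∀ k → ⌊ double k /2⌋ ≡ k
half-double zero    = ≡.refl
half-double (suc k) = cong suc (half-double k)

ifOdd-odd : ∀ {A : Set} {i} {a b : A} → parity i ≡ 1ℙ → (ifOdd i then a else b) ≡ a
ifOdd-odd {i = i} p with parity i | p
... | 1ℙ | _ = ≡.refl

ifOdd-even : ∀ {A : Set} {i} {a b : A} → parity i ≡ 0ℙ → (ifOdd i then a else b) ≡ b
ifOdd-even {i = i} p with parity i | p
... | 0ℙ | _ = ≡.refl

m-odd⁺ : ∀ k → m (+ (3 ℕ.+ double k)) ≡ mO⁺ k
m-odd⁺ k = cong₂ monomial (ifOdd-odd {i = 3 ℕ.+ double k} (parity-suc-double k))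
  (≡.trans (ifOdd-odd {i = 3 ℕ.+ double k} (parity-suc-double k)) (half-double k))

m-even⁺ : ∀ k → m (+ (4 ℕ.+ double k)) ≡ mE⁺ k
m-even⁺ k = cong₂ monomial
  (≡.trans (ifOdd-even {i = 4 ℕ.+ double k} (parity-double k)) (sq-even (double k)))
  (ifOdd-even {i = 4 ℕ.+ double k} (parity-double k))
  where
  sq-even : ∀ d → d ℕ.+ (4 ℕ.+ (d ℕ.+ 0)) ≡ 4 ℕ.+ (d ℕ.+ d)
  sq-even d = ≡.trans (ℕ.+-comm d (4 ℕ.+ (d ℕ.+ 0))) (cong (λ e → 4 ℕ.+ (e ℕ.+ d)) (ℕ.+-identityʳ d))

m-odd⁻ : ∀ k → m (-[1+ double k ]) ≡ mO⁻ k
m-odd⁻ k = cong₂ monomial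
  (≡.trans (ifOdd-odd {i = suc (double k)} (parity-suc-double k)) (cong suc (ℕ.+-identityʳ (double k))))
  (≡.trans (ifOdd-odd {i = suc (double k)} (parity-suc-double k))
    (≡.trans (cong (⌊_/2⌋ ∘ suc) (ℕ.+-comm (double k) 1)) (cong suc (half-double k))))

m-even⁻ : ∀ k → m (-[1+ suc (double k) ]) ≡ mE⁻ k
m-even⁻ k = cong₂ monomial
  (≡.trans (ifOdd-even {i = 2 ℕ.+ double k} (parity-double k)) (sq-even (double k)))
  (≡.trans (ifOdd-even {i = 2 ℕ.+ double k} (parity-double k)) (cong (suc ∘ suc) (ℕ.+-comm (double k) 1)))
  where
  sq-even : ∀ d → suc d ℕ.+ (suc (suc d) ℕ.+ 0) ℕ.+ 1 ≡ 4 ℕ.+ (d ℕ.+ d)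
  sq-even d = ≡.trans (ℕ.+-comm _ 1) (cong (suc ∘ suc) (≡.trans (cong (d ℕ.+_) (ℕ.+-identityʳ (suc (suc d))))
    (≡.trans (ℕ.+-suc d (suc d)) (cong suc (ℕ.+-suc d d)))))

interleave : ∀ {A : Set} → (ℕ → A) → (ℕ → A) → ℕ → A
interleave f g zero    = f 0
interleave f g (suc n) = interleave g (f ∘ suc) n

interleave-even : ∀ {A : Set} (f g : ℕ → A) k → interleave f g (double k) ≡ f k
interleave-even f g zero    = ≡.refl
interleave-even f g (suc k) = interleave-even (f ∘ suc) (g ∘ suc) k

interleave-odd : ∀ {A : Set} (f g : ℕ → A) k → interleave f g (suc (double k)) ≡ g k
interleave-odd f g k = interleave-even g (f ∘ suc) k

-- At 1 and 2 the truncated subtractions give `m` exponents zero, so `x₁` and `x₂` appear there over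
-- the denominator 1. `E⁺` and `O⁻` are shifted, as their values at 0 belong to no graph.
numerator : ℤ → Polynomial
numerator (+ 0)                 = E⁻ 0
numerator (+ 1)                 = x₁
numerator (+ 2)                 = x₂
numerator (+ suc (suc (suc n))) = interleave O⁺ (E⁺ ∘ suc) n
numerator -[1+ n ]              = interleave (O⁻ ∘ suc) (E⁻ ∘ suc) n

clusterVariable : ℤ → RationalFunction
clusterVariable n = Rat.fraction (numerator n) (m n) (m≉0 n)

data Index : ℤ → Set where
  zero  : Index (+ 0)
  one   : Index (+ 1)
  two   : Index (+ 2)
  odd⁺  : ∀ k → Index (+ (3 ℕ.+ double k))
  even⁺ : ∀ k → Index (+ (4 ℕ.+ double k))
  odd⁻  : ∀ k → Index -[1+ double k ]
  even⁻ : ∀ k → Index -[1+ suc (double k) ]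

halves : ∀ n → ∃ λ k → n ≡ double k ⊎ n ≡ suc (double k)
halves zero    = 0 , inj₁ ≡.refl
halves (suc n) with halves n
... | k , inj₁ e = k , inj₂ (cong suc e)
... | k , inj₂ e = suc k , inj₁ (cong suc e)

index : ∀ n → Index n
index (+ 0) = zero
index (+ 1) = one
index (+ 2) = two
index (+ suc (suc (suc n))) with halves n
... | k , inj₁ ≡.refl = odd⁺ k
... | k , inj₂ ≡.refl = even⁺ k
index -[1+ n ] with halves n
... | k , inj₁ ≡.refl = odd⁻ k
... | k , inj₂ ≡.refl = even⁻ k

OddStep EvenStep : ℤ → ℤ → ℤ → Set
OddStep  a b c = OddRelation  (numerator a) (numerator b) (numerator c) (m a) (m b) (m c)
EvenStep a b c = EvenRelation (numerator a) (numerator b) (numerator c) (m a) (m b) (m c)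

transport : ∀ {A : Set} (F : A → A → A → A → A → A → Set) {a a′ b b′ c c′ d d′ e e′ f f′ : A} →
            a ≡ a′ → b ≡ b′ → c ≡ c′ → d ≡ d′ → e ≡ e′ → f ≡ f′ → F a′ b′ c′ d′ e′ f′ → F a b c d e f
transport F ≡.refl ≡.refl ≡.refl ≡.refl ≡.refl ≡.refl x = x

odd-step⁺ : ∀ k → OddStep (+ (5 ℕ.+ double k)) (+ (4 ℕ.+ double k)) (+ (3 ℕ.+ double k))
odd-step⁺ k = transport OddRelation
  (interleave-even O⁺ (E⁺ ∘ suc) (suc k)) (interleave-odd O⁺ (E⁺ ∘ suc) k) (interleave-even O⁺ (E⁺ ∘ suc) k)
  (m-odd⁺ (suc k)) (m-even⁺ k) (m-odd⁺ k) ((O⁺-cleared k))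

even-step⁺ : ∀ k → EvenStep (+ (6 ℕ.+ double k)) (+ (5 ℕ.+ double k)) (+ (4 ℕ.+ double k))
even-step⁺ k = transport EvenRelation
  (interleave-odd O⁺ (E⁺ ∘ suc) (suc k)) (interleave-even O⁺ (E⁺ ∘ suc) (suc k)) (interleave-odd O⁺ (E⁺ ∘ suc) k)
  (m-even⁺ (suc k)) (m-odd⁺ (suc k)) (m-even⁺ k) ((E⁺-cleared k))

odd-step⁻ : ∀ k → OddStep -[1+ double k ] -[1+ suc (double k) ] -[1+ suc (suc (double k)) ]
odd-step⁻ k = transport OddRelation
  (interleave-even (O⁻ ∘ suc) (E⁻ ∘ suc) k) (interleave-odd (O⁻ ∘ suc) (E⁻ ∘ suc) k) (interleave-even (O⁻ ∘ suc) (E⁻ ∘ suc) (suc k))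
  (m-odd⁻ k) (m-even⁻ k) (m-odd⁻ (suc k)) ((O⁻-cleared k))

even-step⁻ : ∀ k → EvenStep -[1+ suc (double k) ] -[1+ suc (suc (double k)) ] -[1+ suc (suc (suc (double k))) ]
even-step⁻ k = transport EvenRelation
  (interleave-odd (O⁻ ∘ suc) (E⁻ ∘ suc) k) (interleave-even (O⁻ ∘ suc) (E⁻ ∘ suc) (suc k)) (interleave-odd (O⁻ ∘ suc) (E⁻ ∘ suc) (suc k))
  (m-even⁻ k) (m-odd⁻ (suc k)) (m-even⁻ (suc k)) ((E⁻-cleared k))

odd-step₁ : OddStep (+ 1) (+ 0) -[1+ 0 ]
odd-step₁ = transport OddRelation {numerator (+ 1)} {x₁} {numerator (+ 0)} {E⁻ 0} {numerator -[1+ 0 ]} {O⁻ 1}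
  ≡.refl ≡.refl ≡.refl
  (cong₂ monomial {sq (+ 1)} {0} {oct (+ 1)} {0} ≡.refl ≡.refl)
  (cong₂ monomial {sq (+ 0)} {0} {oct (+ 0)} {1} ≡.refl ≡.refl)
  (cong₂ monomial {sq -[1+ 0 ]} {1} {oct -[1+ 0 ]} {1} ≡.refl ≡.refl) cleared₁

odd-step₃ : OddStep (+ 3) (+ 2) (+ 1)
odd-step₃ = transport OddRelation {numerator (+ 3)} {O⁺ 0} {numerator (+ 2)} {x₂} {numerator (+ 1)} {x₁}
  ≡.refl ≡.refl ≡.refl
  (cong₂ monomial {sq (+ 3)} {1} {oct (+ 3)} {0} ≡.refl ≡.refl)
  (cong₂ monomial {sq (+ 2)} {0} {oct (+ 2)} {0} ≡.refl ≡.refl)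
  (cong₂ monomial {sq (+ 1)} {0} {oct (+ 1)} {0} ≡.refl ≡.refl) cleared₃

even-step₀ : EvenStep (+ 0) -[1+ 0 ] -[1+ 1 ]
even-step₀ = transport EvenRelation {numerator (+ 0)} {E⁻ 0} {numerator -[1+ 0 ]} {O⁻ 1} {numerator -[1+ 1 ]} {E⁻ 1}
  ≡.refl ≡.refl ≡.refl
  (cong₂ monomial {sq (+ 0)} {0} {oct (+ 0)} {1} ≡.refl ≡.refl)
  (cong₂ monomial {sq -[1+ 0 ]} {1} {oct -[1+ 0 ]} {1} ≡.refl ≡.refl)
  (cong₂ monomial {sq -[1+ 1 ]} {4} {oct -[1+ 1 ]} {3} ≡.refl ≡.refl) cleared₀

even-step₂ : EvenStep (+ 2) (+ 1) (+ 0)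
even-step₂ = transport EvenRelation {numerator (+ 2)} {x₂} {numerator (+ 1)} {x₁} {numerator (+ 0)} {E⁻ 0}
  ≡.refl ≡.refl ≡.refl
  (cong₂ monomial {sq (+ 2)} {0} {oct (+ 2)} {0} ≡.refl ≡.refl)
  (cong₂ monomial {sq (+ 1)} {0} {oct (+ 1)} {0} ≡.refl ≡.refl)
  (cong₂ monomial {sq (+ 0)} {0} {oct (+ 0)} {1} ≡.refl ≡.refl) cleared₂

even-step₄ : EvenStep (+ 4) (+ 3) (+ 2)
even-step₄ = transport EvenRelation {numerator (+ 4)} {E⁺ 1} {numerator (+ 3)} {O⁺ 0} {numerator (+ 2)} {x₂}
  ≡.refl ≡.refl ≡.refl
  (cong₂ monomial {sq (+ 4)} {4} {oct (+ 4)} {1} ≡.refl ≡.refl)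
  (cong₂ monomial {sq (+ 3)} {1} {oct (+ 3)} {0} ≡.refl ≡.refl)
  (cong₂ monomial {sq (+ 2)} {0} {oct (+ 2)} {0} ≡.refl ≡.refl) cleared₄

-[1+]-1 : ∀ n → -[1+ n ] ℤ.- + 1 ≡ -[1+ suc n ]
-[1+]-1 n = cong (-[1+_] ∘ suc) (ℕ.+-identityʳ n)

-[1+]-2 : ∀ n → -[1+ n ] ℤ.- + 2 ≡ -[1+ suc (suc n) ]
-[1+]-2 n = cong (-[1+_] ∘ suc) (ℕ.+-comm n 1)

odd-steps : ∀ n → Odd n → OddStep n (n ℤ.- + 1) (n ℤ.- + 2)
odd-steps n p with index n
... | one              = odd-step₁
... | odd⁺ zero        = odd-step₃
... | odd⁺ (suc k)     = odd-step⁺ k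
... | odd⁻ k           = ≡.subst₂ (OddStep -[1+ double k ]) (≡.sym (-[1+]-1 (double k))) (≡.sym (-[1+]-2 (double k))) (odd-step⁻ k)
... | even⁺ k with () ← ≡.trans (≡.sym p) (parity-double k)
... | even⁻ k with () ← ≡.trans (≡.sym p) (parity-double k)

even-steps : ∀ n → Even n → EvenStep n (n ℤ.- + 1) (n ℤ.- + 2)
even-steps n p with index n
... | zero             = even-step₀
... | two              = even-step₂
... | even⁺ zero       = even-step₄
... | even⁺ (suc k)    = even-step⁺ k
... | even⁻ k          = ≡.subst₂ (EvenStep -[1+ suc (double k) ]) (≡.sym (-[1+]-1 (suc (double k)))) (≡.sym (-[1+]-2 (suc (double k)))) (even-step⁻ k)
... | odd⁺ k with () ← ≡.trans (≡.sym p) (parity-suc-double k)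
... | odd⁻ k with () ← ≡.trans (≡.sym p) (parity-suc-double k)

clusterVariables : IsClusterSequence clusterVariable
clusterVariables = record
  { initial₁ = initial x₁ (Pol.*-identityˡ Pol.1#)
  ; initial₂ = initial x₂ (Pol.*-identityˡ Pol.1#)
  ; odd      = λ n p → odd-product {numerator n} {numerator (n ℤ.- + 2)} {numerator (n ℤ.- + 1)} {m n} {m (n ℤ.- + 2)} {m (n ℤ.- + 1)}
                         {m≉0 n} {m≉0 (n ℤ.- + 2)} {m≉0 (n ℤ.- + 1)} (OddRelation.cleared (odd-steps n p))
  ; even     = λ n p → even-product {numerator n} {numerator (n ℤ.- + 2)} {numerator (n ℤ.- + 1)} {m n} {m (n ℤ.- + 2)} {m (n ℤ.- + 1)}
                         {m≉0 n} {m≉0 (n ℤ.- + 2)} {m≉0 (n ℤ.- + 1)} (EvenRelation.cleared (even-steps n p))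
  }
  where
  initial : ∀ x {u} → u Pol.≈ Pol.1# → x Pol.* Pol.1# Pol.≈ x Pol.* u
  initial x e = Pol.*-congˡ {x} (Pol.sym e)

module _ (D : IntegralDomain) where
  private module R = IntegralDomain D
  open Polynomials D

  coeff-*-zero : ∀ p q → coeff (p * q) 0 R.≈ coeff p 0 R.* coeff q 0
  coeff-*-zero []      q = R.sym (R.zeroˡ _)
  coeff-*-zero (a ∷ p) q = R.trans (coeff-+ (scale a q) (shift (p * q)) 0)
    (R.trans (R.+-identityʳ _) (coeff-scale a q 0))

-- All numerators other than x₁ and x₂ have constant term 1, hence are nonzero.
constantTerm : Polynomial → ℤ
constantTerm p = ℤ[x₁].coeff (ℤ[x₁,x₂].coeff p 0) 0

constantTerm-+ : ∀ p q → constantTerm (p Pol.+ q) ≡ constantTerm p ℤ.+ constantTerm q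
constantTerm-+ p q = ≡.trans (ℤ[x₁].at (ℤ[x₁,x₂].coeff-+ p q 0) 0) (ℤ[x₁].coeff-+ (ℤ[x₁,x₂].coeff p 0) (ℤ[x₁,x₂].coeff q 0) 0)

constantTerm-* : ∀ p q → constantTerm (p Pol.* q) ≡ constantTerm p ℤ.* constantTerm q
constantTerm-* p q = ≡.trans (ℤ[x₁].at (coeff-*-zero ℤ[x₁].integralDomain p q) 0)
  (coeff-*-zero ℤ-integralDomain (ℤ[x₁,x₂].coeff p 0) (ℤ[x₁,x₂].coeff q 0))

constantTerm-≉0 : ∀ {p} → constantTerm p ≡ + 1 → ¬ (p Pol.≈ Pol.0#)
constantTerm-≉0 e p≈0 with () ← ≡.trans (≡.sym e) (ℤ[x₁].at (ℤ[x₁,x₂].at p≈0 0) 0)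

open ConstantTerms.Augmented Pol.commutativeRing x₁ x₂ constantTerm constantTerm-+ constantTerm-* ≡.refl ≡.refl ≡.refl ≡.refl

numerator≉0 : ∀ n → ¬ (numerator n Pol.≈ Pol.0#)
numerator≉0 n with index n
... | zero    = constantTerm-≉0 {E⁻ 0} (ε-E⁻ 0)
... | one     = x₁≉0
... | two     = x₂≉0
... | odd⁺ k  = constantTerm-≉0 (≡.trans (cong constantTerm (interleave-even O⁺ (E⁺ ∘ suc) k)) (ε-O⁺ k))
... | even⁺ k = constantTerm-≉0 (≡.trans (cong constantTerm (interleave-odd O⁺ (E⁺ ∘ suc) k)) (ε-E⁺ (suc k)))
... | odd⁻ k  = constantTerm-≉0 (≡.trans (cong constantTerm (interleave-even (O⁻ ∘ suc) (E⁻ ∘ suc) k)) (ε-O⁻ k))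
... | even⁻ k = constantTerm-≉0 (≡.trans (cong constantTerm (interleave-odd (O⁻ ∘ suc) (E⁻ ∘ suc) k)) (ε-E⁻ (suc k)))

-- Uniqueness of the cluster sequence

module Uniqueness {x y : ℤ → RationalFunction} (cx : IsClusterSequence x) (cy : IsClusterSequence y)
                  (y≉0 : ∀ n → ¬ (Rat.Fraction.numerator (y n) Pol.≈ Pol.0#)) where
  private
    module X = IsClusterSequence cx
    module Y = IsClusterSequence cy

  infix 4 _∼_
  _∼_ : RationalFunction → RationalFunction → Set
  _∼_ = Rat._≃_

  Agree : ℤ → Set
  Agree n = x n ∼ y n

  products-agree : ∀ n → Agree (n ℤ.- + 1) → (x n Rat.* x (n ℤ.- + 2)) ∼ (y n Rat.* y (n ℤ.- + 2))
  products-agree n e with parity ℤ.∣ n ∣ in p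
  ... | 1ℙ = ≃-trans {x n Rat.* x (n ℤ.- + 2)} {x (n ℤ.- + 1) Rat.+ Rat.1#} {y n Rat.* y (n ℤ.- + 2)} (X.odd n p)
    (≃-trans {x (n ℤ.- + 1) Rat.+ Rat.1#} {y (n ℤ.- + 1) Rat.+ Rat.1#} {y n Rat.* y (n ℤ.- + 2)}
      (+1-cong {x (n ℤ.- + 1)} {y (n ℤ.- + 1)} e)
      (≃-sym {y n Rat.* y (n ℤ.- + 2)} {y (n ℤ.- + 1) Rat.+ Rat.1#} (Y.odd n p)))
  ... | 0ℙ = ≃-trans {x n Rat.* x (n ℤ.- + 2)} {(x (n ℤ.- + 1) Rat.^ 4) Rat.+ Rat.1#} {y n Rat.* y (n ℤ.- + 2)} (X.even n p)
    (≃-trans {(x (n ℤ.- + 1) Rat.^ 4) Rat.+ Rat.1#} {(y (n ℤ.- + 1) Rat.^ 4) Rat.+ Rat.1#} {y n Rat.* y (n ℤ.- + 2)}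
      (+1-cong {x (n ℤ.- + 1) Rat.^ 4} {y (n ℤ.- + 1) Rat.^ 4} (^ᶠ4-cong {x (n ℤ.- + 1)} {y (n ℤ.- + 1)} e))
      (≃-sym {y n Rat.* y (n ℤ.- + 2)} {(y (n ℤ.- + 1) Rat.^ 4) Rat.+ Rat.1#} (Y.even n p)))

  -- Only the values of the explicit solution `y` have to be nonzero for the cancellation; nothing
  -- of the kind is assumed of `x`.
  ascend : ∀ n → Agree (n ℤ.- + 2) → Agree (n ℤ.- + 1) → Agree n
  ascend n e f = *ᶠ-cancelʳ {x n} {y n} {x (n ℤ.- + 2)} {y (n ℤ.- + 2)} (y≉0 (n ℤ.- + 2)) e (products-agree n f)

  descend : ∀ n → Agree n → Agree (n ℤ.- + 1) → Agree (n ℤ.- + 2)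
  descend n e f = *ᶠ-cancelˡ {x (n ℤ.- + 2)} {y (n ℤ.- + 2)} {x n} {y n} (y≉0 n) e (products-agree n f)

  above : ∀ n → Agree (+ suc n) × Agree (+ suc (suc n))
  above zero    =
    ≃-trans {x (+ 1)} {Rat.fromRing x₁} {y (+ 1)} X.initial₁ (≃-sym {y (+ 1)} {Rat.fromRing x₁} Y.initial₁) ,
    ≃-trans {x (+ 2)} {Rat.fromRing x₂} {y (+ 2)} X.initial₂ (≃-sym {y (+ 2)} {Rat.fromRing x₂} Y.initial₂)
  above (suc n) = let e , f = above n in f , ascend (+ suc (suc (suc n))) e f

  agree-zero : Agree (+ 0)
  agree-zero = let e , f = above 0 in descend (+ 2) f e

  below : ∀ n → Agree (-[1+ n ]) × Agree (-[1+ suc n ])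
  below zero    = let e = descend (+ 1) (proj₁ (above 0)) agree-zero in e , descend (+ 0) agree-zero e
  below (suc n) = let e , f = below n in
    f , subst Agree (-[1+]-2 n) (descend -[1+ n ] e (subst Agree (≡.sym (-[1+]-1 n)) f))

  agree : ∀ n → Agree n
  agree (+ 0)     = agree-zero
  agree (+ suc n) = proj₁ (above n)
  agree -[1+ n ]  = proj₁ (below n)

double-2* : ∀ k → 2 ℕ.* k ≡ double k
double-2* zero    = ≡.refl
double-2* (suc k) = cong suc (≡.trans (ℕ.+-suc k (k ℕ.+ 0)) (cong suc (double-2* k)))

index-odd⁺ : ∀ k → + 2 ℤ.* + k ℤ.+ + 3 ≡ + (3 ℕ.+ double k)
index-odd⁺ zero    = ≡.refl
index-odd⁺ (suc k) = cong +_ (≡.trans (ℕ.+-comm (2 ℕ.* suc k) 3) (cong (3 ℕ.+_) (double-2* (suc k))))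

index-even⁺ : ∀ k → + 2 ℤ.* + suc k ℤ.+ + 2 ≡ + (4 ℕ.+ double k)
index-even⁺ k = cong +_ (≡.trans (ℕ.+-comm (2 ℕ.* suc k) 2) (cong (2 ℕ.+_) (double-2* (suc k))))

negated : ∀ k → ℤ.- (+ 2) ℤ.* + suc k ≡ -[1+ suc (double k) ]
negated k = cong -[1+_] (ℕ.suc-injective (double-2* (suc k)))

index-odd⁻ : ∀ k → ℤ.- (+ 2) ℤ.* + suc k ℤ.+ + 1 ≡ -[1+ double k ]
index-odd⁻ k = cong (ℤ._+ + 1) (negated k)

index-even⁻ : ∀ k → ℤ.- (+ 2) ℤ.* + suc (suc k) ℤ.+ + 2 ≡ -[1+ suc (double k) ]
index-even⁻ k = cong (ℤ._+ + 2) (negated (suc k))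

p-square : WeightedGraph.p square Pol.≈ O⁺ 0
p-square = from-yes (WeightedGraph.p square ≟² O⁺ 0)

numerator-p : ∀ {n G} → IsG n G → numerator n Pol.≈ WeightedGraph.p G
numerator-p G-three = Pol.sym p-square
numerator-p (G-odd⁺ (suc k) _ χ _) = Pol.trans
  (Pol.reflexive (≡.trans (cong numerator (index-odd⁺ (suc k))) (interleave-even O⁺ (E⁺ ∘ suc) (suc k)))) (Pol.sym (p-odd⁺ k χ))
numerator-p (G-odd⁻ (suc k) _ χ _) = Pol.trans
  (Pol.reflexive (≡.trans (cong numerator (index-odd⁻ k)) (interleave-even (O⁻ ∘ suc) (E⁻ ∘ suc) k))) (Pol.sym (p-odd⁻ k χ))
numerator-p (G-even⁺ (suc k) _ χ _) = Pol.trans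
  (Pol.reflexive (≡.trans (cong numerator (index-even⁺ k)) (interleave-odd O⁺ (E⁺ ∘ suc) k))) (Pol.sym (p-even⁺ k χ))
-- `G_0`, a single octagon, belongs to this family, but index 0 has its own clause in `numerator`.
numerator-p (G-even⁻ 1 _ χ _) = Pol.sym (p-even⁻ 0 χ)
numerator-p (G-even⁻ (suc (suc k)) _ χ _) = Pol.trans
  (Pol.reflexive (≡.trans (cong numerator (index-even⁻ k)) (interleave-odd (O⁻ ∘ suc) (E⁻ ∘ suc) k))) (Pol.sym (p-even⁻ (suc k) χ))

-- Admissible choices

ifOdd-elim : ∀ {A : Set} (P : A → Set) i {a b : A} → P a → P b → P (ifOdd i then a else b)
ifOdd-elim P i pa pb with parity i
... | 1ℙ = pa
... | 0ℙ = pb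

OnArc : (ℤ → Corner → Set) → Vertex × Vertex → Set
OnArc P (a , b) = OnCorner a × OnCorner b
  where
  OnCorner : Vertex → Set
  OnCorner (corner i c) = P i c
  OnCorner (new _ _ _)  = ⊥

-- A set of corners that contains all arc ends and no chosen foot separates the two, so squares and
-- arcs need not be compared pair by pair.
avoiding⇒admissible : ∀ {L χ} (P : ℤ → Corner → Set) → (∀ i s → ¬ P i (foot s (χ i s))) →
                      All (OnArc P) (Layout.arcs L) → Admissible L χ
avoiding⇒admissible P ¬P arcsP = All.universal
  (λ (i , s) → All.map (λ { {a , b} (pa , pb) → (λ { ≡.refl → ¬P i s pa }) , (λ { ≡.refl → ¬P i s pb }) }) arcsP) _

-- In the odd families all arcs end on the same side, left or right, so a constant choice works. In
-- the even families the tails are half-turn images of each other and need opposite choices; in the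
-- central octagon the arcs end at diagonally opposite corners.
χ-odd⁺ χ-odd⁻ χ-even⁺ χ-even⁻ : Choice
χ-odd⁺ _ _ = start
χ-odd⁻ _ _ = finish
χ-even⁺ (+ 0)     north = start
χ-even⁺ (+ 0)     _     = finish
χ-even⁺ (+ suc _) _     = finish
χ-even⁺ -[1+ _ ]  _     = start
χ-even⁻ (+ 0)     north = finish
χ-even⁻ (+ 0)     _     = start
χ-even⁻ (+ suc _) _     = start
χ-even⁻ -[1+ _ ]  _     = finish

data Left : Corner → Set where
  nl : Left nl
  sl : Left sl

data Right : Corner → Set where
  nr : Right nr
  sr : Right sr

¬right-start : ∀ s → ¬ Right (foot s start)
¬right-start north ()
¬right-start south ()
¬right-start east  ()
¬right-start west  ()

¬left-finish : ∀ s → ¬ Left (foot s finish)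
¬left-finish north ()
¬left-finish south ()
¬left-finish east  ()
¬left-finish west  ()

admissible-odd⁺ : ∀ k → Admissible (oddPositive k) χ-odd⁺
admissible-odd⁺ k = avoiding⇒admissible {oddPositive k} {χ-odd⁺} (λ _ → Right) (λ _ → ¬right-start)
  (All.map⁺ (All.universal (λ i → on i , on (suc i)) [1⋯ k ℕ.∸ 1 ]))
  where
  on : ∀ i → Right (ifOdd i then sr else nr)
  on i = ifOdd-elim Right i sr nr

admissible-odd⁻ : ∀ k → Admissible (oddNegative k) χ-odd⁻
admissible-odd⁻ k = avoiding⇒admissible {oddNegative k} {χ-odd⁻} (λ _ → Left) (λ _ → ¬left-finish)
  (All.map⁺ (All.universal (λ i → on i , on (suc i)) [1⋯ k ℕ.∸ 1 ]))
  where
  on : ∀ i → Left (ifOdd i then nl else sl)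
  on i = ifOdd-elim Left i nl sl

admissible-even⁺ : ∀ k → Admissible (evenPositive k) χ-even⁺
admissible-even⁺ k = avoiding⇒admissible {evenPositive k} {χ-even⁺} P
  (λ { (+ 0) north (inj₁ ()) ; (+ 0) north (inj₂ ()) ; (+ 0) south (inj₁ ()) ; (+ 0) south (inj₂ ())
     ; (+ 0) east (inj₁ ()) ; (+ 0) east (inj₂ ()) ; (+ 0) west (inj₁ ()) ; (+ 0) west (inj₂ ())
     ; (+ suc _) → ¬left-finish ; -[1+ _ ] → ¬right-start })
  (All.++⁺ (All.map⁺ (All.universal (λ i → onV (i ℕ.∸ 1) , onV i) [1⋯ k ℕ.∸ 1 ]))
           (All.map⁺ (All.universal (λ i → onU (i ℕ.∸ 1) , onU i) [1⋯ k ℕ.∸ 1 ])))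
  where
  P : ℤ → Corner → Set
  P (+ 0)     c = c ≡ sl ⊎ c ≡ nr
  P (+ suc _) c = Left c
  P -[1+ _ ]  c = Right c
  onV : ∀ i → P (pos i) (ifOdd i then nl else sl)
  onV zero    = inj₁ ≡.refl
  onV (suc i) = ifOdd-elim Left (suc i) nl sl
  onU : ∀ i → P (neg i) (ifOdd i then sr else nr)
  onU zero    = inj₂ ≡.refl
  onU (suc i) = ifOdd-elim Right (suc i) sr nr

admissible-even⁻ : ∀ k → Admissible (evenNegative k) χ-even⁻
admissible-even⁻ k = avoiding⇒admissible {evenNegative k} {χ-even⁻} P
  (λ { (+ 0) north (inj₁ ()) ; (+ 0) north (inj₂ ()) ; (+ 0) south (inj₁ ()) ; (+ 0) south (inj₂ ())
     ; (+ 0) east (inj₁ ()) ; (+ 0) east (inj₂ ()) ; (+ 0) west (inj₁ ()) ; (+ 0) west (inj₂ ())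
     ; (+ suc _) → ¬right-start ; -[1+ _ ] → ¬left-finish })
  (All.++⁺ (All.map⁺ (All.universal (λ i → onV (i ℕ.∸ 1) , onV i) [1⋯ k ℕ.∸ 1 ]))
           (All.map⁺ (All.universal (λ i → onU (i ℕ.∸ 1) , onU i) [1⋯ k ℕ.∸ 1 ])))
  where
  P : ℤ → Corner → Set
  P (+ 0)     c = c ≡ sr ⊎ c ≡ nl
  P (+ suc _) c = Right c
  P -[1+ _ ]  c = Left c
  onV : ∀ i → P (pos i) (ifOdd i then nr else sr)
  onV zero    = inj₁ ≡.refl
  onV (suc i) = ifOdd-elim Right (suc i) nr sr
  onU : ∀ i → P (neg i) (ifOdd i then sl else nl)
  onU zero    = inj₂ ≡.refl
  onU (suc i) = ifOdd-elim Left (suc i) sl nl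

-- This ensures that a claim about all `G` with `IsG n G` is never vacuous: an admissible placement
-- of the weights exists for each n.
graph : ∀ n → n ≢ + 1 → n ≢ + 2 → ∃ (IsG n)
graph n n≢1 n≢2 with index n
... | zero         = _ , G-even⁻ 1 (s≤s z≤n) χ-even⁻ (admissible-even⁻ 1)
... | one          = contradiction ≡.refl n≢1
... | two          = contradiction ≡.refl n≢2
... | odd⁺ zero    = _ , G-three
... | odd⁺ (suc k) = subst (λ n → ∃ (IsG n)) (index-odd⁺ (suc k)) (_ , G-odd⁺ (suc k) (s≤s z≤n) χ-odd⁺ (admissible-odd⁺ (suc k)))
... | even⁺ k      = subst (λ n → ∃ (IsG n)) (index-even⁺ k) (_ , G-even⁺ (suc k) (s≤s z≤n) χ-even⁺ (admissible-even⁺ (suc k)))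
... | odd⁻ k       = subst (λ n → ∃ (IsG n)) (index-odd⁻ k) (_ , G-odd⁻ (suc k) (s≤s z≤n) χ-odd⁻ (admissible-odd⁻ (suc k)))
... | even⁻ k      = subst (λ n → ∃ (IsG n)) (index-even⁻ k) (_ , G-even⁻ (suc (suc k)) (s≤s z≤n) χ-even⁻ (admissible-even⁻ (suc (suc k))))


theorem4 : ∃ IsClusterSequence ×
    (∀ x → IsClusterSequence x → ∀ n → n ≢ + 1 → n ≢ + 2 →
    ∃ (IsG n) × (∀ G → IsG n G → x n Rat.≃ p/m G n))
theorem4 = (clusterVariable , clusterVariables) , λ x cx n n≢1 n≢2 → graph n n≢1 n≢2 , λ G g →
  ≃-trans {x n} {clusterVariable n} {p/m G n} (Uniqueness.agree cx clusterVariables numerator≉0 n)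
    -- Both fractions have the denominator `m n`, so it suffices that the numerators agree.
    (Pol.*-congʳ {m n} {numerator n} {WeightedGraph.p G} (numerator-p g))
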